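{- Let $q=p^h$ with $p$ prime, let $m>1$ be a divisor of $n$, let $k$ be a positive integer with $\gcd(k,n)=1$, let $t\in\{1,\ldots,m-2\}$, let $s$ be an integer with $s\not\equiv 0,\pm1,\pm2 \pmod m$ and $\gcd(n,sk-t)<m$, and let $\mu\in\mathbb F_{q^n}$, $\mu\neq 0$, with $\mathrm N_{q^n/q}(\mu)\neq(-1)^{nt}$. Let $$\mathcal H^{(k)}_{m,n,t,\mu,s}=\Gamma^{(k)}_{m,n,t,\mu,s}\oplus\Omega^{(k)}_1\oplus\cdots\oplus\Omega^{(k)}_{t-1},\qquad \Gamma^{(k)}_{m,n,t,\mu,s}=\{f^{(k)}_{a,0}+f^{(k)}_{\mu a^{q^{sk}},t}: a\in\mathbb F_{q^n}\}.$$ Then $\mathcal H^{(k)}_{m,n,t,\mu,s}$ is not equivalent to any generalized Gabidulin code.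
   Context: $\mathbb F_{q^m}\subseteq \mathbb F_{q^n}$ since $m\mid n$. $\mathrm{Tr}:\mathbb F_{q^n}\to\mathbb F_q$, $y\mapsto\sum_{i=0}^{n-1}y^{q^i}$, and $\mathrm N_{q^n/q}(y)=\prod_{i=0}^{n-1}y^{q^i}$. $\Omega_{m,n}$ denotes the $mn$-dimensional $\mathbb F_q$-space of all $\mathbb F_q$-bilinear forms $f:\mathbb F_{q^m}\times\mathbb F_{q^n}\to\mathbb F_q$ (the fields being regarded as $\mathbb F_q$-vector spaces of dimensions $m$ and $n$); the rank of $f$ is $m$ minus the dimension of its left radical $\{x:f(x,x')=0\ \forall x'\}$, and the distance between two forms is the rank of their difference. For $a\in\mathbb F_{q^n}$ and $0\le j\le m-1$ put $f^{(k)}_{a,j}(x,x')=\mathrm{Tr}(a\,x\,x'^{q^{kj}})$ and $\Omega^{(k)}_j=\{f^{(k)}_{a,j}:a\in\mathbb F_{q^n}\}$. $\mathrm{Aut}(\Omega_{m,n})$ is the group of all invertible $\mathbb F_q$-semilinear transformations of $\Omega_{m,n}$ preserving rank; it is generated by the maps $f\mapsto f^{(g,g')}$, $f^{(g,g')}(x,x')=f(g(x),g'(x'))$ with $g\in\mathrm{GL}_{\mathbb F_q}(\mathbb F_{q^m})$, $g'\in\mathrm{GL}_{\mathbb F_q}(\mathbb F_{q^n})$, the map $f\mapsto f^\phi$ with $f^\phi(x,x')=\big(f(x^{p^{ -1}},x'^{p^{ -1}})\big)^p$ (where $y^{p^{ -1}}$ denotes the inverse of the Frobenius map), and, if $m=n$,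 transposition $f\mapsto f^\top$, $f^\top(x,x')=f(x',x)$. Two subsets of $\Omega_{m,n}$ are equivalent if one is mapped onto the other by an element of $\mathrm{Aut}(\Omega_{m,n})$. Generalized Gabidulin codes: for $\mathbb F_q$-linearly independent $g_0,\ldots,g_{m-1}\in\mathbb F_{q^n}$, $1\le t'\le m$, an integer $j$ with $\gcd(j,n)=1$ and an $\mathbb F_q$-basis $\{u_0,\ldots,u_{n-1}\}$ of $\mathbb F_{q^n}$, let $\mathcal L^{(j)}_{t'}=\{\sum_{i=0}^{t'-1}c_ix^{q^{ji}}: c_i\in\mathbb F_{q^n}\}$; the set of $m\times n$ matrices over $\mathbb F_q$ whose $i$-th row is the coordinate vector of $F(g_i)$ in the basis $\{u_l\}$, for $F$ ranging in $\mathcal L^{(j)}_{t'}$, is a generalized Gabidulin code in $M_{m,n}(\mathbb F_q)$. A subset of $\Omega_{m,n}$ is a generalized Gabidulin code if for some $\mathbb F_q$-bases $\{e_i\}$ of $\mathbb F_{q^m}$ and $\{e'_l\}$ of $\mathbb F_{q^n}$ the set of matrices $(f(e_i,e'_l))_{i,l}$ of its elements is a generalized Gabidulin code in $M_{m,n}(\mathbb F_q)$. -}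

module Defs where

open import Level using (0ℓ)
open import Data.Nat as ℕ using (ℕ; zero; suc)
open import Data.Integer as ℤ using (ℤ; +_)
open import Data.Integer.DivMod using (_%ℕ_)
open import Data.Fin using (Fin; toℕ)
import Data.Fin as Fin
open import Data.Product using (Σ; ∃; _×_; _,_)
open import Relation.Binary.PropositionalEquality using (_≡_; _≢_)
open import Relation.Nullary using (¬_)
open import Algebra.Core using (Op₁; Op₂)
open import Algebra.Structures using (IsCommutativeRing)
open import Function.Bundles using (_⇔_)

-- Fields (with propositional equality).  A finite field F_{q^n} is a
-- Field whose carrier is in bijection with Fin (q ^ n) (stated in the
-- theorem).

record Field : Set₁ where
  field
    Carrier : Set
    _+_ _*_ : Op₂ Carrier
    -_ : Op₁ Carrier
    0# 1# : Carrier
    isCommutativeRing : IsCommutativeRing _≡_ _+_ _*_ -_ 0# 1#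
    0≢1 : 0# ≢ 1#
    inverse : ∀ x → x ≢ 0# → Σ Carrier λ y → x * y ≡ 1#
  infixl 6 _+_
  infixl 7 _*_
  infix 8 -_

IntCong : ℤ → ℤ → ℕ → Set
IntCong a b m = (+ m) Data.Integer.Divisibility.∣ (a ℤ.- b)
  where import Data.Integer.Divisibility

gcdℤ : ℕ → ℤ → ℕ
gcdℤ n z = Data.Nat.GCD.gcd n ℤ.∣ z ∣
  where import Data.Nat.GCD

intMod : ℤ → ℕ → ℕ
intMod e zero = 0
intMod e (suc n) = e %ℕ suc n

-- Everything inside the field K = F_{q^n}, with F_q = {x | x^q = x}
-- and F_{q^m} = {x | x^(q^m) = x}.

module Setup (F : Field) (q n m : ℕ) where
  open Field F renaming (Carrier to K)

  pow : K → ℕ → K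
  pow x zero = 1#
  pow x (suc e) = x * pow x e

  -- x ↦ x^(q^e) for an integer e (exponent taken modulo n, as
  -- x^(q^n) = x on F_{q^n}; negative e = inverse Frobenius powers)
  frobℤ : ℤ → K → K
  frobℤ e x = pow x (q ℕ.^ intMod e n)

  sumN : ℕ → (ℕ → K) → K
  sumN zero f = 0#
  sumN (suc i) f = sumN i f + f i

  prodN : ℕ → (ℕ → K) → K
  prodN zero f = 1#
  prodN (suc i) f = prodN i f * f i

  sumF : ∀ {d} → (Fin d → K) → K
  sumF {zero} f = 0#
  sumF {suc d} f = f Fin.zero + sumF (λ i → f (Fin.suc i))

  Tr : K → K
  Tr y = sumN n (λ i → pow y (q ℕ.^ i))

  Norm : K → K
  Norm y = prodN n (λ i → pow y (q ℕ.^ i))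

  InFq : K → Set
  InFq x = pow x q ≡ x

  InFqm : K → Set
  InFqm x = pow x (q ℕ.^ m) ≡ x

  lc : ∀ {d} → (Fin d → K) → (Fin d → K) → K
  lc c b = sumF (λ i → c i * b i)

  LinIndep : ∀ {d} → (Fin d → K) → Set
  LinIndep b = ∀ c → (∀ i → InFq (c i)) → lc c b ≡ 0# → ∀ i → c i ≡ 0#

  Spans : ∀ {d} → (K → Set) → (Fin d → K) → Set
  Spans V b = ∀ x → V x → Σ (Fin _ → K) λ c → (∀ i → InFq (c i)) × lc c b ≡ x

  IsBasis : ∀ {d} → (K → Set) → (Fin d → K) → Set
  IsBasis V b = (∀ i → V (b i)) × LinIndep b × Spans V b

  HasDim : (K → Set) → ℕ → Set
  HasDim V d = Σ (Fin d → K) λ b → IsBasis V b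

  Whole : K → Set
  Whole _ = ⊤' where open import Data.Unit using () renaming (⊤ to ⊤')

  -- Ω_{m,n}: F_q-bilinear forms F_{q^m} × F_{q^n} → F_q, represented
  -- by functions K → K → K whose first argument is only used on
  -- F_{q^m}.

  RawForm : Set
  RawForm = K → K → K

  IsForm : RawForm → Set
  IsForm f =
      (∀ x x' → InFqm x → InFq (f x x'))
    × (∀ x y x' → InFqm x → InFqm y → f (x + y) x' ≡ f x x' + f y x')
    × (∀ x x' y' → InFqm x → f x (x' + y') ≡ f x x' + f x y')
    × (∀ λ' x x' → InFq λ' → InFqm x → f (λ' * x) x' ≡ λ' * f x x')
    × (∀ λ' x x' → InFq λ' → InFqm x → f x (λ' * x') ≡ λ' * f x x')

  _≈_ : RawForm → RawForm → Set
  f ≈ g = ∀ x x' → InFqm x → f x x' ≡ g x x'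

  _⊕_ : RawForm → RawForm → RawForm
  (f ⊕ g) x x' = f x x' + g x x'

  _·_ : K → RawForm → RawForm
  (λ' · f) x x' = λ' * f x x'

  LeftRadical : RawForm → K → Set
  LeftRadical f x = InFqm x × (∀ x' → f x x' ≡ 0#)

  Rank : RawForm → ℕ → Set
  Rank f r = r ℕ.≤ m × HasDim (LeftRadical f) (m ℕ.∸ r)

  IsFqAut : (K → K) → Set
  IsFqAut σ =
      (∀ x → InFq x → InFq (σ x))
    × (∀ x y → InFq x → InFq y → σ (x + y) ≡ σ x + σ y)
    × (∀ x y → InFq x → InFq y → σ (x * y) ≡ σ x * σ y)
    × (∀ x y → InFq x → InFq y → σ x ≡ σ y → x ≡ y)
    × (∀ y → InFq y → Σ K λ x → InFq x × σ x ≡ y)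

  IsAut : (RawForm → RawForm) → Set
  IsAut T =
      (∀ f → IsForm f → IsForm (T f))
    × (∀ f g → IsForm f → IsForm g → f ≈ g → T f ≈ T g)
    × (∀ f g → IsForm f → IsForm g → T (f ⊕ g) ≈ (T f ⊕ T g))
    × (Σ (K → K) λ σ → IsFqAut σ
         × (∀ λ' f → InFq λ' → IsForm f → T (λ' · f) ≈ (σ λ' · T f)))
    × (∀ f g → IsForm f → IsForm g → T f ≈ T g → f ≈ g)
    × (∀ g → IsForm g → Σ RawForm λ f → IsForm f × T f ≈ g)
    × (∀ f r → IsForm f → (Rank f r ⇔ Rank (T f) r))

  Equivalent : (RawForm → Set) → (RawForm → Set) → Set
  Equivalent A B = Σ (RawForm → RawForm) λ T → IsAut T
    × (∀ f → B f ⇔ Σ RawForm λ g → A g × T g ≈ f)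

  IsGeneralizedGabidulin : (RawForm → Set) → Set
  IsGeneralizedGabidulin C =
    Σ ℕ λ t' → 1 ℕ.≤ t' × t' ℕ.≤ m ×
    Σ ℤ λ j → Data.Nat.GCD.gcd ℤ.∣ j ∣ n ≡ 1 ×
    Σ (Fin m → K) λ g → LinIndep g ×
    Σ (Fin n → K) λ u → IsBasis Whole u ×
    Σ (Fin m → K) λ e → IsBasis InFqm e ×
    Σ (Fin n → K) λ e' → IsBasis Whole e' ×
    (∀ f → C f ⇔
      (IsForm f × Σ (Fin t' → K) λ c →
        ∀ i → sumF (λ l → f (e i) (e' l) * u l)
              ≡ sumF (λ r → c r * frobℤ (j ℤ.* + toℕ r) (g i))))
    where import Data.Nat.GCD

  fForm : ℕ → K → ℕ → RawForm
  fForm k a j x x' = Tr (a * x * pow x' (q ℕ.^ (k ℕ.* j)))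

  H : (k t : ℕ) (μ : K) (s : ℤ) → RawForm → Set
  H k t μ s f = IsForm f ×
    Σ K λ a → Σ (ℕ → K) λ b →
      f ≈ ((fForm k a 0 ⊕ fForm k (μ * frobℤ (s ℤ.* + k) a) t)
           ⊕ (λ x x' → sumN (t ℕ.∸ 1) (λ i → fForm k (b i) (suc i) x x')))

-- Let K = F_{q^n}.  Through the trace form, bilinear forms become F_q-linear maps
-- F_{q^m} → K, and these expand uniquely as Σ_{i<m} c_i σ^i for a generator σ of
-- Gal(K / F_q).  The code H consists of the maps Σ_{i≤t} c_i σ^i with c_t = η κ(c_0)
-- for some κ in the Galois group, while a Gabidulin code is Σ_r K θ^r γ for another
-- generator θ.  A rank-preserving T maps each α ⊗ K either into some β ⊗ K or into
-- some F_q^m ⊗ d, and by connectedness the same alternative holds for all α.  In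
-- either case the natural left, respectively right, action of K on the Gabidulin
-- code pulls back along T to an action X of the field K on H by left
-- multiplications, and H = Σ_r X(K) Y^r γ with Y X(c) = X(θ c) Y.
--
-- Left multiplications preserving H are F_{q^m}-linear.  As X(K) is its own
-- centraliser it contains F_{q^m}, so H is closed under F_{q^m}: hence κ is trivial
-- on F_{q^m} (which settles t = 1), and Y is θ-semilinear over F_{q^m}, shifting the
-- exponents of σ.  Some power of σ does not occur in H, so the exponents can be
-- ordered linearly by this shift.  For t ≥ 2, comparing extreme terms shows that γ is
-- a monomial, since H contains the monomial σ; but then H would contain the monomial
-- σ^0, which is coupled to σ^t.
module Submission where

open import Defs
open import Data.Nat as ℕ using (ℕ; zero; suc; _!; _≤_; _<_; _∸_; _^_)
import Data.Nat.Properties as ℕₚ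
import Data.Nat.Solver as ℕSolver
open import Data.Nat.Combinatorics using (nCk≡n!/k![n-k]!; nCn≡1; [n∸k]!k!∣n!)
import Data.Nat.Combinatorics as Combinatorics
open import Data.Nat.Coprimality using (Coprime; coprime-Bézout; coprime-divisor)
import Data.Nat.Coprimality as Coprimality
open import Data.Nat.Divisibility using (_∣_; divides; ∣⇒≤; m∣m*n; ∣-trans; ∣1⇒≡1)
open import Data.Nat.DivMod using
  ( _%_; _/_; m/n*n≡m; m%n<n; m%n%n≡m%n; m<n⇒m%n≡m; m≡m%n+[m/n]*n; %-distribˡ-+; %-distribˡ-*
  ; [m+kn]%n≡m%n )
open import Data.Nat.GCD using (gcd; gcd-greatest; module Bézout)
open import Data.Nat.Primality using (Prime; euclidsLemma; prime⇒nonZero; prime⇒nonTrivial)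
open import Data.Integer as ℤ using (ℤ)
open import Data.Integer.DivMod using (a≡a%ℕn+[a/ℕn]*n; _/ℕ_)
import Data.Integer.Divisibility as ℤ∣
import Data.Integer.Divisibility.Signed as Signed
import Data.Integer.Properties as ℤₚ
import Data.Integer.Solver as ℤSolver
open import Data.Fin as Fin using (Fin; toℕ)
import Data.Fin.Properties as Finₚ
open import Data.Maybe using (Maybe; just; nothing)
open import Data.Product using (Σ; _×_; _,_; proj₁; proj₂)
open import Data.Sum using (_⊎_; inj₁; inj₂)
open import Data.Empty using (⊥; ⊥-elim)
open import Data.Vec.Functional using (insertAt)
open import Data.Vec.Functional.Properties using (insertAt-lookup; insertAt-punchIn)
open import Function using (_∘_)
open import Function.Bundles using (_↔_; Inverse; mk↔ₛ′; Equivalence)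
open import Relation.Binary.Definitions using (DecidableEquality)
open import Relation.Binary.PropositionalEquality hiding (J)
open import Relation.Nullary using (¬_; Dec; yes; no)
open import Relation.Nullary.Decidable using (¬?; decidable-stable; map′)
open import Algebra.Bundles using (CommutativeRing; RawRing)
import Algebra.Properties.CommutativeMonoid.Sum
import Algebra.Properties.CommutativeSemiring.Binomial
import Algebra.Properties.Ring
import Algebra.Properties.Semiring.Exp
import Algebra.Properties.Semiring.Mult
import Algebra.Solver.Ring
open import Algebra.Solver.Ring.AlmostCommutativeRing
  using (AlmostCommutativeRing; fromCommutativeRing; _-Raw-AlmostCommutative⟶_)
import Algebra.Solver.Ring.NaturalCoefficients.Default

open ≡-Reasoning

-- The code is closed under multiplication by y in K only if κ fixes y, so the field X(K) obtained
-- from T cannot simply be compared with multiplication by K, and the proof never determines it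
-- completely. What rescues the argument is that powers of σ on F_{q^m} matter only modulo m. Once
-- X(K) contains the scalars of F_{q^m}, semilinearity over F_{q^m} already decides which exponent a
-- term occupies. The coefficients are then moved by unknown injective maps, but only their
-- vanishing is ever used. The case F_q^m ⊗ d is possible only for n = m: T embeds α ⊗ K, of
-- dimension n, semilinearly into a space of dimension m. The evaluation points of the Gabidulin
-- code are then a basis of K, and this is what makes a right action of K available.

infixr 5 _∙_
_∙_ : {A : Set} {x y z : A} → x ≡ y → y ≡ z → x ≡ z
_∙_ = trans

-- Binomial coefficients modulo a prime.

prime∤! : ∀ {p} → Prime p → ∀ k → k < p → ¬ (p ∣ k !)
prime∤! {p} pp zero _ p∣1 =
  ℕₚ.<⇒≱ (ℕ.nonTrivial⇒n>1 p {{prime⇒nonTrivial pp}}) (∣⇒≤ p∣1)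
prime∤! pp (suc k) k<p p∣k! with euclidsLemma (suc k) (k !) pp p∣k!
... | inj₁ p∣1+k = ℕₚ.<⇒≱ k<p (∣⇒≤ p∣1+k)
... | inj₂ p∣k!′ = prime∤! pp k (ℕₚ.<-trans (ℕₚ.n<1+n k) k<p) p∣k!′

-- In `p ! = C(p,k) * (k ! * (p - k) !)` the prime divides the left side but neither factorial on
-- the right.
prime∣C : ∀ {p} → Prime p → ∀ k → 0 < k → k < p → p ∣ (p Combinatorics.C k)
prime∣C {p} pp k 0<k k<p with euclidsLemma (p Combinatorics.C k) (k ! ℕ.* (p ∸ k) !) pp p∣product
  where
  instance _ = k ℕₚ.!* (p ∸ k) !≢0
  product≡p! : (p Combinatorics.C k) ℕ.* (k ! ℕ.* (p ∸ k) !) ≡ p !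
  product≡p! = cong (ℕ._* (k ! ℕ.* (p ∸ k) !)) (nCk≡n!/k![n-k]! (ℕₚ.<⇒≤ k<p)) ∙
    m/n*n≡m (subst (_∣ p !) (ℕₚ.*-comm ((p ∸ k) !) (k !)) ([n∸k]!k!∣n! (ℕₚ.<⇒≤ k<p)))
  p∣p! : ∀ r → 0 < r → r ∣ r !
  p∣p! (suc r) _ = m∣m*n (r !)
  p∣product : p ∣ (p Combinatorics.C k) ℕ.* (k ! ℕ.* (p ∸ k) !)
  p∣product = subst (p ∣_) (sym product≡p!) (p∣p! p (ℕₚ.<-trans 0<k k<p))
... | inj₁ p∣C = p∣C
... | inj₂ p∣k!r! with euclidsLemma (k !) ((p ∸ k) !) pp p∣k!r!
...   | inj₁ p∣k! = ⊥-elim (prime∤! pp k k<p p∣k!)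
...   | inj₂ p∣r! = ⊥-elim (prime∤! pp (p ∸ k) (ℕₚ.∸-monoʳ-< 0<k (ℕₚ.<⇒≤ k<p)) p∣r!)

iterate : {A : Set} → (A → A) → ℕ → A → A
iterate f zero x = x
iterate f (suc r) x = f (iterate f r x)

module Rearrangements where
  open ℕSolver.+-*-Solver

  wrap : ∀ g a r → g ℕ.* a ℕ.+ (r ℕ.+ g) ≡ r ℕ.+ g ℕ.* (a ℕ.+ 1)
  wrap = solve 3 (λ g a r → g :* a :+ (r :+ g) := r :+ g :* (a :+ con 1)) refl

  shift : ∀ z r ν j → z ℕ.+ (r ℕ.+ ν) ℕ.* j ≡ r ℕ.* j ℕ.+ (z ℕ.+ ν ℕ.* j)
  shift = solve 4 (λ z r ν j → z :+ (r :+ ν) :* j := r :* j :+ (z :+ ν :* j)) refl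

  exchange : ∀ a b c → a ℕ.+ (b ℕ.+ c) ≡ b ℕ.+ (a ℕ.+ c)
  exchange = solve 3 (λ a b c → a :+ (b :+ c) := b :+ (a :+ c)) refl

-- Extreme indices of a finite family.

module Search {A : Set} (Z : A → Set) (Z? : ∀ x → Dec (Z x)) where
  first : ∀ d (f : ℕ → A) → (Σ ℕ λ r → r < d × ¬ Z (f r)) →
          Σ ℕ λ r → r < d × ¬ Z (f r) × (∀ s → s < r → Z (f s))
  first (suc d) f (r , r<1+d , ¬Zr) with Z? (f 0)
  ... | no ¬Z0 = 0 , ℕ.z<s , ¬Z0 , λ _ ()
  first (suc d) f (zero , _ , ¬Z0) | yes Z0 = ⊥-elim (¬Z0 Z0)
  first (suc d) f (suc r , ℕ.s<s r<d , ¬Zr) | yes Z0 with first d (f ∘ suc) (r , r<d , ¬Zr)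
  ... | a , a<d , ¬Za , below = suc a , ℕ.s<s a<d , ¬Za , λ { zero _ → Z0 ; (suc s) (ℕ.s<s s<a) → below s s<a }

  last : ∀ d (f : ℕ → A) → (Σ ℕ λ r → r < d × ¬ Z (f r)) →
         Σ ℕ λ r → r < d × ¬ Z (f r) × (∀ s → r < s → s < d → Z (f s))
  last (suc d) f (r , r<1+d , ¬Zr) with Z? (f d)
  ... | no ¬Zd = d , ℕₚ.n<1+n d , ¬Zd , λ s d<s s<1+d → ⊥-elim (ℕₚ.<⇒≱ d<s (ℕ.s≤s⁻¹ s<1+d))
  ... | yes Zd with r ℕ.≟ d
  ...   | yes refl = ⊥-elim (¬Zr Zd)
  ...   | no r≢d with last d f (r , ℕₚ.≤∧≢⇒< (ℕ.s≤s⁻¹ r<1+d) r≢d , ¬Zr)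
  ...     | b , b<d , ¬Zb , above = b , ℕₚ.m<n⇒m<1+n b<d , ¬Zb , beyond
    where
    beyond : ∀ s → b < s → s < suc d → Z (f s)
    beyond s b<s s<1+d with s ℕ.≟ d
    ... | yes refl = Zd
    ... | no s≢d = above s b<s (ℕₚ.≤∧≢⇒< (ℕ.s≤s⁻¹ s<1+d) s≢d)

-- Congruences modulo m on natural numbers.

module Congruence (m : ℕ) {{_ : ℕ.NonZero m}} where
  infix 4 _≋_
  _≋_ : ℕ → ℕ → Set
  a ≋ b = a % m ≡ b % m

  ≋-+ : ∀ {a b c d} → a ≋ b → c ≋ d → a ℕ.+ c ≋ b ℕ.+ d
  ≋-+ {a} {b} {c} {d} a≋b c≋d = %-distribˡ-+ a c m ∙
    cong₂ (λ x y → (x ℕ.+ y) % m) a≋b c≋d ∙ sym (%-distribˡ-+ b d m)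

  ≋-+ˡ : ∀ c {a b} → a ≋ b → c ℕ.+ a ≋ c ℕ.+ b
  ≋-+ˡ c {a} {b} = ≋-+ {c} {c} {a} {b} refl

  ≋-%  : ∀ a → a % m ≋ a
  ≋-% a = m%n%n≡m%n a m

  ≋-multiple : ∀ a k → a ℕ.+ k ℕ.* m ≋ a
  ≋-multiple a k = [m+kn]%n≡m%n a k m

  -- There are no negatives in ℕ; `pred m * c` serves as the negative of `c` modulo `m`.
  ≋-+-cancelˡ : ∀ c {a b} → c ℕ.+ a ≋ c ℕ.+ b → a ≋ b
  ≋-+-cancelˡ c {a} {b} eq = sym (unwind a) ∙ ≋-+ˡ (ℕ.pred m ℕ.* c) eq ∙ unwind b
    where
    unwind : ∀ a → ℕ.pred m ℕ.* c ℕ.+ (c ℕ.+ a) ≋ a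
    unwind a = cong (_% m) (begin
      ℕ.pred m ℕ.* c ℕ.+ (c ℕ.+ a) ≡⟨ ℕₚ.+-assoc (ℕ.pred m ℕ.* c) c a ⟨
      ℕ.pred m ℕ.* c ℕ.+ c ℕ.+ a   ≡⟨ cong (ℕ._+ a) (ℕₚ.+-comm (ℕ.pred m ℕ.* c) c) ⟩
      suc (ℕ.pred m) ℕ.* c ℕ.+ a   ≡⟨ cong (λ k → k ℕ.* c ℕ.+ a) (ℕₚ.suc-pred m) ⟩
      m ℕ.* c ℕ.+ a                ≡⟨ ℕₚ.+-comm (m ℕ.* c) a ⟩
      a ℕ.+ m ℕ.* c                ≡⟨ cong (a ℕ.+_) (ℕₚ.*-comm m c) ⟩
      a ℕ.+ c ℕ.* m                ∎) ∙ ≋-multiple a c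

  ≋-+-cancelʳ : ∀ c {a b} → a ℕ.+ c ≋ b ℕ.+ c → a ≋ b
  ≋-+-cancelʳ c {a} {b} eq = ≋-+-cancelˡ c
    (cong (_% m) (ℕₚ.+-comm c a) ∙ eq ∙ cong (_% m) (ℕₚ.+-comm b c))

-- Units modulo m and the passage between ℕ and ℤ.

module Units (m : ℕ) {{_ : ℕ.NonZero m}} where
  open import Data.Integer using (+_; -[1+_])
  open Congruence m

  Unit : ℕ → Set
  Unit g = Σ ℕ λ a → a ℕ.* g ≋ 1

  ≋-* : ∀ c {a b} → a ≋ b → c ℕ.* a ≋ c ℕ.* b
  ≋-* c {a} {b} a≋b = %-distribˡ-* c a m ∙
    cong (λ x → (c % m ℕ.* x) % m) a≋b ∙ sym (%-distribˡ-* c b m)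

  ≡⇒≋ : ∀ {a b} → a ≡ b → a ≋ b
  ≡⇒≋ = cong (_% m)

  unit-cancel : ∀ {g} → Unit g → ∀ {i k} → i ℕ.* g ≋ k ℕ.* g → i ≋ k
  unit-cancel {g} (a , ag≋1) {i} {k} eq = sym (undo i) ∙ ≋-* a {i ℕ.* g} {k ℕ.* g} eq ∙ undo k
    where
    undo : ∀ i → a ℕ.* (i ℕ.* g) ≋ i
    undo i = ≡⇒≋ (sym (ℕₚ.*-assoc a i g) ∙ cong (ℕ._* g) (ℕₚ.*-comm a i) ∙ ℕₚ.*-assoc i a g) ∙
      ≋-* i {a ℕ.* g} {1} ag≋1 ∙ ≡⇒≋ (ℕₚ.*-identityʳ i)

  unit-surjective : ∀ {g} → Unit g → ∀ r → Σ ℕ λ i → i < m × i ℕ.* g ≋ r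
  unit-surjective {g} (a , ag≋1) r = i , m%n<n (r ℕ.* a) m ,
    ≡⇒≋ (ℕₚ.*-comm i g) ∙ ≋-* g {i} {r ℕ.* a} (m%n%n≡m%n (r ℕ.* a) m) ∙
      ≡⇒≋ (ℕₚ.*-comm g (r ℕ.* a) ∙ ℕₚ.*-assoc r a g) ∙
        ≋-* r {a ℕ.* g} {1} ag≋1 ∙ ≡⇒≋ (ℕₚ.*-identityʳ r)
    where
    i : ℕ
    i = (r ℕ.* a) % m

  unit-* : ∀ {f g} → Unit f → Unit g → Unit (f ℕ.* g)
  unit-* {f} {g} (a , af≋1) (b , bg≋1) = a ℕ.* b , ≡⇒≋ (begin
      a ℕ.* b ℕ.* (f ℕ.* g)     ≡⟨ ℕₚ.*-assoc a b (f ℕ.* g) ⟩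
      a ℕ.* (b ℕ.* (f ℕ.* g))   ≡⟨ cong (a ℕ.*_) (ℕₚ.*-assoc b f g) ⟨
      a ℕ.* (b ℕ.* f ℕ.* g)     ≡⟨ cong (λ x → a ℕ.* (x ℕ.* g)) (ℕₚ.*-comm b f) ⟩
      a ℕ.* (f ℕ.* b ℕ.* g)     ≡⟨ cong (a ℕ.*_) (ℕₚ.*-assoc f b g) ⟩
      a ℕ.* (f ℕ.* (b ℕ.* g))   ≡⟨ ℕₚ.*-assoc a f (b ℕ.* g) ⟨
      a ℕ.* f ℕ.* (b ℕ.* g)     ∎) ∙
    ≋-* (a ℕ.* f) {b ℕ.* g} {1} bg≋1 ∙ ≡⇒≋ (ℕₚ.*-identityʳ (a ℕ.* f)) ∙ af≋1

  multiple≋0 : ∀ k → k ℕ.* m ≋ 0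
  multiple≋0 = ≋-multiple 0

  divisible≋0 : ∀ {n} → m ∣ n → n ≋ 0
  divisible≋0 (divides k refl) = multiple≋0 k

  coprime⇒unit : ∀ {g} → Coprime g m → Unit g
  coprime⇒unit {g} coprime = from-Bézout (coprime-Bézout coprime)
    where
    from-Bézout : Bézout.Identity 1 g m → Unit g
    from-Bézout (Bézout.+- x y 1+ym≡xg) = x , ≡⇒≋ (sym 1+ym≡xg) ∙ ≋-multiple 1 y
    -- Here `x * g` is -1 modulo `m`, so the inverse of `g` is -x, written `pred m * x`.
    from-Bézout (Bézout.-+ x y 1+xg≡ym) = ℕ.pred m ℕ.* x , ≋-+-cancelʳ (x ℕ.* g) {ℕ.pred m ℕ.* x ℕ.* g} {1} (begin
        (ℕ.pred m ℕ.* x ℕ.* g ℕ.+ x ℕ.* g) % m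
          ≡⟨ ≡⇒≋ (cong (ℕ._+ x ℕ.* g) (ℕₚ.*-assoc (ℕ.pred m) x g)) ⟩
        (ℕ.pred m ℕ.* (x ℕ.* g) ℕ.+ x ℕ.* g) % m
          ≡⟨ ≡⇒≋ ((ℕₚ.+-comm _ (x ℕ.* g)) ∙ cong (ℕ._* (x ℕ.* g)) (ℕₚ.suc-pred m)) ⟩
        (m ℕ.* (x ℕ.* g)) % m
          ≡⟨ ≡⇒≋ (ℕₚ.*-comm m (x ℕ.* g)) ∙ multiple≋0 (x ℕ.* g) ⟩
        0 % m
          ≡⟨ multiple≋0 y ⟨
        (y ℕ.* m) % m
          ≡⟨ ≡⇒≋ 1+xg≡ym ⟨
        (1 ℕ.+ x ℕ.* g) % m ∎)

  -- n - 1 ≡ -1 modulo a divisor m of n.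
  pred-unit : ∀ n {{_ : ℕ.NonZero n}} → m ∣ n → Unit (ℕ.pred n)
  pred-unit (suc n) m∣1+n = n , ≋-+-cancelʳ n {n ℕ.* n} {1}
    (≡⇒≋ (ℕₚ.+-comm (n ℕ.* n) n ∙ sym (ℕₚ.*-suc n n)) ∙
      ≋-* n {suc n} {0} (divisible≋0 m∣1+n) ∙ ≡⇒≋ (ℕₚ.*-zeroʳ n) ∙ sym (divisible≋0 m∣1+n))

  ≋-from-ℤ : ∀ {x y} c → + x ≡ + y ℤ.+ c ℤ.* + m → x ≋ y
  ≋-from-ℤ {x} {y} (+ c) eq = ≡⇒≋ (ℤₚ.+-injective (begin
      + x                       ≡⟨ eq ⟩
      + y ℤ.+ + c ℤ.* + m       ≡⟨ cong (ℤ._+_ (+ y)) (ℤₚ.pos-* c m) ⟨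
      + y ℤ.+ + (c ℕ.* m)       ≡⟨ ℤₚ.pos-+ y (c ℕ.* m) ⟨
      + (y ℕ.+ c ℕ.* m)         ∎)) ∙ ≋-multiple y c
  ≋-from-ℤ {x} {y} -[1+ c ] eq = sym (≡⇒≋ (ℤₚ.+-injective (begin
      + y                                               ≡⟨ cancel (+ y) -[1+ c ] (+ m) ⟩
      (+ y ℤ.+ -[1+ c ] ℤ.* + m) ℤ.+ + suc c ℤ.* + m    ≡⟨ cong (ℤ._+ (+ suc c ℤ.* + m)) eq ⟨
      + x ℤ.+ + suc c ℤ.* + m                           ≡⟨ cong (ℤ._+_ (+ x)) (ℤₚ.pos-* (suc c) m) ⟨
      + x ℤ.+ + (suc c ℕ.* m)                           ≡⟨ ℤₚ.pos-+ x (suc c ℕ.* m) ⟨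
      + (x ℕ.+ suc c ℕ.* m)                             ∎)) ∙ ≋-multiple x (suc c))
    where
    cancel : ∀ y c m → y ≡ (y ℤ.+ c ℤ.* m) ℤ.+ (ℤ.- c) ℤ.* m
    cancel = solve 3 (λ y c m → y := (y :+ c :* m) :+ (:- c) :* m) refl
      where open ℤSolver.+-*-Solver

  ≋-to-ℤ : ∀ {z r b} c → z ≡ + r ℤ.+ c ℤ.* + m → r ≋ b → (+ m) ℤ∣.∣ (z ℤ.- + b)
  ≋-to-ℤ {z} {r} {b} c eq r≋b = Signed.∣⇒∣ᵤ (Signed.divides (+ (r / m) ℤ.+ c ℤ.- + (b / m)) (begin
      z ℤ.- + b
        ≡⟨ cong₂ ℤ._-_ (eq ∙ cong (ℤ._+ c ℤ.* + m) (cong +_ (m≡m%n+[m/n]*n r m) ∙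
          split r)) (cong +_ (m≡m%n+[m/n]*n b m) ∙ split b) ⟩
      (+ (r % m) ℤ.+ + (r / m) ℤ.* + m ℤ.+ c ℤ.* + m) ℤ.- (+ (b % m) ℤ.+ + (b / m) ℤ.* + m)
        ≡⟨ cong (λ x → (+ x ℤ.+ + (r / m) ℤ.* + m ℤ.+ c ℤ.* + m) ℤ.- (+ (b % m) ℤ.+ + (b / m) ℤ.* + m)) r≋b ⟩
      (+ (b % m) ℤ.+ + (r / m) ℤ.* + m ℤ.+ c ℤ.* + m) ℤ.- (+ (b % m) ℤ.+ + (b / m) ℤ.* + m)
        ≡⟨ collect (+ (b % m)) (+ (r / m)) c (+ (b / m)) (+ m) ⟩
      (+ (r / m) ℤ.+ c ℤ.- + (b / m)) ℤ.* + m ∎))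
    where
    split : ∀ r → + (r % m ℕ.+ r / m ℕ.* m) ≡ + (r % m) ℤ.+ + (r / m) ℤ.* + m
    split r = ℤₚ.pos-+ (r % m) (r / m ℕ.* m) ∙ cong (ℤ._+_ (+ (r % m))) (ℤₚ.pos-* (r / m) m)
    collect : ∀ x r c b m → (x ℤ.+ r ℤ.* m ℤ.+ c ℤ.* m) ℤ.- (x ℤ.+ b ℤ.* m) ≡ (r ℤ.+ c ℤ.- b) ℤ.* m
    collect = solve 5 (λ x r c b m → (x :+ r :* m :+ c :* m) :- (x :+ b :* m) := (r :+ c :- b) :* m) refl
      where open ℤSolver.+-*-Solver

gcd-coprime : ∀ {k n m} → gcd k n ≡ 1 → m ∣ n → Coprime k m
gcd-coprime gcd≡1 m∣n (d∣k , d∣m) = ∣1⇒≡1 (subst (_ ∣_) gcd≡1 (gcd-greatest d∣k (∣-trans d∣m m∣n)))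

-- Integer exponents reduced modulo n.

module IntegerExponents (n : ℕ) {{_ : ℕ.NonZero n}} where
  open import Data.Integer using (+_)
  intMod-quotient : ∀ z → Σ ℤ λ c → z ≡ + intMod z n ℤ.+ c ℤ.* + n
  intMod-quotient z = quotient n
    where
    quotient : ∀ n {{_ : ℕ.NonZero n}} → Σ ℤ λ c → z ≡ + intMod z n ℤ.+ c ℤ.* + n
    quotient (suc n) = z /ℕ suc n , a≡a%ℕn+[a/ℕn]*n z (suc n)

  -- A common divisor of the residue and of `m` also divides `n`, hence divides `j` itself.
  intMod-coprime : ∀ {m} j → m ∣ n → gcd ℤ.∣ j ∣ n ≡ 1 → Coprime (intMod j n) m
  intMod-coprime j m∣n gcd≡1 {d} (d∣J , d∣m) = ∣1⇒≡1 (subst (d ∣_) gcd≡1 (gcd-greatest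
    (subst (λ z → (+ d) ℤ∣.∣ z) (sym (proj₂ (intMod-quotient j))) (Signed.∣⇒∣ᵤ
      (Signed.∣m∣n⇒∣m+n (Signed.∣ᵤ⇒∣ {+ d} {+ intMod j n} d∣J)
        (Signed.∣n⇒∣m*n (proj₁ (intMod-quotient j)) (Signed.∣ᵤ⇒∣ {+ d} {+ n} (∣-trans d∣m m∣n))))))
    (∣-trans d∣m m∣n)))

  module _ {m} {{_ : ℕ.NonZero m}} (m∣n : m ∣ n) where
    open Congruence m

    -- Reduction modulo `n` keeps residues modulo its divisor `m`, and the factor `k` cancels
    -- because it is prime to `m`. In this way the hypotheses on `s` reach the exponents of
    -- Frobenius.
    intMod-congruence : ∀ {k} → Coprime k m → ∀ s a → intMod (s ℤ.* + k) n ≋ a ℕ.* k → IntCong s (+ a) m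
    intMod-congruence {k} coprime s a eq = coprime-divisor (Coprimality.sym coprime)
        (subst (m ∣_) (ℕₚ.*-comm ℤ.∣ s ℤ.- + a ∣ k) (subst (m ∣_) (ℤₚ.abs-* (s ℤ.- + a) (+ k))
          (subst (λ z → (+ m) ℤ∣.∣ z) factored (Units.≋-to-ℤ m (c ℤ.* + d) expanded eq))))
      where
      c : ℤ
      c = proj₁ (intMod-quotient (s ℤ.* + k))
      d : ℕ
      d = _∣_.quotient m∣n
      expanded : s ℤ.* + k ≡ + intMod (s ℤ.* + k) n ℤ.+ (c ℤ.* + d) ℤ.* + m
      expanded = proj₂ (intMod-quotient (s ℤ.* + k)) ∙ cong (ℤ._+_ (+ intMod (s ℤ.* + k) n))
        (cong (ℤ._*_ c) (cong +_ (_∣_.equality m∣n) ∙ ℤₚ.pos-* d m) ∙ sym (ℤₚ.*-assoc c (+ d) (+ m)))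
      factored : s ℤ.* + k ℤ.- + (a ℕ.* k) ≡ (s ℤ.- + a) ℤ.* + k
      factored = cong (ℤ._-_ (s ℤ.* + k)) (ℤₚ.pos-* a k) ∙
        solve 3 (λ s a k → s :* k :- a :* k := (s :- a) :* k) refl s (+ a) (+ k)
        where open ℤSolver.+-*-Solver

  intMod-multiple : ∀ j r → Congruence._≋_ n (intMod (j ℤ.* + r) n) (r ℕ.* intMod j n)
  intMod-multiple j r = Units.≋-from-ℤ n (c ℤ.* + r ℤ.- c′) (begin
      + I                                         ≡⟨ cancel (+ I) c′ (+ n) ⟩
      (+ I ℤ.+ c′ ℤ.* + n) ℤ.- c′ ℤ.* + n         ≡⟨ cong (ℤ._- c′ ℤ.* + n) (proj₂ (intMod-quotient (j ℤ.* + r))) ⟨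
      j ℤ.* + r ℤ.- c′ ℤ.* + n                    ≡⟨ cong (λ z → z ℤ.* + r ℤ.- c′ ℤ.* + n) (proj₂ (intMod-quotient j)) ⟩
      (+ E ℤ.+ c ℤ.* + n) ℤ.* + r ℤ.- c′ ℤ.* + n  ≡⟨ collect (+ E) c (+ n) (+ r) c′ ⟩
      + r ℤ.* + E ℤ.+ (c ℤ.* + r ℤ.- c′) ℤ.* + n  ≡⟨ cong (ℤ._+ (c ℤ.* + r ℤ.- c′) ℤ.* + n) (ℤₚ.pos-* r E) ⟨
      + (r ℕ.* E) ℤ.+ (c ℤ.* + r ℤ.- c′) ℤ.* + n  ∎)
    where
    I E : ℕ
    I = intMod (j ℤ.* + r) n
    E = intMod j n
    c c′ : ℤ
    c = proj₁ (intMod-quotient j)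
    c′ = proj₁ (intMod-quotient (j ℤ.* + r))
    cancel : ∀ i c n → i ≡ (i ℤ.+ c ℤ.* n) ℤ.- c ℤ.* n
    cancel = solve 3 (λ i c n → i := (i :+ c :* n) :- c :* n) refl
      where open ℤSolver.+-*-Solver
    collect : ∀ J c n r c′ → (J ℤ.+ c ℤ.* n) ℤ.* r ℤ.- c′ ℤ.* n ≡ r ℤ.* J ℤ.+ (c ℤ.* r ℤ.- c′) ℤ.* n
    collect = solve 5 (λ J c n r c′ → (J :+ c :* n) :* r :- c′ :* n := r :* J :+ (c :* r :- c′) :* n) refl
      where open ℤSolver.+-*-Solver

-- Arithmetic, finite sums and powers in a finite field.

module FiniteField (F : Field) (p h n m : ℕ) (p-prime : Prime p)
                   (enumeration : Field.Carrier F ↔ Fin ((p ^ h) ^ n)) where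
  q : ℕ
  q = p ^ h

  open Field F renaming (Carrier to K)
  open Setup F q n m

  ring : CommutativeRing _ _
  ring = record { isCommutativeRing = isCommutativeRing }

  open CommutativeRing ring
    using (+-assoc; +-comm; +-identityˡ; +-identityʳ; *-assoc; *-comm; *-identityˡ; *-identityʳ;
           distribˡ; distribʳ; zeroˡ; zeroʳ; -‿inverseˡ; -‿inverseʳ; semiring; commutativeSemiring;
           *-commutativeMonoid; +-commutativeMonoid)
  open Algebra.Properties.Ring (CommutativeRing.ring ring)
    using (-‿distribˡ-*; -‿distribʳ-*; -0#≈0#; -‿involutive; -‿+-comm; x∙y⁻¹≈ε⇒x≈y)

  open Algebra.Properties.Semiring.Mult semiring
    using () renaming (_×_ to _×ₙ_; ×-homo-+ to ×ₙ-homo-+; ×1-homo-* to ×ₙ1-homo-*)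

  -- A formal difference (a , b) of naturals denotes a - b; the library's ring
  -- solver needs coefficients with a computing equality test.
  module Differences where
    open Algebra.Solver.Ring.NaturalCoefficients.Default commutativeSemiring
      using (solve; _:=_; _:+_; _:*_)

    coeffs : RawRing _ _
    coeffs = record
      { Carrier = ℕ × ℕ
      ; _≈_ = _≡_
      ; _+_ = λ { (a , b) (c , d) → a ℕ.+ c , b ℕ.+ d }
      ; _*_ = λ { (a , b) (c , d) → a ℕ.* c ℕ.+ b ℕ.* d , a ℕ.* d ℕ.+ b ℕ.* c }
      ; -_ = λ { (a , b) → b , a }
      ; 0# = 0 , 0
      ; 1# = 1 , 0
      }

    value : ℕ × ℕ → K
    value (a , b) = a ×ₙ 1# + - (b ×ₙ 1#)

    value-+ : ∀ x y → value (RawRing._+_ coeffs x y) ≡ value x + value y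
    value-+ (a , b) (c , d) = begin
      (a ℕ.+ c) ×ₙ 1# + - ((b ℕ.+ d) ×ₙ 1#)
        ≡⟨ cong₂ (λ u v → u + - v) (×ₙ-homo-+ 1# a c) (×ₙ-homo-+ 1# b d) ⟩
      (A + C) + - (B + D)
        ≡⟨ cong ((A + C) +_) (-‿+-comm B D) ⟨
      (A + C) + (- B + - D)
        ≡⟨ solve 4 (λ a b c d → (a :+ c) :+ (b :+ d) := (a :+ b) :+ (c :+ d)) refl A (- B) C (- D) ⟩
      (A + - B) + (C + - D) ∎
      where
      A = a ×ₙ 1#
      B = b ×ₙ 1#
      C = c ×ₙ 1#
      D = d ×ₙ 1#

    value-* : ∀ x y → value (RawRing._*_ coeffs x y) ≡ value x * value y
    value-* (a , b) (c , d) = begin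
      (a ℕ.* c ℕ.+ b ℕ.* d) ×ₙ 1# + - ((a ℕ.* d ℕ.+ b ℕ.* c) ×ₙ 1#)
        ≡⟨ cong₂ (λ u v → u + - v)
             (×ₙ-homo-+ 1# (a ℕ.* c) (b ℕ.* d) ∙ cong₂ _+_ (×ₙ1-homo-* a c) (×ₙ1-homo-* b d))
             (×ₙ-homo-+ 1# (a ℕ.* d) (b ℕ.* c) ∙ cong₂ _+_ (×ₙ1-homo-* a d) (×ₙ1-homo-* b c)) ⟩
      (A * C + B * D) + - (A * D + B * C)
        ≡⟨ cong₂ (λ u v → (A * C + u) + v) minus² (sym (-‿+-comm _ _)) ⟩
      (A * C + - B * - D) + (- (A * D) + - (B * C))
        ≡⟨ cong₂ (λ u v → (A * C + - B * - D) + (u + v)) (-‿distribʳ-* A D) (-‿distribˡ-* B C) ⟩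
      (A * C + - B * - D) + (A * - D + - B * C)
        ≡⟨ solve 4 (λ a b c d → (a :* c :+ b :* d) :+ (a :* d :+ b :* c) := (a :+ b) :* (c :+ d))
             refl A (- B) C (- D) ⟩
      (A + - B) * (C + - D) ∎
      where
      A = a ×ₙ 1#
      B = b ×ₙ 1#
      C = c ×ₙ 1#
      D = d ×ₙ 1#
      minus² : B * D ≡ - B * - D
      minus² = sym (-‿involutive _) ∙
                 cong -_ (-‿distribˡ-* B D) ∙ -‿distribʳ-* (- B) D

    almostRing : AlmostCommutativeRing _ _
    almostRing = fromCommutativeRing ring

    morphism : coeffs -Raw-AlmostCommutative⟶ almostRing
    morphism = record
      { ⟦_⟧ = value
      ; +-homo = value-+
      ; *-homo = value-*
      ; -‿homo = λ { (a , b) → +-comm _ _ ∙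
                   cong (- (a ×ₙ 1#) +_) (sym (-‿involutive _)) ∙ -‿+-comm _ _ }
      ; 0-homo = -‿inverseʳ 0#
      ; 1-homo = cong₂ _+_ (+-identityʳ 1#) -0#≈0# ∙ +-identityʳ 1#
      }

    -- The pairs are compared as integers. A coincidence that holds only in characteristic p goes
    -- undetected, which is harmless for a solver.
    equal? : (x y : ℕ × ℕ) → Maybe (value x ≡ value y)
    equal? (a , b) (c , d) with a ℕ.+ d ℕ.≟ c ℕ.+ b
    ... | no _ = nothing
    ... | yes a+d≡c+b = just (begin
        A + - B             ≡⟨ cong (_+ - B) (+-identityʳ A) ⟨
        A + 0# + - B        ≡⟨ cong (λ z → A + z + - B) (-‿inverseʳ D) ⟨
        A + (D + - D) + - B ≡⟨ cong (_+ - B) (+-assoc A D (- D)) ⟨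
        A + D + - D + - B   ≡⟨ cong (λ z → z + - D + - B) same ⟩
        C + B + - D + - B   ≡⟨ solve 4 (λ c b d b' → c :+ b :+ d :+ b' := c :+ d :+ (b :+ b')) refl C B (- D) (- B) ⟩
        C + - D + (B + - B) ≡⟨ cong (C + - D +_) (-‿inverseʳ B) ⟩
        C + - D + 0#        ≡⟨ +-identityʳ _ ⟩
        C + - D             ∎)
      where
      A = a ×ₙ 1#
      B = b ×ₙ 1#
      C = c ×ₙ 1#
      D = d ×ₙ 1#
      same : A + D ≡ C + B
      same = sym (×ₙ-homo-+ 1# a d) ∙ cong (_×ₙ 1#) a+d≡c+b ∙ ×ₙ-homo-+ 1# c b

  module Solver = Algebra.Solver.Ring Differences.coeffs Differences.almostRing
                    Differences.morphism Differences.equal?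
  open Solver using (solve; _:=_; _:+_; _:*_; :-_; con)

  infixl 6 _−_
  _−_ : K → K → K
  x − y = x + - y

  −≡0⇒≡ : ∀ {x y} → x − y ≡ 0# → x ≡ y
  −≡0⇒≡ = x∙y⁻¹≈ε⇒x≈y _ _

  ≡⇒−≡0 : ∀ {x y} → x ≡ y → x − y ≡ 0#
  ≡⇒−≡0 refl = -‿inverseʳ _

  +-cancelˡ : ∀ x {y z} → x + y ≡ x + z → y ≡ z
  +-cancelˡ x {y} {z} eq = begin
    y             ≡⟨ solve 2 (λ x y → y := :- x :+ (x :+ y)) refl x y ⟩
    - x + (x + y) ≡⟨ cong (- x +_) eq ⟩
    - x + (x + z) ≡⟨ solve 2 (λ x y → :- x :+ (x :+ y) := y) refl x z ⟩
    z             ∎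

  1≢0 : 1# ≢ 0#
  1≢0 eq = 0≢1 (sym eq)

  inv : ∀ {x} → x ≢ 0# → K
  inv {x} x≢0 = proj₁ (inverse x x≢0)

  *-inv : ∀ {x} (x≢0 : x ≢ 0#) → x * inv x≢0 ≡ 1#
  *-inv {x} x≢0 = proj₂ (inverse x x≢0)

  *-cancelˡ-0 : ∀ {x y} → x ≢ 0# → x * y ≡ 0# → y ≡ 0#
  *-cancelˡ-0 {x} {y} x≢0 xy≡0 = begin
    y                 ≡⟨ *-identityˡ y ⟨
    1# * y            ≡⟨ cong (_* y) (*-inv x≢0) ⟨
    x * inv x≢0 * y   ≡⟨ solve 3 (λ x i y → x :* i :* y := i :* (x :* y)) refl x (inv x≢0) y ⟩
    inv x≢0 * (x * y) ≡⟨ cong (inv x≢0 *_) xy≡0 ⟩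
    inv x≢0 * 0#      ≡⟨ zeroʳ _ ⟩
    0#                ∎

  *-cancelʳ-0 : ∀ {x y} → y ≢ 0# → x * y ≡ 0# → x ≡ 0#
  *-cancelʳ-0 y≢0 xy≡0 = *-cancelˡ-0 y≢0 (*-comm _ _ ∙ xy≡0)

  *-nonzero : ∀ {x y} → x ≢ 0# → y ≢ 0# → x * y ≢ 0#
  *-nonzero x≢0 y≢0 xy≡0 = y≢0 (*-cancelˡ-0 x≢0 xy≡0)

  *-cancelˡ : ∀ x {y z} → x ≢ 0# → x * y ≡ x * z → y ≡ z
  *-cancelˡ x {y} {z} x≢0 eq = −≡0⇒≡ (*-cancelˡ-0 x≢0
    (solve 3 (λ x y z → x :* (y :+ :- z) := x :* y :+ :- (x :* z)) refl x y z ∙ ≡⇒−≡0 eq))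

  Additive : (K → K) → Set
  Additive φ = ∀ x y → φ (x + y) ≡ φ x + φ y

  additive-0 : ∀ {φ} → Additive φ → φ 0# ≡ 0#
  additive-0 {φ} add = +-cancelˡ (φ 0#) (begin
    φ 0# + φ 0# ≡⟨ add 0# 0# ⟨
    φ (0# + 0#) ≡⟨ cong φ (+-identityˡ 0#) ⟩
    φ 0#        ≡⟨ +-identityʳ (φ 0#) ⟨
    φ 0# + 0#   ∎)

  additive-neg : ∀ {φ} → Additive φ → ∀ x → φ (- x) ≡ - φ x
  additive-neg {φ} add x = −≡0⇒≡ (begin
    φ (- x) + - - φ x ≡⟨ cong (φ (- x) +_) (-‿involutive (φ x)) ⟩
    φ (- x) + φ x     ≡⟨ add (- x) x ⟨
    φ (- x + x)       ≡⟨ cong φ (-‿inverseˡ x) ⟩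
    φ 0#              ≡⟨ additive-0 add ⟩
    0#                ∎)

  additive-− : ∀ {φ} → Additive φ → ∀ x y → φ (x − y) ≡ φ x − φ y
  additive-− {φ} add x y = add x (- y) ∙ cong (φ x +_) (additive-neg add y)

  sumF-cong : ∀ {d} {f g : Fin d → K} → (∀ i → f i ≡ g i) → sumF f ≡ sumF g
  sumF-cong {zero} _ = refl
  sumF-cong {suc d} eq = cong₂ _+_ (eq Fin.zero) (sumF-cong (eq ∘ Fin.suc))

  sumF-0 : ∀ {d} {f : Fin d → K} → (∀ i → f i ≡ 0#) → sumF f ≡ 0#
  sumF-0 {zero} _ = refl
  sumF-0 {suc d} eq = cong₂ _+_ (eq Fin.zero) (sumF-0 (eq ∘ Fin.suc)) ∙ +-identityˡ 0#

  sumF-+ : ∀ {d} (f g : Fin d → K) → sumF (λ i → f i + g i) ≡ sumF f + sumF g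
  sumF-+ {zero} f g = sym (+-identityˡ 0#)
  sumF-+ {suc d} f g = cong (f Fin.zero + g Fin.zero +_) (sumF-+ (f ∘ Fin.suc) (g ∘ Fin.suc)) ∙
    (solve 4 (λ a b c d → (a :+ b) :+ (c :+ d) := (a :+ c) :+ (b :+ d)) refl _ _ _ _)

  sumF-additive : ∀ {d} {φ} → Additive φ → (f : Fin d → K) → φ (sumF f) ≡ sumF (φ ∘ f)
  sumF-additive {zero} add f = additive-0 add
  sumF-additive {suc d} {φ} add f =
    (add _ _) ∙ cong (φ (f Fin.zero) +_) (sumF-additive add (f ∘ Fin.suc))

  sumF-*ˡ : ∀ {d} c (f : Fin d → K) → c * sumF f ≡ sumF (λ i → c * f i)
  sumF-*ˡ c f = sumF-additive (distribˡ c) f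

  sumF-*ʳ : ∀ {d} c (f : Fin d → K) → sumF f * c ≡ sumF (λ i → f i * c)
  sumF-*ʳ c f = sumF-additive (distribʳ c) f

  sumF-swap : ∀ {d e} (f : Fin d → Fin e → K) →
              sumF (λ i → sumF (f i)) ≡ sumF (λ j → sumF (λ i → f i j))
  sumF-swap {zero} {e} f = sym (sumF-0 {e} (λ _ → refl))
  sumF-swap {suc d} {e} f = cong (sumF (f Fin.zero) +_) (sumF-swap (f ∘ Fin.suc)) ∙
    sym (sumF-+ {e} _ _)

  sumF-punchIn : ∀ {d} (i : Fin (suc d)) (f : Fin (suc d) → K) →
                 sumF f ≡ f i + sumF (f ∘ Fin.punchIn i)
  sumF-punchIn Fin.zero f = refl
  sumF-punchIn {suc d} (Fin.suc i) f = cong (f Fin.zero +_) (sumF-punchIn i (f ∘ Fin.suc)) ∙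
    (solve 3 (λ a b c → a :+ (b :+ c) := b :+ (a :+ c)) refl _ _ _)

  sumF-single : ∀ {d} (i : Fin d) (f : Fin d → K) → (∀ j → j ≢ i → f j ≡ 0#) → sumF f ≡ f i
  sumF-single {suc d} i f zeros = sumF-punchIn i f ∙
    cong (f i +_) (sumF-0 (λ j → zeros _ (Finₚ.punchInᵢ≢i i j))) ∙ +-identityʳ _

  unit : ∀ {d} → Fin d → Fin d → K
  unit i j with i Fin.≟ j
  ... | yes _ = 1#
  ... | no _ = 0#

  unit-diag : ∀ {d} (i : Fin d) → unit i i ≡ 1#
  unit-diag i with i Fin.≟ i
  ... | yes _ = refl
  ... | no i≢i = ⊥-elim (i≢i refl)

  unit-off : ∀ {d} {i j : Fin d} → i ≢ j → unit i j ≡ 0#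
  unit-off {i = i} {j} i≢j with i Fin.≟ j
  ... | yes i≡j = ⊥-elim (i≢j i≡j)
  ... | no _ = refl

  sumF-unitˡ : ∀ {d} (i : Fin d) (f : Fin d → K) → sumF (λ j → unit i j * f j) ≡ f i
  sumF-unitˡ i f = (sumF-single i _ (λ j j≢i → cong (_* f j) (unit-off (j≢i ∘ sym)) ∙ zeroˡ _)) ∙
    cong (_* f i) (unit-diag i) ∙ *-identityˡ _

  sumF-unitʳ : ∀ {d} (i : Fin d) (f : Fin d → K) → sumF (λ j → f j * unit j i) ≡ f i
  sumF-unitʳ i f = (sumF-single i _ (λ j j≢i → cong (f j *_) (unit-off j≢i) ∙ zeroʳ _)) ∙
    cong (f i *_) (unit-diag i) ∙ *-identityʳ _

  sumN-cong : ∀ d {f g : ℕ → K} → (∀ i → i < d → f i ≡ g i) → sumN d f ≡ sumN d g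
  sumN-cong zero _ = refl
  sumN-cong (suc d) eq = cong₂ _+_ (sumN-cong d (λ i i<d → eq i (ℕₚ.m<n⇒m<1+n i<d))) (eq d (ℕₚ.n<1+n d))

  sumN-0 : ∀ d {f : ℕ → K} → (∀ i → i < d → f i ≡ 0#) → sumN d f ≡ 0#
  sumN-0 zero _ = refl
  sumN-0 (suc d) eq = cong₂ _+_ (sumN-0 d (λ i i<d → eq i (ℕₚ.m<n⇒m<1+n i<d))) (eq d (ℕₚ.n<1+n d)) ∙
    +-identityˡ 0#

  sumN-+ : ∀ d (f g : ℕ → K) → sumN d (λ i → f i + g i) ≡ sumN d f + sumN d g
  sumN-+ zero f g = sym (+-identityˡ 0#)
  sumN-+ (suc d) f g = cong (_+ (f d + g d)) (sumN-+ d f g) ∙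
    (solve 4 (λ a b c d → (a :+ b) :+ (c :+ d) := (a :+ c) :+ (b :+ d)) refl _ _ _ _)

  sumN-additive : ∀ d {φ} → Additive φ → (f : ℕ → K) → φ (sumN d f) ≡ sumN d (φ ∘ f)
  sumN-additive zero add f = additive-0 add
  sumN-additive (suc d) {φ} add f = add _ _ ∙ cong (_+ φ (f d)) (sumN-additive d add f)

  sumN-*ˡ : ∀ d c (f : ℕ → K) → c * sumN d f ≡ sumN d (λ i → c * f i)
  sumN-*ˡ d c f = sumN-additive d (distribˡ c) f

  sumN-*ʳ : ∀ d c (f : ℕ → K) → sumN d f * c ≡ sumN d (λ i → f i * c)
  sumN-*ʳ d c f = sumN-additive d (distribʳ c) f

  sumN-single : ∀ d i → i < d → (f : ℕ → K) → (∀ j → j < d → j ≢ i → f j ≡ 0#) → sumN d f ≡ f i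
  sumN-single (suc d) i i<1+d f zeros with i ℕ.≟ d
  ... | yes refl = cong (_+ f d) (sumN-0 d (λ j j<d → zeros j (ℕₚ.m<n⇒m<1+n j<d) (ℕₚ.<⇒≢ j<d))) ∙
                     (+-identityˡ _)
  ... | no i≢d = cong₂ _+_ (sumN-single d i (ℕₚ.≤∧≢⇒< (ℕ.s≤s⁻¹ i<1+d) i≢d) f
                                     (λ j j<d → zeros j (ℕₚ.m<n⇒m<1+n j<d)))
                                  (zeros d (ℕₚ.n<1+n d) (i≢d ∘ sym)) ∙
                   (+-identityʳ _)

  sumF-sumN-swap : ∀ {d} e (f : Fin d → ℕ → K) →
                   sumF (λ i → sumN e (f i)) ≡ sumN e (λ j → sumF (λ i → f i j))
  sumF-sumN-swap {d} zero f = sumF-0 {d} (λ _ → refl)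
  sumF-sumN-swap (suc e) f = sumF-+ (λ i → sumN e (f i)) (λ i → f i e) ∙
    cong (_+ sumF (λ i → f i e)) (sumF-sumN-swap e f)

  sumN-suc : ∀ d (f : ℕ → K) → sumN (suc d) f ≡ f 0 + sumN d (f ∘ suc)
  sumN-suc zero f = +-comm _ _
  sumN-suc (suc d) f = cong (_+ f (suc d)) (sumN-suc d f) ∙ +-assoc _ _ _

  sumN≡sumF : ∀ d (f : ℕ → K) → sumN d f ≡ sumF {d} (f ∘ toℕ)
  sumN≡sumF zero f = refl
  sumN≡sumF (suc d) f = sumN-suc d f ∙ cong (f 0 +_) (sumN≡sumF d (f ∘ suc))

  pow-+ : ∀ x a b → pow x (a ℕ.+ b) ≡ pow x a * pow x b
  pow-+ x zero b = sym (*-identityˡ _)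
  pow-+ x (suc a) b = cong (x *_) (pow-+ x a b) ∙ sym (*-assoc _ _ _)

  pow-1# : ∀ a → pow 1# a ≡ 1#
  pow-1# zero = refl
  pow-1# (suc a) = *-identityˡ _ ∙ pow-1# a

  pow-0# : ∀ a → 0 < a → pow 0# a ≡ 0#
  pow-0# (suc a) _ = zeroˡ _

  pow-* : ∀ x y a → pow (x * y) a ≡ pow x a * pow y a
  pow-* x y zero = sym (*-identityˡ 1#)
  pow-* x y (suc a) = cong (x * y *_) (pow-* x y a) ∙
    (solve 4 (λ x y a b → x :* y :* (a :* b) := x :* a :* (y :* b)) refl x y _ _)

  pow-pow : ∀ x a b → pow x (b ℕ.* a) ≡ pow (pow x a) b
  pow-pow x a zero = refl
  pow-pow x a (suc b) = pow-+ x a (b ℕ.* a) ∙ cong (pow x a *_) (pow-pow x a b)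

  pow-one : ∀ x → pow x 1 ≡ x
  pow-one = *-identityʳ

  pow-nonzero : ∀ {x} → x ≢ 0# → ∀ a → pow x a ≢ 0#
  pow-nonzero x≢0 zero = 1≢0
  pow-nonzero x≢0 (suc a) = *-nonzero x≢0 (pow-nonzero x≢0 a)

  ×ₙ1-pow : ∀ a e → (a ^ e) ×ₙ 1# ≡ pow (a ×ₙ 1#) e
  ×ₙ1-pow a zero = +-identityʳ 1#
  ×ₙ1-pow a (suc e) = ×ₙ1-homo-* a (a ^ e) ∙ cong (a ×ₙ 1# *_) (×ₙ1-pow a e)

  -- Counting in a finite field: pigeonhole, characteristic, Fermat.

  module Finite {N : ℕ} (enumeration : K ↔ Fin N) where
    open Inverse enumeration using (to; from)

    from-to : ∀ x → from (to x) ≡ x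
    from-to x = Inverse.inverseʳ enumeration refl

    to-from : ∀ i → to (from i) ≡ i
    to-from i = Inverse.inverseˡ enumeration refl

    infix 4 _≟_
    abstract
      _≟_ : DecidableEquality K
      x ≟ y = map′ (λ eq → sym (from-to x) ∙ cong from eq ∙ from-to y) (cong to) (to x Fin.≟ to y)

      all? : {P : K → Set} → (∀ x → Dec (P x)) → (∀ x → P x) ⊎ Σ K λ x → ¬ P x
      all? {P} P? with Finₚ.any? (λ i → ¬? (P? (from i)))
      ... | yes (i , ¬Pi) = inj₂ (from i , ¬Pi)
      ... | no ¬any = inj₁ λ x → subst P (from-to x)
                        (decidable-stable (P? _) (λ ¬P → ¬any (to x , ¬P)))

      injective⇒surjective : (f : K → K) → (∀ x y → f x ≡ f y → x ≡ y) → ∀ y → Σ K λ x → f x ≡ y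
      injective⇒surjective f injective y with Finₚ.any? (λ i → f (from i) ≟ y)
      ... | yes (i , fi≡y) = from i , fi≡y
      ... | no missed = ⊥-elim (contract N refl)
        where
        -- `N` is a parameter and cannot be split; a variable equal to it can, which exposes the
        -- predecessor needed for the pigeonhole principle.
        contract : ∀ M → M ≢ N
        contract zero refl with to y
        ... | ()
        contract (suc M) refl = ℕₚ.1+n≰n (Finₚ.injective⇒≤ {f = g} g-injective)
          where
          avoids : ∀ i → to y ≢ to (f (from i))
          avoids i eq = missed (i , sym (sym (from-to y) ∙ cong from eq ∙ from-to _))
          g : Fin (suc M) → Fin M
          g i = Fin.punchOut (avoids i)
          g-injective : ∀ {i j} → g i ≡ g j → i ≡ j
          g-injective {i} {j} eq = sym (to-from i) ∙ cong to (injective _ _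
            (sym (from-to _) ∙ cong from (Finₚ.punchOut-injective (avoids i) (avoids j) eq) ∙
              (from-to _))) ∙ to-from j

    private
      module ∑ = Algebra.Properties.CommutativeMonoid.Sum +-commutativeMonoid
      module ∏ = Algebra.Properties.CommutativeMonoid.Sum *-commutativeMonoid

    permutation : (f g : K → K) → (∀ x → f (g x) ≡ x) → (∀ x → g (f x) ≡ x) → Fin N ↔ Fin N
    permutation f g f-g g-f = mk↔ₛ′ (to ∘ f ∘ from) (to ∘ g ∘ from)
      (λ i → cong (to ∘ f) (from-to _) ∙ cong to (f-g _) ∙ to-from i)
      (λ i → cong (to ∘ g) (from-to _) ∙ cong to (g-f _) ∙ to-from i)

    -- Translation by 1 permutes K, so N · 1 vanishes.
    characteristic : N ×ₙ 1# ≡ 0#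
    characteristic = +-cancelˡ (∑.sum from) (begin
      ∑.sum from + N ×ₙ 1#
        ≡⟨ cong (∑.sum from +_) (∑.sum-replicate N) ⟨
      ∑.sum from + ∑.sum {N} (λ _ → 1#)
        ≡⟨ ∑.∑-distrib-+ from (λ _ → 1#) ⟨
      ∑.sum (λ i → from i + 1#)
        ≡⟨ ∑.sum-cong-≗ (λ i → from-to (from i + 1#)) ⟨
      ∑.sum (λ i → from (to (from i + 1#)))
        ≡⟨ ∑.sum-permute from shift ⟨
      ∑.sum from
        ≡⟨ +-identityʳ _ ⟨
      ∑.sum from + 0# ∎)
      where
      shift : Fin N ↔ Fin N
      shift = permutation (_+ 1#) (_− 1#)
        (λ x → +-assoc _ _ _ ∙ cong (x +_) (-‿inverseˡ 1#) ∙ +-identityʳ x)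
        (λ x → +-assoc _ _ _ ∙ cong (x +_) (-‿inverseʳ 1#) ∙ +-identityʳ x)

    ∏-pow : ∀ d a → ∏.sum {d} (λ _ → a) ≡ pow a d
    ∏-pow zero a = refl
    ∏-pow (suc d) a = cong (a *_) (∏-pow d a)

    0<N : 0 < N
    0<N = ℕₚ.≤-<-trans ℕ.z≤n (Finₚ.toℕ<n (to 0#))

    fermat : ∀ x → pow x N ≡ x
    fermat a with a ≟ 0#
    ... | yes a≡0 = cong (λ z → pow z N) a≡0 ∙ pow-0# N 0<N ∙ sym a≡0
    ... | no a≢0 = cong (pow a) N≡ ∙
                     cong (a *_) (sym ∏factor ∙ ∏factor≡1) ∙ *-identityʳ a
      where
      M = ℕ.pred N
      N≡ : N ≡ suc M
      N≡ = sym (ℕₚ.suc-pred N {{ℕ.>-nonZero 0<N}})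
      -- Multiplication by a permutes the nonzero elements; 0 is replaced by 1 in the product.
      nonzero : K → K
      nonzero x with x ≟ 0#
      ... | yes _ = 1#
      ... | no _ = x
      factor : K → K
      factor x with x ≟ 0#
      ... | yes _ = 1#
      ... | no _ = a
      nonzero≢0 : ∀ x → nonzero x ≢ 0#
      nonzero≢0 x with x ≟ 0#
      ... | yes _ = 1≢0
      ... | no x≢0 = x≢0
      scale : ∀ x → nonzero (a * x) ≡ factor x * nonzero x
      scale x with x ≟ 0# | (a * x) ≟ 0#
      ... | yes _ | yes _ = sym (*-identityˡ 1#)
      ... | yes x≡0 | no ax≢0 = ⊥-elim (ax≢0 (cong (a *_) x≡0 ∙ zeroʳ a))
      ... | no x≢0 | yes ax≡0 = ⊥-elim (*-nonzero a≢0 x≢0 ax≡0)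
      ... | no _ | no _ = refl
      ∏≢0 : ∀ d (f : Fin d → K) → (∀ i → f i ≢ 0#) → ∏.sum f ≢ 0#
      ∏≢0 zero f _ = 1≢0
      ∏≢0 (suc d) f f≢0 = *-nonzero (f≢0 Fin.zero) (∏≢0 d (f ∘ Fin.suc) (f≢0 ∘ Fin.suc))
      multiply : Fin N ↔ Fin N
      multiply = permutation (a *_) (inv a≢0 *_)
        (λ x → sym (*-assoc _ _ _) ∙ cong (_* x) (*-inv a≢0) ∙ *-identityˡ x)
        (λ x → sym (*-assoc _ _ _) ∙
          cong (_* x) (*-comm _ _ ∙ *-inv a≢0) ∙ *-identityˡ x)
      ∏factor≡1 : ∏.sum (factor ∘ from) ≡ 1#
      ∏factor≡1 = *-cancelˡ (∏.sum (nonzero ∘ from)) (∏≢0 N _ (λ i → nonzero≢0 (from i))) (begin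
        ∏.sum (nonzero ∘ from) * ∏.sum (factor ∘ from)
          ≡⟨ *-comm _ _ ⟩
        ∏.sum (factor ∘ from) * ∏.sum (nonzero ∘ from)
          ≡⟨ ∏.∑-distrib-+ (factor ∘ from) (nonzero ∘ from) ⟨
        ∏.sum (λ i → factor (from i) * nonzero (from i))
          ≡⟨ ∏.sum-cong-≗ (λ i → cong nonzero (from-to _) ∙ scale (from i)) ⟨
        ∏.sum (λ i → nonzero (from (to (a * from i))))
          ≡⟨ ∏.sum-permute (nonzero ∘ from) multiply ⟨
        ∏.sum (nonzero ∘ from)
          ≡⟨ *-identityʳ _ ⟨
        ∏.sum (nonzero ∘ from) * 1# ∎)
      ∏-one-exception : ∀ {d} (f : Fin d → K) (i₀ : Fin d) → d ≡ suc M → f i₀ ≡ 1# →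
                        (∀ i → i ≢ i₀ → f i ≡ a) → ∏.sum f ≡ pow a M
      ∏-one-exception {suc d} f i₀ refl fi₀ f≡a = begin
        ∏.sum f                                         ≡⟨ ∏.sum-remove {i = i₀} f ⟩
        f i₀ * ∏.sum (f ∘ Fin.punchIn i₀)               ≡⟨ cong₂ _*_ fi₀ (∏.sum-cong-≗
                                                             (λ j → f≡a _ (Finₚ.punchInᵢ≢i i₀ j))) ⟩
        1# * ∏.sum {d} (λ _ → a)                        ≡⟨ *-identityˡ _ ⟩
        ∏.sum {d} (λ _ → a)                             ≡⟨ ∏-pow d a ⟩
        pow a d                                         ∎
      factor-0 : factor (from (to 0#)) ≡ 1#
      factor-0 with from (to 0#) ≟ 0#
      ... | yes _ = refl
      ... | no ≢0 = ⊥-elim (≢0 (from-to 0#))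
      factor-other : ∀ i → i ≢ to 0# → factor (from i) ≡ a
      factor-other i i≢ with from i ≟ 0#
      ... | yes eq = ⊥-elim (i≢ (sym (to-from i) ∙ cong to eq))
      ... | no _ = refl
      ∏factor : ∏.sum (factor ∘ from) ≡ pow a M
      ∏factor = ∏-one-exception (factor ∘ from) (to 0#) N≡ factor-0 factor-other

  open Finite enumeration

  record IsSubfield (P : K → Set) : Set where
    field
      has-0 : P 0#
      has-1 : P 1#
      has-+ : ∀ {x y} → P x → P y → P (x + y)
      has-* : ∀ {x y} → P x → P y → P (x * y)
      has-neg : ∀ {x} → P x → P (- x)
      has-inv : ∀ {x} (x≢0 : x ≢ 0#) → P x → P (inv x≢0)

    has-sum : ∀ {d} {f : Fin d → K} → (∀ i → P (f i)) → P (sumF f)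
    has-sum {zero} _ = has-0
    has-sum {suc d} Pf = has-+ (Pf Fin.zero) (has-sum (Pf ∘ Fin.suc))

    has-unit : ∀ {d} (i j : Fin d) → P (unit i j)
    has-unit i j with i Fin.≟ j
    ... | yes _ = has-1
    ... | no _ = has-0

  -- Gaussian elimination over a subfield.

  module Elimination {P : K → Set} (subfield : IsSubfield P) where
    open IsSubfield subfield

    Vanishing : ∀ {d e} → (Fin d → Fin e → K) → (Fin d → K) → Set
    Vanishing V c = ∀ j → sumF (λ i → c i * V i j) ≡ 0#

    -- Elimination of the first column, by recursion on the number of columns. The coefficients are
    -- tracked inside `P`, because it is applied to F_q, where membership of the coefficients is the
    -- point.
    dependence : ∀ d (V : Fin (suc d) → Fin d → K) → (∀ i j → P (V i j)) →
                 Σ (Fin (suc d) → K) λ c → (∀ i → P (c i)) × (Σ (Fin (suc d)) λ i → c i ≢ 0#) × Vanishing V c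
    dependence zero V PV = (λ _ → 1#) , (λ _ → has-1) , (Fin.zero , 1≢0) , λ ()
    dependence (suc d) V PV with Finₚ.any? (λ i → ¬? (V i Fin.zero ≟ 0#))
    ... | no ¬pivot = extended , Pextended , (Fin.suc (proj₁ c≢0) , proj₂ c≢0) , vanishing
      where
      column-0 : ∀ i → V i Fin.zero ≡ 0#
      column-0 i with V i Fin.zero ≟ 0#
      ... | yes V≡0 = V≡0
      ... | no V≢0 = ⊥-elim (¬pivot (i , V≢0))
      smaller = dependence d (λ i j → V (Fin.suc i) (Fin.suc j)) (λ i j → PV _ _)
      c = proj₁ smaller
      c≢0 = proj₁ (proj₂ (proj₂ smaller))
      extended : Fin (suc (suc d)) → K
      extended Fin.zero = 0#
      extended (Fin.suc i) = c i
      Pextended : ∀ i → P (extended i)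
      Pextended Fin.zero = has-0
      Pextended (Fin.suc i) = proj₁ (proj₂ smaller) i
      vanishing : Vanishing V extended
      vanishing Fin.zero = sumF-0 {suc (suc d)} (λ i → cong (extended i *_) (column-0 i) ∙ zeroʳ _)
      vanishing (Fin.suc j) = cong (_+ sumF {suc d} (λ i → c i * V (Fin.suc i) (Fin.suc j))) (zeroˡ _) ∙
        (+-identityˡ _) ∙ proj₂ (proj₂ (proj₂ smaller)) j
    ... | yes (i₀ , pivot≢0) = extended , Pextended , nonzero , vanishing
      where
      pivot⁻¹ = inv pivot≢0
      others : Fin (suc d) → Fin (suc (suc d))
      others = Fin.punchIn i₀
      factor : Fin (suc d) → K
      factor k = V (others k) Fin.zero * pivot⁻¹
      W : Fin (suc d) → Fin d → K
      W k j = V (others k) (Fin.suc j) − factor k * V i₀ (Fin.suc j)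
      Pfactor : ∀ k → P (factor k)
      Pfactor k = has-* (PV _ _) (has-inv pivot≢0 (PV _ _))
      smaller = dependence d W (λ k j → has-+ (PV _ _) (has-neg (has-* (Pfactor k) (PV _ _))))
      c = proj₁ smaller
      -- The coefficient of the pivot row is the one that clears the first column.
      c₀ = - sumF (λ k → c k * factor k)
      extended = insertAt c i₀ c₀
      Pextended : ∀ i → P (extended i)
      Pextended i with i₀ Fin.≟ i
      ... | yes refl = subst P (sym (insertAt-lookup c i₀ c₀))
              (has-neg (has-sum (λ k → has-* (proj₁ (proj₂ smaller) k) (Pfactor k))))
      ... | no i₀≢i = subst (P ∘ extended) (Finₚ.punchIn-punchOut i₀≢i)
              (subst P (sym (insertAt-punchIn c i₀ c₀ _)) (proj₁ (proj₂ smaller) _))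
      nonzero : Σ (Fin (suc (suc d))) λ i → extended i ≢ 0#
      nonzero with proj₁ (proj₂ (proj₂ smaller))
      ... | k , ck≢0 = others k , ck≢0 ∘ trans (sym (insertAt-punchIn c i₀ c₀ k))
      split : ∀ j → sumF (λ i → extended i * V i j) ≡ sumF (λ k → c k * (V (others k) j − factor k * V i₀ j))
      split j = begin
        sumF (λ i → extended i * V i j)
          ≡⟨ sumF-punchIn i₀ (λ i → extended i * V i j) ⟩
        extended i₀ * V i₀ j + sumF (λ k → extended (others k) * V (others k) j)
          ≡⟨ cong₂ _+_ (cong (_* V i₀ j) (insertAt-lookup c i₀ c₀))
               (sumF-cong (λ k → cong (_* V (others k) j) (insertAt-punchIn c i₀ c₀ k))) ⟩
        c₀ * V i₀ j + sumF (λ k → c k * V (others k) j)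
          ≡⟨ cong (_+ sumF (λ k → c k * V (others k) j))
               ((solve 2 (λ s v → :- s :* v := s :* :- v) refl _ _) ∙
                 sumF-*ʳ (- V i₀ j) (λ k → c k * factor k)) ⟩
        sumF (λ k → c k * factor k * - V i₀ j) + sumF (λ k → c k * V (others k) j)
          ≡⟨ sumF-+ (λ k → c k * factor k * - V i₀ j) (λ k → c k * V (others k) j) ⟨
        sumF (λ k → c k * factor k * - V i₀ j + c k * V (others k) j)
          ≡⟨ sumF-cong (λ k → solve 4 (λ c f v w → c :* f :* :- v :+ c :* w := c :* (w :+ :- (f :* v)))
               refl (c k) (factor k) (V i₀ j) (V (others k) j)) ⟩
        sumF (λ k → c k * (V (others k) j − factor k * V i₀ j)) ∎
      vanishing : Vanishing V extended
      vanishing Fin.zero = split Fin.zero ∙ sumF-0 {suc d} (λ k →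
        cong (c k *_) (≡⇒−≡0 (begin
          V (others k) Fin.zero
            ≡⟨ *-identityʳ _ ⟨
          V (others k) Fin.zero * 1#
            ≡⟨ cong (V (others k) Fin.zero *_) (*-inv pivot≢0) ⟨
          V (others k) Fin.zero * (V i₀ Fin.zero * pivot⁻¹)
            ≡⟨ solve 3 (λ w v i → w :* (v :* i) := w :* i :* v) refl _ _ _ ⟩
          factor k * V i₀ Fin.zero ∎)) ∙ zeroʳ _)
      vanishing (Fin.suc j) = split (Fin.suc j) ∙ proj₂ (proj₂ (proj₂ smaller)) j

    -- Adjoining `w` as an extra row gives `d + 1` rows of length `d`. Their dependence must involve
    -- `w`, since the other rows are independent, and can be solved for it.
    spanning : ∀ d (V : Fin d → Fin d → K) → (∀ i j → P (V i j)) →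
               (∀ c → (∀ i → P (c i)) → Vanishing V c → ∀ i → c i ≡ 0#) →
               ∀ (w : Fin d → K) → (∀ j → P (w j)) →
               Σ (Fin d → K) λ c → (∀ i → P (c i)) × (∀ j → sumF (λ i → c i * V i j) ≡ w j)
    spanning d V PV independent w Pw with dependence d rows Prows
      where
      rows : Fin (suc d) → Fin d → K
      rows Fin.zero = w
      rows (Fin.suc i) = V i
      Prows : ∀ i j → P (rows i j)
      Prows Fin.zero = Pw
      Prows (Fin.suc i) = PV i
    ... | c , Pc , nonzero , vanishing with c Fin.zero ≟ 0#
    ...   | yes c₀≡0 = ⊥-elim (absurd nonzero)
      where
      tail-0 : ∀ i → c (Fin.suc i) ≡ 0#
      tail-0 = independent (c ∘ Fin.suc) (Pc ∘ Fin.suc) (λ j →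
        sym (+-identityˡ _) ∙ cong (_+ sumF (λ i → c (Fin.suc i) * V i j))
          (sym (cong (_* w j) c₀≡0 ∙ zeroˡ _)) ∙ vanishing j)
      absurd : (Σ (Fin (suc d)) λ i → c i ≢ 0#) → ⊥
      absurd (Fin.zero , c≢0) = c≢0 c₀≡0
      absurd (Fin.suc i , c≢0) = c≢0 (tail-0 i)
    ...   | no c₀≢0 = (λ i → - inv c₀≢0 * c (Fin.suc i)) ,
                      (λ i → has-* (has-neg (has-inv c₀≢0 (Pc _))) (Pc _)) , λ j → begin
        sumF (λ i → - inv c₀≢0 * c (Fin.suc i) * V i j)
          ≡⟨ sumF-cong {d} (λ i → *-assoc _ _ _) ⟩
        sumF (λ i → - inv c₀≢0 * (c (Fin.suc i) * V i j))
          ≡⟨ sumF-*ˡ (- inv c₀≢0) (λ i → c (Fin.suc i) * V i j) ⟨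
        - inv c₀≢0 * sumF (λ i → c (Fin.suc i) * V i j)
          ≡⟨ solve 4 (λ i c w s → :- i :* s := (c :* i) :* w :+ :- (i :* (c :* w :+ s))) refl
               (inv c₀≢0) (c Fin.zero) (w j) (sumF (λ i → c (Fin.suc i) * V i j)) ⟩
        (c Fin.zero * inv c₀≢0) * w j − inv c₀≢0 * (c Fin.zero * w j + sumF (λ i → c (Fin.suc i) * V i j))
          ≡⟨ cong₂ (λ a b → a * w j − inv c₀≢0 * b) (*-inv c₀≢0) (vanishing j) ⟩
        1# * w j − inv c₀≢0 * 0#
          ≡⟨ cong₂ _−_ (*-identityˡ _) (zeroʳ _) ⟩
        w j − 0# ≡⟨ cong (w j +_) -0#≈0# ∙ +-identityʳ _ ⟩
        w j ∎

  whole : IsSubfield Whole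
  whole = _

  -- Frobenius maps and their fixed fields.

  private
    module B = Algebra.Properties.CommutativeSemiring.Binomial commutativeSemiring
    module E = Algebra.Properties.Semiring.Exp semiring
    module ∑ = Algebra.Properties.CommutativeMonoid.Sum +-commutativeMonoid

  0<p : 0 < p
  0<p = ℕ.>-nonZero⁻¹ p {{Data.Nat.Primality.prime⇒nonZero p-prime}}
    where import Data.Nat.Primality

  -- The multiple of 1 by the number of elements is a power of `p ×ₙ 1#`, and a field has no
  -- nilpotents.
  characteristic-p : p ×ₙ 1# ≡ 0#
  characteristic-p with (p ×ₙ 1#) ≟ 0#
  ... | yes p≡0 = p≡0
  ... | no p≢0 = ⊥-elim (pow-nonzero (λ q≡0 → pow-nonzero p≢0 h (sym (×ₙ1-pow p h) ∙ q≡0)) n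
                   (sym (×ₙ1-pow q n) ∙ characteristic))

  multiple-0 : ∀ c x → p ∣ c → c ×ₙ x ≡ 0#
  multiple-0 c x (divides k refl) = begin
    (k ℕ.* p) ×ₙ x                  ≡⟨ cong ((k ℕ.* p) ×ₙ_) (*-identityˡ x) ⟨
    (k ℕ.* p) ×ₙ (1# * x)           ≡⟨ M.×-assoc-* (k ℕ.* p) 1# x ⟨
    (k ℕ.* p) ×ₙ 1# * x             ≡⟨ cong (_* x) (×ₙ1-homo-* k p) ⟩
    k ×ₙ 1# * (p ×ₙ 1#) * x         ≡⟨ cong (λ z → k ×ₙ 1# * z * x) characteristic-p ⟩
    k ×ₙ 1# * 0# * x                ≡⟨ cong (_* x) (zeroʳ _) ⟩
    0# * x                          ≡⟨ zeroˡ x ⟩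
    0#                              ∎
    where
    import Algebra.Properties.Semiring.Mult semiring as M

  pow≡^ : ∀ x e → pow x e ≡ x E.^ e
  pow≡^ x zero = refl
  pow≡^ x (suc e) = cong (x *_) (pow≡^ x e)

  pow-p-+ : ∀ x y → pow (x + y) p ≡ pow x p + pow y p
  pow-p-+ x y = begin
    pow (x + y) p                                              ≡⟨ pow≡^ _ p ⟩
    (x + y) E.^ p                                              ≡⟨ B.theorem p x y ⟩
    B.binomialExpansion x y p                                  ≡⟨ expansion p 0<p refl ⟩
    x E.^ p + y E.^ p                                          ≡⟨ cong₂ _+_ (pow≡^ x p) (pow≡^ y p) ⟨
    pow x p + pow y p                                          ∎
    where
    -- A variable exponent equal to `p` can be split as a successor, which separates the two end
    -- terms; all terms between them vanish in characteristic p.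
    expansion : ∀ r → 0 < r → r ≡ p → B.binomialExpansion x y r ≡ x E.^ r + y E.^ r
    expansion (suc r) _ refl = begin
      first + ∑.sum rest                    ≡⟨ cong (first +_) (∑.sum-init-last rest) ⟩
      first + (∑.sum (rest ∘ Fin.inject₁) + rest (Fin.fromℕ r))
        ≡⟨ cong₂ (λ a b → first + (a + b)) (sum-0 r (rest ∘ Fin.inject₁) middle) last ⟩
      first + (0# + x E.^ suc r)            ≡⟨ cong₂ _+_ first≡ (+-identityˡ _) ⟩
      y E.^ suc r + x E.^ suc r             ≡⟨ +-comm _ _ ⟩
      x E.^ suc r + y E.^ suc r             ∎
      where
      first = B.binomialTerm x y (suc r) Fin.zero
      rest : Fin (suc r) → K
      rest k = B.binomialTerm x y (suc r) (Fin.suc k)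
      first≡ : first ≡ y E.^ suc r
      first≡ = +-identityʳ _ ∙ *-identityˡ _
      sum-0 : ∀ d (f : Fin d → K) → (∀ i → f i ≡ 0#) → ∑.sum f ≡ 0#
      sum-0 d f f≡0 = ∑.sum-cong-≗ f≡0 ∙ ∑.sum-replicate-zero d
      middle : ∀ i → rest (Fin.inject₁ i) ≡ 0#
      middle i = multiple-0 _ _ (prime∣C p-prime (suc (toℕ (Fin.inject₁ i))) ℕ.z<s
        (ℕ.s<s (subst (_< r) (sym (Finₚ.toℕ-inject₁ i)) (Finₚ.toℕ<n i))))
      last : rest (Fin.fromℕ r) ≡ x E.^ suc r
      last rewrite Finₚ.toℕ-fromℕ r | nCn≡1 (suc r) | ℕₚ.n∸n≡0 r =
        (+-identityʳ _) ∙ *-identityʳ _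

  pow-p^-+ : ∀ e x y → pow (x + y) (p ^ e) ≡ pow x (p ^ e) + pow y (p ^ e)
  pow-p^-+ zero x y = pow-one _ ∙ sym (cong₂ _+_ (pow-one x) (pow-one y))
  pow-p^-+ (suc e) x y = pow-pow _ _ p ∙ cong (λ z → pow z p) (pow-p^-+ e x y) ∙
    (pow-p-+ _ _) ∙ sym (cong₂ _+_ (pow-pow x _ p) (pow-pow y _ p))

  -- Exponents stay natural numbers. As `Fr n` is the identity, the inverse of `Fr e` is available
  -- as `Fr (pred n * e)`.
  Fr : ℕ → K → K
  Fr e x = pow x (q ^ e)

  Fr-+ : ∀ e → Additive (Fr e)
  Fr-+ e x y rewrite ℕₚ.^-*-assoc p h e = pow-p^-+ (h ℕ.* e) x y

  Fr-* : ∀ e x y → Fr e (x * y) ≡ Fr e x * Fr e y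
  Fr-* e x y = pow-* x y (q ^ e)

  Fr-1 : ∀ e → Fr e 1# ≡ 1#
  Fr-1 e = pow-1# (q ^ e)

  Fr-0 : ∀ e → Fr e 0# ≡ 0#
  Fr-0 e = additive-0 (Fr-+ e)

  Fr-zero : ∀ x → Fr 0 x ≡ x
  Fr-zero = pow-one

  Fr-∘ : ∀ a b x → Fr (a ℕ.+ b) x ≡ Fr a (Fr b x)
  Fr-∘ a b x = cong (pow x) (ℕₚ.^-distribˡ-+-* q a b) ∙ pow-pow x (q ^ b) (q ^ a)

  Fr-comm : ∀ a b x → Fr a (Fr b x) ≡ Fr b (Fr a x)
  Fr-comm a b x = sym (Fr-∘ a b x) ∙ cong (λ e → Fr e x) (ℕₚ.+-comm a b) ∙ Fr-∘ b a x

  Fr-nonzero : ∀ e {x} → x ≢ 0# → Fr e x ≢ 0#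
  Fr-nonzero e x≢0 = pow-nonzero x≢0 (q ^ e)

  Fr-fixed-* : ∀ {d x} → Fr d x ≡ x → ∀ k → Fr (k ℕ.* d) x ≡ x
  Fr-fixed-* fixed zero = Fr-zero _
  Fr-fixed-* {d} fixed (suc k) = (Fr-∘ d (k ℕ.* d) _) ∙ cong (Fr d) (Fr-fixed-* fixed k) ∙ fixed

  Fr-n* : ∀ k x → Fr (k ℕ.* n) x ≡ x
  Fr-n* k x = Fr-fixed-* (fermat x) k

  fixedField : ∀ e → IsSubfield (λ x → Fr e x ≡ x)
  fixedField e = record
    { has-0 = Fr-0 e
    ; has-1 = Fr-1 e
    ; has-+ = λ x∈ y∈ → Fr-+ e _ _ ∙ cong₂ _+_ x∈ y∈
    ; has-* = λ x∈ y∈ → Fr-* e _ _ ∙ cong₂ _*_ x∈ y∈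
    ; has-neg = λ x∈ → (additive-neg (Fr-+ e) _) ∙ cong -_ x∈
    ; has-inv = λ {x} x≢0 x∈ → *-cancelˡ x x≢0 (begin
        x * Fr e (inv x≢0)      ≡⟨ cong (_* Fr e (inv x≢0)) x∈ ⟨
        Fr e x * Fr e (inv x≢0) ≡⟨ Fr-* e x (inv x≢0) ⟨
        Fr e (x * inv x≢0)      ≡⟨ cong (Fr e) (*-inv x≢0) ⟩
        Fr e 1#                 ≡⟨ Fr-1 e ⟩
        1#                      ≡⟨ *-inv x≢0 ⟨
        x * inv x≢0             ∎)
    }

  Fq⇒fixed : ∀ {x} → InFq x → Fr 1 x ≡ x
  Fq⇒fixed {x} x∈ = cong (pow x) (ℕₚ.*-identityʳ q) ∙ x∈

  fixed⇒Fq : ∀ {x} → Fr 1 x ≡ x → InFq x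
  fixed⇒Fq {x} x∈ = cong (pow x) (sym (ℕₚ.*-identityʳ q)) ∙ x∈

  Fr-Fq : ∀ e {x} → InFq x → Fr e x ≡ x
  Fr-Fq e {x} x∈ = cong (λ d → Fr d x) (sym (ℕₚ.*-identityʳ e)) ∙ Fr-fixed-* (Fq⇒fixed x∈) e

  FqField : IsSubfield InFq
  FqField = record
    { has-0 = fixed⇒Fq has-0
    ; has-1 = fixed⇒Fq has-1
    ; has-+ = λ x∈ y∈ → fixed⇒Fq (has-+ (Fq⇒fixed x∈) (Fq⇒fixed y∈))
    ; has-* = λ x∈ y∈ → fixed⇒Fq (has-* (Fq⇒fixed x∈) (Fq⇒fixed y∈))
    ; has-neg = λ x∈ → fixed⇒Fq (has-neg (Fq⇒fixed x∈))
    ; has-inv = λ x≢0 x∈ → fixed⇒Fq (has-inv x≢0 (Fq⇒fixed x∈))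
    }
    where open IsSubfield (fixedField 1)

  FqmField : IsSubfield InFqm
  FqmField = fixedField m

  module Fq = IsSubfield FqField
  module Fqm = IsSubfield FqmField

  Fq⊆Fqm : ∀ {x} → InFq x → InFqm x
  Fq⊆Fqm = Fr-Fq m

  Fr-Fqm : ∀ e {x} → InFqm x → InFqm (Fr e x)
  Fr-Fqm e {x} x∈ = Fr-comm m e x ∙ cong (Fr e) x∈

  -- F_q-linear maps and Moore matrices.

  record Linear (φ : K → K) : Set where
    constructor linear
    field
      add : Additive φ
      hom : ∀ {c} x → InFq c → φ (c * x) ≡ c * φ x

    map-sum : ∀ {d} (c b : Fin d → K) → (∀ i → InFq (c i)) → φ (lc c b) ≡ lc c (φ ∘ b)
    map-sum {d} c b c∈ = (sumF-additive {d} add _) ∙ sumF-cong {d} (λ i → hom (b i) (c∈ i))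

    map-0 : φ 0# ≡ 0#
    map-0 = additive-0 add

  open Linear public

  Fr-linear : ∀ e → Linear (Fr e)
  Fr-linear e = linear (Fr-+ e) (λ x c∈ → Fr-* e _ _ ∙ cong (_* Fr e x) (Fr-Fq e c∈))

  ∘-linear : ∀ {φ ψ} → Linear φ → Linear ψ → Linear (φ ∘ ψ)
  ∘-linear {φ} {ψ} φ-lin ψ-lin = linear
    (λ x y → cong φ (add ψ-lin x y) ∙ add φ-lin _ _)
    (λ x c∈ → cong φ (hom ψ-lin x c∈) ∙ hom φ-lin _ c∈)

  *ˡ-linear : ∀ a → Linear (a *_)
  *ˡ-linear a = linear (distribˡ a) (λ {c} x _ → solve 3 (λ a c x → a :* (c :* x) := c :* (a :* x)) refl a c x)

  *ʳ-linear : ∀ a → Linear (_* a)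
  *ʳ-linear a = linear (distribʳ a) (λ x _ → *-assoc _ x a)

  +-linear : ∀ {φ ψ} → Linear φ → Linear ψ → Linear (λ x → φ x + ψ x)
  +-linear φ-lin ψ-lin = linear
    (λ x y → cong₂ _+_ (add φ-lin x y) (add ψ-lin x y) ∙
      (solve 4 (λ a b c d → (a :+ b) :+ (c :+ d) := (a :+ c) :+ (b :+ d)) refl _ _ _ _))
    (λ x c∈ → cong₂ _+_ (hom φ-lin x c∈) (hom ψ-lin x c∈) ∙ sym (distribˡ _ _ _))

  sumN-linear : ∀ d {φ : ℕ → K → K} → (∀ i → Linear (φ i)) → Linear (λ x → sumN d (λ i → φ i x))
  sumN-linear zero φ-lin = linear (λ _ _ → sym (+-identityˡ 0#)) (λ _ _ → sym (zeroʳ _))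
  sumN-linear (suc d) φ-lin = +-linear (sumN-linear d φ-lin) (φ-lin d)

  iterate-linear : ∀ {φ} → Linear φ → ∀ r → Linear (iterate φ r)
  iterate-linear φ-lin zero = linear (λ _ _ → refl) (λ _ _ → refl)
  iterate-linear φ-lin (suc r) = ∘-linear φ-lin (iterate-linear φ-lin r)

  linear-unique : ∀ {d} {V : K → Set} {b : Fin d → K} → Spans V b → ∀ {φ ψ} → Linear φ → Linear ψ →
                  (∀ i → φ (b i) ≡ ψ (b i)) → ∀ {x} → V x → φ x ≡ ψ x
  linear-unique {d} {b = b} spans {φ} {ψ} φ-lin ψ-lin agree {x} x∈ with spans x x∈
  ... | c , c∈ , eq = begin
    φ x           ≡⟨ cong φ eq ⟨
    φ (lc c b)    ≡⟨ map-sum φ-lin c b c∈ ⟩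
    lc c (φ ∘ b)  ≡⟨ sumF-cong {d} (λ i → cong (c i *_) (agree i)) ⟩
    lc c (ψ ∘ b)  ≡⟨ map-sum ψ-lin c b c∈ ⟨
    ψ (lc c b)    ≡⟨ cong ψ eq ⟩
    ψ x           ∎

  -- Summation by parts: the sequence `Fr r x` has the differences `Fr r (Fr 1 x − x)`. If the
  -- coefficients sum to zero, that is if 1 is a root, the boundary term disappears and `Fr 1 - id`
  -- splits off on the right.
  abel : ∀ (c : ℕ → K) x d → sumN (suc d) (λ r → c r * Fr r x) ≡
         sumN (suc d) c * Fr d x − sumN d (λ r → sumN (suc r) c * Fr r (Fr 1 x − x))
  abel c x zero = +-identityˡ _ ∙
    sym (cong₂ _+_ (cong (_* Fr 0 x) (+-identityˡ _)) -0#≈0# ∙ +-identityʳ _)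
  abel c x (suc d) = begin
    sumN (suc d) (λ r → c r * Fr r x) + c′ * F′
      ≡⟨ cong (_+ c′ * F′) (abel c x d) ⟩
    C * Fr d x − S + c′ * F′
      ≡⟨ solve 5 (λ C F S c F′ → C :* F :+ :- S :+ c :* F′ := (C :+ c) :* F′ :+ :- (S :+ C :* (F′ :+ :- F)))
           refl C (Fr d x) S c′ F′ ⟩
    (C + c′) * F′ − (S + C * (F′ − Fr d x))
      ≡⟨ cong (λ z → (C + c′) * F′ − (S + C * z)) difference ⟨
    (C + c′) * F′ − (S + C * Fr d (Fr 1 x − x)) ∎
    where
    c′ = c (suc d)
    F′ = Fr (suc d) x
    C = sumN (suc d) c
    S = sumN d (λ r → sumN (suc r) c * Fr r (Fr 1 x − x))
    difference : Fr d (Fr 1 x − x) ≡ F′ − Fr d x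
    difference = (additive-− (Fr-+ d) _ _) ∙
      cong (_− Fr d x) (sym (Fr-∘ d 1 x) ∙ cong (λ e → Fr e x) (ℕₚ.+-comm d 1))

  independent-nonzero : ∀ {d} (w : Fin d → K) → LinIndep w → ∀ i → w i ≢ 0#
  independent-nonzero {d} w independent i wi≡0 = 1≢0 (sym (unit-diag i) ∙
    independent (unit i) (Fq.has-unit i) (sumF-unitˡ i w ∙ wi≡0) i)

  -- The Moore matrix of independent elements is invertible: after dividing by w 0,
  -- summation by parts factors Fr 1 - id out on the right, and Fr 1 - id has kernel F_q.
  moore : ∀ d (w : Fin d → K) → LinIndep w → (c : ℕ → K) →
          (∀ i → sumN d (λ r → c r * Fr r (w i)) ≡ 0#) → ∀ r → r < d → c r ≡ 0#
  moore (suc d) w independent c vanishing r r<1+d =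
    *-cancelʳ-0 (Fr-nonzero r w₀≢0) (c′≡0 r r<1+d)
    where
    w₀ = w Fin.zero
    w₀≢0 = independent-nonzero w independent Fin.zero
    c′ : ℕ → K
    c′ r = c r * Fr r w₀
    ratio v : Fin d → K
    ratio i = w (Fin.suc i) * inv w₀≢0
    v i = Fr 1 (ratio i) − ratio i
    ratio* : ∀ i → w₀ * ratio i ≡ w (Fin.suc i)
    ratio* i = (solve 3 (λ a b i → a :* (b :* i) := (a :* i) :* b) refl w₀ _ (inv w₀≢0)) ∙
      cong (_* w (Fin.suc i)) (*-inv w₀≢0) ∙ *-identityˡ _
    vanish : ∀ x y → w₀ * x ≡ y → sumN (suc d) (λ r → c r * Fr r y) ≡ 0# →
             sumN (suc d) (λ r → c′ r * Fr r x) ≡ 0#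
    vanish x _ refl y-vanishes = sumN-cong (suc d) (λ r _ →
      (*-assoc _ _ _) ∙ cong (c r *_) (sym (Fr-* r w₀ x))) ∙ y-vanishes
    total : sumN (suc d) c′ ≡ 0#
    total = sumN-cong (suc d) (λ r _ → sym (cong (c′ r *_) (Fr-1 r) ∙ *-identityʳ _)) ∙
      vanish 1# w₀ (*-identityʳ w₀) (vanishing Fin.zero)
    partial : ∀ i → sumN d (λ r → sumN (suc r) c′ * Fr r (v i)) ≡ 0#
    partial i = begin
      S                                           ≡⟨ -‿involutive S ⟨
      - (- S)                                     ≡⟨ cong -_ (+-identityˡ _) ⟨
      - (0# − S)                                  ≡⟨ cong (λ z → - (z − S)) (zeroˡ (Fr d (ratio i))) ⟨
      - (0# * Fr d (ratio i) − S)                 ≡⟨ cong (λ z → - (z * Fr d (ratio i) − S)) total ⟨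
      - (sumN (suc d) c′ * Fr d (ratio i) − S)    ≡⟨ cong -_ (abel c′ (ratio i) d) ⟨
      - sumN (suc d) (λ r → c′ r * Fr r (ratio i)) ≡⟨ cong -_ (vanish _ _ (ratio* i) (vanishing (Fin.suc i))) ⟩
      - 0#                                        ≡⟨ -0#≈0# ⟩
      0#                                          ∎
      where S = sumN d (λ r → sumN (suc r) c′ * Fr r (v i))
    -- A relation among the `v i` makes `y` a fixed point of `Fr 1`. So `y` is a scalar, and the
    -- relation lifts to `w` with coefficient `- y` at `w₀`.
    v-independent : LinIndep v
    v-independent l l∈ lv≡0 i = independent extended extended∈ combination (Fin.suc i)
      where
      y = lc l ratio
      y∈ : InFq y
      y∈ = fixed⇒Fq (−≡0⇒≡ (begin
        Fr 1 y − y                              ≡⟨ cong (_− y) (map-sum (Fr-linear 1) l ratio l∈) ⟩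
        lc l (Fr 1 ∘ ratio) − y                 ≡⟨ cong (lc l (Fr 1 ∘ ratio) +_) (sumF-additive {d} (λ a b → sym (-‿+-comm a b)) _) ⟩
        lc l (Fr 1 ∘ ratio) + sumF (λ i → - (l i * ratio i)) ≡⟨ sumF-+ {d} _ _ ⟨
        sumF (λ i → l i * Fr 1 (ratio i) − l i * ratio i)
          ≡⟨ sumF-cong {d} (λ i → solve 3 (λ l a b → l :* a :+ :- (l :* b) := l :* (a :+ :- b)) refl _ _ _) ⟩
        lc l v                                  ≡⟨ lv≡0 ⟩
        0#                                      ∎))
      extended : Fin (suc d) → K
      extended Fin.zero = - y
      extended (Fin.suc i) = l i
      extended∈ : ∀ i → InFq (extended i)
      extended∈ Fin.zero = Fq.has-neg y∈
      extended∈ (Fin.suc i) = l∈ i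
      combination : lc extended w ≡ 0#
      combination = begin
        - y * w₀ + sumF (λ i → l i * w (Fin.suc i))
          ≡⟨ cong (- y * w₀ +_) (sumF-cong {d} (λ i → cong (l i *_) (sym (ratio* i)) ∙
               (solve 3 (λ l a b → l :* (a :* b) := a :* (l :* b)) refl _ _ _))) ⟩
        - y * w₀ + sumF (λ i → w₀ * (l i * ratio i))
          ≡⟨ cong (- y * w₀ +_) (sumF-*ˡ w₀ (λ i → l i * ratio i)) ⟨
        - y * w₀ + w₀ * y
          ≡⟨ solve 2 (λ y w → :- y :* w :+ w :* y := con (0 , 0)) refl y w₀ ⟩
        Differences.value (0 , 0)
          ≡⟨ -‿inverseʳ 0# ⟩
        0# ∎
    partial-sums : ∀ r → r ≤ d → sumN (suc r) c′ ≡ 0#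
    partial-sums r r≤d with r ℕ.≟ d
    ... | yes refl = total
    ... | no r≢d = moore d v v-independent (λ r → sumN (suc r) c′) partial r (ℕₚ.≤∧≢⇒< r≤d r≢d)
    c′≡0 : ∀ r → r < suc d → c′ r ≡ 0#
    c′≡0 zero _ = sym (+-identityˡ _) ∙ partial-sums 0 ℕ.z≤n
    c′≡0 (suc r) (ℕ.s≤s r<d) = +-cancelˡ (sumN (suc r) c′)
      (partial-sums (suc r) r<d ∙
        sym (+-identityʳ _ ∙ partial-sums r (ℕₚ.<⇒≤ r<d)))

  -- Padding by zero: families over `Fin d` become sequences, so that indices can be shifted and
  -- compared as plain numbers.
  ext : ∀ {d} → (Fin d → K) → ℕ → K
  ext {zero} f _ = 0#
  ext {suc d} f zero = f Fin.zero
  ext {suc d} f (suc r) = ext (f ∘ Fin.suc) r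

  ext-toℕ : ∀ {d} (f : Fin d → K) i → ext f (toℕ i) ≡ f i
  ext-toℕ f Fin.zero = refl
  ext-toℕ f (Fin.suc i) = ext-toℕ (f ∘ Fin.suc) i

  sumF-ext : ∀ {d} (f : Fin d → K) (g : ℕ → K) → sumF (λ i → f i * g (toℕ i)) ≡ sumN d (λ r → ext f r * g r)
  sumF-ext {d} f g = sym (sumN≡sumF d _ ∙ sumF-cong {d} (λ i → cong (_* g (toℕ i)) (ext-toℕ f i)))

  ext-Fq : ∀ {d} {f : Fin d → K} → (∀ i → InFq (f i)) → ∀ r → InFq (ext f r)
  ext-Fq {zero} _ _ = Fq.has-0
  ext-Fq {suc d} f∈ zero = f∈ Fin.zero
  ext-Fq {suc d} f∈ (suc r) = ext-Fq (f∈ ∘ Fin.suc) r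

  lc-0 : ∀ {d} {c : Fin d → K} (b : Fin d → K) → (∀ i → c i ≡ 0#) → lc c b ≡ 0#
  lc-0 {d} b c≡0 = sumF-0 {d} (λ i → cong (_* b i) (c≡0 i) ∙ zeroˡ _)

  -- Coordinates with respect to a basis of K.

  module Coordinates {d} (b : Fin d → K) (independent : LinIndep b) (spans : Spans Whole b) where
    coordinate : K → Fin d → K
    coordinate x = proj₁ (spans x _)

    coordinate∈ : ∀ x i → InFq (coordinate x i)
    coordinate∈ x = proj₁ (proj₂ (spans x _))

    coordinate-lc : ∀ x → lc (coordinate x) b ≡ x
    coordinate-lc x = proj₂ (proj₂ (spans x _))

    coordinate-unique : ∀ {c c′ : Fin d → K} → (∀ i → InFq (c i)) → (∀ i → InFq (c′ i)) →
                        lc c b ≡ lc c′ b → ∀ i → c i ≡ c′ i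
    coordinate-unique {c} {c′} c∈ c′∈ eq i = −≡0⇒≡ (independent (λ i → c i − c′ i)
      (λ i → Fq.has-+ (c∈ i) (Fq.has-neg (c′∈ i))) (begin
        lc (λ i → c i − c′ i) b
          ≡⟨ sumF-cong {d} (λ i → solve 3 (λ c c′ b → (c :+ :- c′) :* b := c :* b :+ :- (c′ :* b)) refl (c i) (c′ i) (b i)) ⟩
        sumF (λ i → c i * b i − c′ i * b i)
          ≡⟨ sumF-+ {d} (λ i → c i * b i) (λ i → - (c′ i * b i)) ⟩
        lc c b + sumF (λ i → - (c′ i * b i))
          ≡⟨ cong (lc c b +_) (sumF-additive {d} (λ x y → sym (-‿+-comm x y)) (λ i → c′ i * b i)) ⟨
        lc c b − lc c′ b
          ≡⟨ ≡⇒−≡0 eq ⟩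
        0# ∎) i)

    extend : (Fin d → K) → K → K
    extend v x = lc (coordinate x) v

    extend-linear : ∀ v → Linear (extend v)
    extend-linear v = linear
      (λ x y → sumF-cong {d} (λ i → cong (_* v i) (coordinate-+ x y i) ∙ (distribʳ (v i) _ _)) ∙
        sumF-+ {d} (λ i → coordinate x i * v i) (λ i → coordinate y i * v i))
      (λ {c} x c∈ → sumF-cong {d} (λ i → cong (_* v i) (coordinate-* c∈ x i) ∙ *-assoc _ _ _) ∙
        sym (sumF-*ˡ {d} c (λ i → coordinate x i * v i)))
      where
      coordinate-+ : ∀ x y i → coordinate (x + y) i ≡ coordinate x i + coordinate y i
      coordinate-+ x y = coordinate-unique (coordinate∈ _) (λ i → Fq.has-+ (coordinate∈ x i) (coordinate∈ y i)) (begin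
        lc (coordinate (x + y)) b                       ≡⟨ coordinate-lc (x + y) ⟩
        x + y                                           ≡⟨ cong₂ _+_ (coordinate-lc x) (coordinate-lc y) ⟨
        lc (coordinate x) b + lc (coordinate y) b       ≡⟨ sumF-+ {d} _ _ ⟨
        sumF (λ i → coordinate x i * b i + coordinate y i * b i) ≡⟨ sumF-cong {d} (λ i → sym (distribʳ (b i) _ _)) ⟩
        lc (λ i → coordinate x i + coordinate y i) b    ∎)
      coordinate-* : ∀ {c} → InFq c → ∀ x i → coordinate (c * x) i ≡ c * coordinate x i
      coordinate-* {c} c∈ x = coordinate-unique (coordinate∈ _) (λ i → Fq.has-* c∈ (coordinate∈ x i)) (begin
        lc (coordinate (c * x)) b             ≡⟨ coordinate-lc (c * x) ⟩
        c * x                                 ≡⟨ cong (c *_) (coordinate-lc x) ⟨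
        c * lc (coordinate x) b               ≡⟨ sumF-*ˡ {d} c _ ⟩
        sumF (λ i → c * (coordinate x i * b i)) ≡⟨ sumF-cong {d} (λ i → sym (*-assoc _ _ _)) ⟩
        lc (λ i → c * coordinate x i) b       ∎)

    extend-basis : ∀ v i → extend v (b i) ≡ v i
    extend-basis v i = sumF-cong {d} (λ k → cong (_* v k) (coordinate-unique (coordinate∈ (b i)) (Fq.has-unit i)
      (coordinate-lc (b i) ∙ sym (sumF-unitˡ i b)) k)) ∙ sumF-unitˡ i v

  -- Independence of `b` makes the rows of its coordinate matrix with respect to `u` independent,
  -- and this square system is then solvable for the coordinates of any `x`.
  independent-spans : ∀ {d} {u b : Fin d → K} → IsBasis Whole u → LinIndep b → Spans Whole b
  independent-spans {d} {u} {b} (_ , u-independent , u-spans) b-independent x _ =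
    proj₁ solution , proj₁ (proj₂ solution) , (begin
      lc (proj₁ solution) b                       ≡⟨ expanded (proj₁ solution) ⟩
      lc (λ l → sumF (λ i → proj₁ solution i * coordinate (b i) l)) u
        ≡⟨ sumF-cong {d} (λ l → cong (_* u l) (proj₂ (proj₂ solution) l)) ⟩
      lc (coordinate x) u                         ≡⟨ coordinate-lc x ⟩
      x                                           ∎)
    where
    open Coordinates u u-independent u-spans
    expanded : ∀ c → lc c b ≡ lc (λ l → sumF (λ i → c i * coordinate (b i) l)) u
    expanded c = begin
      sumF (λ i → c i * b i)
        ≡⟨ sumF-cong {d} (λ i → cong (c i *_) (sym (coordinate-lc (b i))) ∙ (sumF-*ˡ {d} (c i) _)) ⟩
      sumF (λ i → sumF (λ l → c i * (coordinate (b i) l * u l)))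
        ≡⟨ sumF-swap {d} {d} _ ⟩
      sumF (λ l → sumF (λ i → c i * (coordinate (b i) l * u l)))
        ≡⟨ sumF-cong {d} (λ l → sumF-cong {d} (λ i → sym (*-assoc _ _ _)) ∙
             sym (sumF-*ʳ {d} (u l) (λ i → c i * coordinate (b i) l))) ⟩
      lc (λ l → sumF (λ i → c i * coordinate (b i) l)) u ∎
    solution : Σ (Fin d → K) λ c → (∀ i → InFq (c i)) × (∀ l →
      sumF (λ i → c i * coordinate (b i) l) ≡ coordinate x l)
    solution = Elimination.spanning FqField d (λ i → coordinate (b i)) (λ i → coordinate∈ (b i))
      (λ c c∈ vanishing → b-independent c c∈ (expanded c ∙ lc-0 u vanishing))
      (coordinate x) (coordinate∈ x)

  -- Vectors over K and the geometry of rank one.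

  -- An F_q-linear map F_{q^m} → K is recorded by its values on a basis.
  Vector : Set
  Vector = Fin m → K

  infixl 6 _⊞_
  _⊞_ : Vector → Vector → Vector
  (v ⊞ w) i = v i + w i

  tensor : Vector → K → Vector
  tensor α b i = α i * b

  Φ : K → K
  Φ = Fr 1

  -- The entries of v are proportional over F_q, the fixed field of Φ; 0 is included.
  RankOne : Vector → Set
  RankOne v = ∀ i j → v i * Φ (v j) ≡ v j * Φ (v i)

  -- For nonzero `v = α ⊗ b` and `w = β ⊗ d` the first says that `α` and `β` are proportional over
  -- F_q, the second that `b` and `d` are. As polynomial identities both are decidable, additive in
  -- `w`, and true for zero.
  SameRow SameColumn : Vector → Vector → Set
  SameRow v w = ∀ i j → v i * w j ≡ w i * v j
  SameColumn v w = ∀ i j → v i * Φ (w j) ≡ w j * Φ (v i)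

  ratio-Fq : ∀ {x y} (y≢0 : y ≢ 0#) → x * Φ y ≡ y * Φ x → InFq (x * inv y≢0)
  ratio-Fq {x} {y} y≢0 eq = fixed⇒Fq (*-cancelˡ y y≢0 (*-cancelˡ (Φ y) (Fr-nonzero 1 y≢0) (begin
    Φ y * (y * Φ (x * i))     ≡⟨ cong (λ z → Φ y * (y * z)) (Fr-* 1 x i) ⟩
    Φ y * (y * (Φ x * Φ i))   ≡⟨ solve 4 (λ fy y fx fi → fy :* (y :* (fx :* fi)) := (y :* fx) :* (fy :* fi)) refl (Φ y) y (Φ x) (Φ i) ⟩
    y * Φ x * (Φ y * Φ i)     ≡⟨ cong₂ _*_ (sym eq) (sym (Fr-* 1 y i) ∙ cong Φ (*-inv y≢0) ∙ Fr-1 1 ∙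
      sym (*-inv y≢0)) ⟩
    x * Φ y * (y * i)         ≡⟨ solve 4 (λ x fy y i → x :* fy :* (y :* i) := fy :* (y :* (x :* i))) refl x (Φ y) y i ⟩
    Φ y * (y * (x * i))       ∎)))
    where
    i = inv y≢0

  ratio-* : ∀ {x y} (y≢0 : y ≢ 0#) → x * inv y≢0 * y ≡ x
  ratio-* {x} {y} y≢0 = solve 3 (λ x i y → x :* i :* y := x :* (y :* i)) refl x (inv y≢0) y ∙
    cong (x *_) (*-inv y≢0) ∙ *-identityʳ x

  tensor-RankOne : ∀ {α} b → (∀ i → InFq (α i)) → RankOne (tensor α b)
  tensor-RankOne {α} b α∈ i j = begin
    α i * b * Φ (α j * b)     ≡⟨ cong (α i * b *_) (hom (Fr-linear 1) b (α∈ j)) ⟩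
    α i * b * (α j * Φ b)     ≡⟨ solve 4 (λ a b c d → a :* b :* (c :* d) := c :* b :* (a :* d)) refl (α i) b (α j) (Φ b) ⟩
    α j * b * (α i * Φ b)     ≡⟨ cong (α j * b *_) (hom (Fr-linear 1) b (α∈ i)) ⟨
    α j * b * Φ (α i * b)     ∎

  RankOne-cong : ∀ {v w} → (∀ i → v i ≡ w i) → RankOne v → RankOne w
  RankOne-cong eq rk i j = cong₂ (λ a b → a * Φ b) (sym (eq i)) (sym (eq j)) ∙
    rk i j ∙ cong₂ (λ a b → a * Φ b) (eq j) (eq i)

  linear-RankOne : ∀ {A} → Linear A → ∀ {v} → RankOne v → RankOne (A ∘ v)
  linear-RankOne {A} A-lin {v} rk i j = by-cases (v j ≟ 0#)
    where
    by-cases : Dec (v j ≡ 0#) → A (v i) * Φ (A (v j)) ≡ A (v j) * Φ (A (v i))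
    by-cases (yes vj≡0) = cong (λ z → A (v i) * Φ z) Avj≡0 ∙ cong (A (v i) *_) (Fr-0 1) ∙
        (zeroʳ _) ∙ sym (cong (_* Φ (A (v i))) Avj≡0 ∙ zeroˡ _)
      where
      Avj≡0 : A (v j) ≡ 0#
      Avj≡0 = cong A vj≡0 ∙ map-0 A-lin
    by-cases (no vj≢0) = begin
      A (v i) * Φ (A (v j))         ≡⟨ cong (_* Φ (A (v j))) Avi ⟩
      l * A (v j) * Φ (A (v j))     ≡⟨ solve 3 (λ l a f → l :* a :* f := a :* (l :* f)) refl l (A (v j)) (Φ (A (v j))) ⟩
      A (v j) * (l * Φ (A (v j)))   ≡⟨ cong (A (v j) *_) (hom (Fr-linear 1) (A (v j)) l∈) ⟨
      A (v j) * Φ (l * A (v j))     ≡⟨ cong (λ z → A (v j) * Φ z) Avi ⟨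
      A (v j) * Φ (A (v i))         ∎
      where
      l : K
      l = v i * inv vj≢0
      l∈ : InFq l
      l∈ = ratio-Fq vj≢0 (rk i j)
      Avi : A (v i) ≡ l * A (v j)
      Avi = cong A (sym (ratio-* vj≢0)) ∙ hom A-lin (v j) l∈

  abstract
    nonzero-entry : ∀ (v : Vector) → (∀ i → v i ≡ 0#) ⊎ Σ (Fin m) λ i → v i ≢ 0#
    nonzero-entry v with Finₚ.any? (λ i → ¬? (v i ≟ 0#))
    ... | yes found = inj₂ found
    ... | no none = inj₁ λ i → decidable-stable (v i ≟ 0#) (λ vi≢0 → none (i , vi≢0))

  module Factor {v : Vector} (rk : RankOne v) (a : Fin m) (va≢0 : v a ≢ 0#) where
    row : Vector
    row i = v i * inv va≢0

    row∈ : ∀ i → InFq (row i)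
    row∈ i = ratio-Fq va≢0 (rk i a)

    factor : ∀ i → v i ≡ row i * v a
    factor i = sym (ratio-* va≢0)

    Φ-factor : ∀ i → Φ (v i) ≡ row i * Φ (v a)
    Φ-factor i = cong Φ (factor i) ∙ hom (Fr-linear 1) (v a) (row∈ i)

  -- For `v = α ⊗ b` and `w = β ⊗ d` the rank-one condition on the sum at `i`, `j` factors as `(α i
  -- * β j − α j * β i) * (b * Φ d − d * Φ b) = 0`, and the second factor does not depend on the
  -- indices.
  sameRow-or-sameColumn : ∀ {v w} → RankOne v → RankOne w → RankOne (v ⊞ w) → SameRow v w ⊎ SameColumn v w
  sameRow-or-sameColumn {v} {w} rk-v rk-w rk-sum = by-cases (nonzero-entry v) (nonzero-entry w)
    where
    module _ (a : Fin m) (b≢0 : v a ≢ 0#) (c : Fin m) (d≢0 : w c ≢ 0#) where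
      open Factor rk-v a b≢0 renaming (row to α; factor to v≡; Φ-factor to Φv≡) using ()
      open Factor rk-w c d≢0 renaming (row to β; factor to w≡; Φ-factor to Φw≡) using ()
      b d : K
      b = v a
      d = w c

      same-column : b * Φ d ≡ d * Φ b → SameColumn v w
      same-column bd i j = begin
        v i * Φ (w j)             ≡⟨ cong₂ _*_ (v≡ i) (Φw≡ j) ⟩
        α i * b * (β j * Φ d)     ≡⟨ solve 4 (λ a b c d → a :* b :* (c :* d) := c :* a :* (b :* d)) refl (α i) b (β j) (Φ d) ⟩
        β j * α i * (b * Φ d)     ≡⟨ cong (β j * α i *_) bd ⟩
        β j * α i * (d * Φ b)     ≡⟨ solve 4 (λ c a d b → c :* a :* (d :* b) := c :* d :* (a :* b)) refl (β j) (α i) d (Φ b) ⟩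
        β j * d * (α i * Φ b)     ≡⟨ cong₂ _*_ (w≡ j) (Φv≡ i) ⟨
        w j * Φ (v i)             ∎

      sum≡ : ∀ i → (v ⊞ w) i ≡ α i * b + β i * d
      sum≡ i = cong₂ _+_ (v≡ i) (w≡ i)

      Φsum : ∀ i → Φ ((v ⊞ w) i) ≡ α i * Φ b + β i * Φ d
      Φsum i = Fr-+ 1 _ _ ∙ cong₂ _+_ (Φv≡ i) (Φw≡ i)

      minor : b * Φ d ≢ d * Φ b → ∀ i j → α i * β j ≡ α j * β i
      minor bd≢ i j = −≡0⇒≡ (*-cancelʳ-0 (λ eq → bd≢ (−≡0⇒≡ eq)) (begin
        (α i * β j − α j * β i) * (b * Φ d − d * Φ b)
          ≡⟨ solve 8 (λ ai aj bi bj b d fb fd →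
               (ai :* bj :+ :- (aj :* bi)) :* (b :* fd :+ :- (d :* fb)) :=
               (ai :* b :+ bi :* d) :* (aj :* fb :+ bj :* fd) :+
               :- ((aj :* b :+ bj :* d) :* (ai :* fb :+ bi :* fd)))
               refl (α i) (α j) (β i) (β j) b d (Φ b) (Φ d) ⟩
        (α i * b + β i * d) * (α j * Φ b + β j * Φ d) − (α j * b + β j * d) * (α i * Φ b + β i * Φ d)
          ≡⟨ cong₂ _−_ (cong₂ _*_ (sum≡ i) (Φsum j)) (cong₂ _*_ (sum≡ j) (Φsum i)) ⟨
        (v ⊞ w) i * Φ ((v ⊞ w) j) − (v ⊞ w) j * Φ ((v ⊞ w) i)
          ≡⟨ ≡⇒−≡0 (rk-sum i j) ⟩
        0# ∎))

      same-row : b * Φ d ≢ d * Φ b → SameRow v w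
      same-row bd≢ i j = begin
        v i * w j                 ≡⟨ cong₂ _*_ (v≡ i) (w≡ j) ⟩
        α i * b * (β j * d)       ≡⟨ solve 4 (λ a b c d → a :* b :* (c :* d) := (a :* c) :* (b :* d)) refl (α i) b (β j) d ⟩
        α i * β j * (b * d)       ≡⟨ cong (_* (b * d)) (minor bd≢ i j) ⟩
        α j * β i * (b * d)       ≡⟨ solve 4 (λ a b c d → (a :* c) :* (b :* d) := c :* d :* (a :* b)) refl (α j) b (β i) d ⟩
        β i * d * (α j * b)       ≡⟨ cong₂ _*_ (w≡ i) (v≡ j) ⟨
        w i * v j                 ∎

      decide : Dec (b * Φ d ≡ d * Φ b) → SameRow v w ⊎ SameColumn v w
      decide (yes eq) = inj₂ (same-column eq)
      decide (no ≢) = inj₁ (same-row ≢)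

    by-cases : (∀ i → v i ≡ 0#) ⊎ (Σ (Fin m) λ i → v i ≢ 0#) → (∀ i → w i ≡ 0#) ⊎ (Σ (Fin m) λ i → w i ≢ 0#) →
               SameRow v w ⊎ SameColumn v w
    by-cases (inj₁ v≡0) _ = inj₁ λ i j → cong (_* w j) (v≡0 i) ∙ zeroˡ _ ∙
      sym (cong (w i *_) (v≡0 j) ∙ zeroʳ _)
    by-cases (inj₂ _) (inj₁ w≡0) = inj₁ λ i j → cong (v i *_) (w≡0 j) ∙ zeroʳ _ ∙
      sym (cong (_* v j) (w≡0 i) ∙ zeroˡ _)
    by-cases (inj₂ (a , b≢0)) (inj₂ (c , d≢0)) = decide a b≢0 c d≢0 (_ ≟ _)

  -- Additivity in the second argument: the vectors parallel to `v` in a given way form a group. The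
  -- column version is alike.
  sameRow-cancel : ∀ {v w w′} → SameRow v w → SameRow v (w ⊞ w′) → SameRow v w′
  sameRow-cancel {v} {w} {w′} r r′ i j = +-cancelˡ (v i * w j)
    (sym (distribˡ _ _ _) ∙ r′ i j ∙ distribʳ _ _ _ ∙ cong (_+ w′ i * v j) (sym (r i j)))

  sameColumn-cancel : ∀ {v w w′} → SameColumn v w → SameColumn v (w ⊞ w′) → SameColumn v w′
  sameColumn-cancel {v} {w} {w′} r r′ i j = +-cancelˡ (v i * Φ (w j))
    (sym (distribˡ _ _ _) ∙ cong (v i *_) (sym (Fr-+ 1 _ _)) ∙
      r′ i j ∙ distribʳ _ _ _ ∙ cong (_+ w′ j * Φ (v i)) (sym (r i j)))

  abstract
    sameRow? : ∀ v w → Dec (SameRow v w)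
    sameRow? v w = Finₚ.all? λ i → Finₚ.all? λ j → (v i * w j) ≟ (w i * v j)

  -- α ⊗ K is a maximal additive family of rank-one vectors, as K ≠ F_q.
  maximal-row : ∀ {θ} → ¬ InFq θ → ∀ α → (∀ i → InFq (α i)) → (Σ (Fin m) λ i → α i ≢ 0#) →
                ∀ z → RankOne z → (∀ b → RankOne (tensor α b ⊞ z)) → SameRow α z
  maximal-row {θ} θ∉ α α∈ (a , αa≢0) z rk-z rk-sum = by-cases (parallel 1#) (parallel θ)
    where
    parallel : ∀ b → SameRow (tensor α b) z ⊎ SameColumn (tensor α b) z
    parallel b = sameRow-or-sameColumn (tensor-RankOne b α∈) rk-z (rk-sum b)
    column : ∀ b → SameColumn (tensor α b) z → ∀ j → b * Φ (z j) ≡ z j * Φ b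
    column b eq j = *-cancelˡ (α a) αa≢0 (begin
      α a * (b * Φ (z j))     ≡⟨ *-assoc _ _ _ ⟨
      α a * b * Φ (z j)       ≡⟨ eq a j ⟩
      z j * Φ (α a * b)       ≡⟨ cong (z j *_) (hom (Fr-linear 1) b (α∈ a)) ⟩
      z j * (α a * Φ b)       ≡⟨ solve 3 (λ z a f → z :* (a :* f) := a :* (z :* f)) refl (z j) (α a) (Φ b) ⟩
      α a * (z j * Φ b)       ∎)
    -- The test value 1 gives `Φ (z j) ≡ z j`; the test value `θ` then gives `z j * (θ − Φ θ) ≡ 0#`,
    -- and `θ` is not fixed by `Φ`.
    vanishes : SameColumn (tensor α 1#) z → SameColumn (tensor α θ) z → ∀ j → z j ≡ 0#
    vanishes column₁ columnθ j = *-cancelʳ-0 (λ eq → θ∉ (fixed⇒Fq (sym (−≡0⇒≡ eq)))) (begin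
      z j * (θ − Φ θ)         ≡⟨ solve 3 (λ z t f → z :* (t :+ :- f) := t :* z :+ :- (z :* f)) refl (z j) θ (Φ θ) ⟩
      θ * z j − z j * Φ θ     ≡⟨ cong (λ x → θ * x − z j * Φ θ) fixed ⟨
      θ * Φ (z j) − z j * Φ θ ≡⟨ ≡⇒−≡0 (column θ columnθ j) ⟩
      0#                      ∎)
      where
      fixed : Φ (z j) ≡ z j
      fixed = sym (*-identityˡ _) ∙ column 1# column₁ j ∙ cong (z j *_) (Fr-1 1) ∙ *-identityʳ _
    by-cases : SameRow (tensor α 1#) z ⊎ SameColumn (tensor α 1#) z →
               SameRow (tensor α θ) z ⊎ SameColumn (tensor α θ) z → SameRow α z
    by-cases (inj₁ row) _ i j =
      cong (_* z j) (sym (*-identityʳ _)) ∙ row i j ∙ cong (z i *_) (*-identityʳ _)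
    by-cases (inj₂ _) (inj₁ row) i j = *-cancelˡ θ (λ θ≡0 → θ∉ (subst InFq (sym θ≡0) Fq.has-0))
      (solve 3 (λ θ a z → θ :* (a :* z) := a :* θ :* z) refl θ (α i) (z j) ∙
        row i j ∙ solve 3 (λ θ a z → z :* (a :* θ) := θ :* (z :* a)) refl θ (α j) (z i))
    by-cases (inj₂ column₁) (inj₂ columnθ) i j = cong (α i *_) (vanishes column₁ columnθ j) ∙
      (zeroʳ _) ∙ sym (cong (_* α j) (vanishes column₁ columnθ i) ∙ zeroˡ _)

  -- Additive bijections preserving rank at most one.

  module Preserver
      {θ : K} (θ∉ : ¬ InFq θ) (o : Fin m)
      (T T⁻¹ : Vector → Vector) (σ : K → K)
      (T-cong : ∀ {v w} → (∀ i → v i ≡ w i) → ∀ i → T v i ≡ T w i)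
      (T⁻¹-cong : ∀ {v w} → (∀ i → v i ≡ w i) → ∀ i → T⁻¹ v i ≡ T⁻¹ w i)
      (T-+ : ∀ v w i → T (v ⊞ w) i ≡ T v i + T w i)
      (T-hom : ∀ {c} v → InFq c → ∀ i → T (λ k → c * v k) i ≡ σ c * T v i)
      (σ∈ : ∀ {c} → InFq c → InFq (σ c))
      (T⁻¹T : ∀ v i → T⁻¹ (T v) i ≡ v i) (TT⁻¹ : ∀ v i → T (T⁻¹ v) i ≡ v i)
      (T-rank : ∀ {v} → RankOne v → RankOne (T v))
      (T-rank⁻¹ : ∀ {v} → RankOne (T v) → RankOne v)
    where

    T-injective : ∀ {v w} → (∀ i → T v i ≡ T w i) → ∀ i → v i ≡ w i
    T-injective {v} {w} eq i = sym (T⁻¹T v i) ∙ T⁻¹-cong eq i ∙ T⁻¹T w i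

    T-0 : ∀ i → T (λ _ → 0#) i ≡ 0#
    T-0 i = +-cancelˡ (T (λ _ → 0#) i) (sym (T-+ _ _ i) ∙
      T-cong (λ _ → +-identityˡ 0#) i ∙ sym (+-identityʳ _))

    T⁻¹-0 : ∀ i → T⁻¹ (λ _ → 0#) i ≡ 0#
    T⁻¹-0 = T-injective (λ i → TT⁻¹ _ i ∙ sym (T-0 i))

    T⁻¹-+ : ∀ v w i → T⁻¹ (v ⊞ w) i ≡ T⁻¹ v i + T⁻¹ w i
    T⁻¹-+ v w = T-injective (λ i → TT⁻¹ _ i ∙
      sym (T-+ _ _ i ∙ cong₂ _+_ (TT⁻¹ v i) (TT⁻¹ w i)))

    T⁻¹-hom : ∀ {c} v → InFq c → ∀ i → T⁻¹ (λ k → σ c * v k) i ≡ c * T⁻¹ v i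
    T⁻¹-hom {c} v c∈ = T-injective (λ i → TT⁻¹ _ i ∙
      sym (T-hom (T⁻¹ v) c∈ i ∙ cong (σ c *_) (TT⁻¹ v i)))

    Scalars : Vector → Set
    Scalars α = (∀ i → InFq (α i)) × Σ (Fin m) λ i → α i ≢ 0#

    T-nonzero : ∀ {v} → (Σ (Fin m) λ i → v i ≢ 0#) → Σ (Fin m) λ i → T v i ≢ 0#
    T-nonzero {v} (k , vk≢0) = by-cases (nonzero-entry (T v))
      where
      by-cases : (∀ i → T v i ≡ 0#) ⊎ (Σ (Fin m) λ i → T v i ≢ 0#) → Σ (Fin m) λ i → T v i ≢ 0#
      by-cases (inj₁ Tv≡0) = ⊥-elim (vk≢0 (T-injective (λ i → Tv≡0 i ∙ sym (T-0 i)) k))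
      by-cases (inj₂ found) = found

    T⁻¹-nonzero : ∀ {v} → (Σ (Fin m) λ i → v i ≢ 0#) → Σ (Fin m) λ i → T⁻¹ v i ≢ 0#
    T⁻¹-nonzero {v} (k , vk≢0) = by-cases (nonzero-entry (T⁻¹ v))
      where
      by-cases : (∀ i → T⁻¹ v i ≡ 0#) ⊎ (Σ (Fin m) λ i → T⁻¹ v i ≢ 0#) → Σ (Fin m) λ i → T⁻¹ v i ≢ 0#
      by-cases (inj₁ v≡0) = ⊥-elim (vk≢0 (sym (TT⁻¹ v k) ∙ T-cong v≡0 k ∙ T-0 k))
      by-cases (inj₂ found) = found

    RowType ColumnType : Vector → Set
    RowType α = Σ Vector λ β → (∀ i → InFq (β i)) × (∀ b → Σ K λ x → ∀ i → T (tensor α b) i ≡ tensor β x i)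
    ColumnType α = Σ K λ d → ∀ b → Σ Vector λ γ → (∀ i → InFq (γ i)) × (∀ i → T (tensor α b) i ≡ tensor γ d i)

    -- Since `α ⊗ K` is closed under addition, any two of its images are parallel in one of the two
    -- ways. Comparing all of them with the nonzero image of `α ⊗ 1` makes the choice uniform.
    row-or-column-type : ∀ α → Scalars α → RowType α ⊎ ColumnType α
    row-or-column-type α (α∈ , k , αk≢0) = conclude (rows-or-columns (all? (λ b → sameRow? (w 1#) (w b))))
      where
      w : K → Vector
      w b = T (tensor α b)
      w-rank : ∀ b → RankOne (w b)
      w-rank b = T-rank (tensor-RankOne b α∈)
      w-+ : ∀ b b′ i → (w b ⊞ w b′) i ≡ w (b + b′) i
      w-+ b b′ i = sym (T-+ _ _ i) ∙ T-cong (λ k → sym (distribˡ (α k) b b′)) i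
      dichotomy : ∀ b b′ → SameRow (w b) (w b′) ⊎ SameColumn (w b) (w b′)
      dichotomy b b′ = sameRow-or-sameColumn (w-rank b) (w-rank b′)
        (RankOne-cong (λ i → sym (w-+ b b′ i)) (w-rank (b + b′)))
      row-sum : ∀ b b′ → SameRow (w 1#) (w (b + b′)) → SameRow (w 1#) (w b ⊞ w b′)
      row-sum b b′ r i j = cong (w 1# i *_) (w-+ b b′ j) ∙ r i j ∙ cong (_* w 1# j) (sym (w-+ b b′ i))
      column-sum : ∀ b b′ → SameColumn (w 1#) (w (b + b′)) → SameColumn (w 1#) (w b ⊞ w b′)
      column-sum b b′ r i j = cong (λ z → w 1# i * Φ z) (w-+ b b′ j) ∙
        r i j ∙ cong (_* Φ (w 1# i)) (sym (w-+ b b′ j))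
      -- An additive group is not a union of two proper subgroups.
      rows-or-columns : (∀ b → SameRow (w 1#) (w b)) ⊎ (Σ K λ b → ¬ SameRow (w 1#) (w b)) →
                        (∀ b → SameRow (w 1#) (w b)) ⊎ (∀ b → SameColumn (w 1#) (w b))
      rows-or-columns (inj₁ rows) = inj₁ rows
      rows-or-columns (inj₂ (b , ¬row)) = inj₂ λ b′ → column b′ (dichotomy 1# b′) (dichotomy 1# (b′ + b)) (dichotomy 1# b)
        where
        column : ∀ b′ → SameRow (w 1#) (w b′) ⊎ SameColumn (w 1#) (w b′) →
                 SameRow (w 1#) (w (b′ + b)) ⊎ SameColumn (w 1#) (w (b′ + b)) →
                 SameRow (w 1#) (w b) ⊎ SameColumn (w 1#) (w b) → SameColumn (w 1#) (w b′)
        column b′ (inj₂ c) _ _ = c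
        column b′ (inj₁ r) (inj₁ r+) _ = ⊥-elim (¬row (sameRow-cancel {w 1#} {w b′} {w b} r (row-sum b′ b r+)))
        column b′ (inj₁ r) (inj₂ c+) (inj₁ row) = ⊥-elim (¬row row)
        column b′ (inj₁ r) (inj₂ c+) (inj₂ c) = sameColumn-cancel {w 1#} {w b} {w b′} c
          (column-sum b b′ (subst (λ z → SameColumn (w 1#) (w z)) (+-comm b′ b) c+))
      pivot : Σ (Fin m) λ i → w 1# i ≢ 0#
      pivot = T-nonzero (k , λ eq → αk≢0 (sym (*-identityʳ _) ∙ eq))
      a : Fin m
      a = proj₁ pivot
      open Factor (w-rank 1#) a (proj₂ pivot)
      conclude : (∀ b → SameRow (w 1#) (w b)) ⊎ (∀ b → SameColumn (w 1#) (w b)) → RowType α ⊎ ColumnType α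
      conclude (inj₁ rows) = inj₁ (row , row∈ , λ b → w b a , λ i → *-cancelˡ (w 1# a) (proj₂ pivot)
        (rows b a i ∙ cong (w b a *_) (factor i) ∙
          solve 3 (λ x β d → x :* (β :* d) := d :* (β :* x)) refl (w b a) (row i) (w 1# a)))
      conclude (inj₂ columns) = inj₂ (w 1# a , λ b → (λ i → w b i * inv (proj₂ pivot)) ,
        (λ i → ratio-Fq (proj₂ pivot) (sym (columns b a i))) , (λ i → sym (ratio-* (proj₂ pivot))))

    -- Maximality of `α ⊗ K` transported through `T`: membership of `z` in `α ⊗ K` can be tested
    -- entirely on the side of the images.
    recognise-row : ∀ α → Scalars α → ∀ z → RankOne (T z) → (∀ b → RankOne (T (tensor α b) ⊞ T z)) → SameRow α z
    recognise-row α (α∈ , nonzero) z rk rk-sum = maximal-row θ∉ α α∈ nonzero z (T-rank⁻¹ rk)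
      (λ b → T-rank⁻¹ (RankOne-cong (λ i → sym (T-+ _ _ i)) (rk-sum b)))

    -- The vector `β ⊗ d` is compatible with the images of both `α ⊗ K` and `α′ ⊗ K`. Its preimage
    -- `z` is nonzero and, by maximality, lies in both families, so `α` and `α′` are proportional.
    not-mixed : ∀ {α α′} → Scalars α → Scalars α′ → RowType α → ColumnType α′ → ∀ i j → α i * α′ j ≡ α j * α′ i
    not-mixed {α} {α′} α-sc α′-sc (β , β∈ , row) (d , column) i j =
      *-cancelˡ (z k * z k) (*-nonzero zk≢0 zk≢0) (begin
        z k * z k * (α i * α′ j)       ≡⟨ swap (z k) (α i) (α′ j) ⟩
        α i * z k * (α′ j * z k)       ≡⟨ cong₂ _*_ (α-row i k) (α′-row j k) ⟩
        z i * α k * (z j * α′ k)       ≡⟨ solve 4 (λ zi a zj b → zi :* a :* (zj :* b) := zj :* a :* (zi :* b)) refl (z i) (α k) (z j) (α′ k) ⟩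
        z j * α k * (z i * α′ k)       ≡⟨ cong₂ _*_ (α-row j k) (α′-row i k) ⟨
        α j * z k * (α′ i * z k)       ≡⟨ swap (z k) (α j) (α′ i) ⟨
        z k * z k * (α j * α′ i)       ∎)
      where
      swap : ∀ c x y → c * c * (x * y) ≡ x * c * (y * c)
      swap = solve 3 (λ c x y → c :* c :* (x :* y) := x :* c :* (y :* c)) refl
      z : Vector
      z = T⁻¹ (tensor β d)
      image-nonzero : ∀ {α} → Scalars α → Σ (Fin m) λ i → T (tensor α 1#) i ≢ 0#
      image-nonzero (_ , k , αk≢0) = T-nonzero (k , λ eq → αk≢0 (sym (*-identityʳ _) ∙ eq))
      l : Fin m
      l = proj₁ (image-nonzero α-sc)
      βl≢0 : β l ≢ 0#
      βl≢0 βl≡0 = proj₂ (image-nonzero α-sc) (proj₂ (row 1#) l ∙ cong (_* proj₁ (row 1#)) βl≡0 ∙ zeroˡ _)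
      d≢0 : d ≢ 0#
      d≢0 d≡0 = proj₂ (image-nonzero α′-sc) ((proj₂ (proj₂ (column 1#)) _) ∙
        cong (proj₁ (column 1#) _ *_) d≡0 ∙ zeroʳ _)
      z-nonzero : Σ (Fin m) λ k → z k ≢ 0#
      z-nonzero = T⁻¹-nonzero (l , *-nonzero βl≢0 d≢0)
      k : Fin m
      k = proj₁ z-nonzero
      zk≢0 : z k ≢ 0#
      zk≢0 = proj₂ z-nonzero
      Tz-rank : RankOne (T z)
      Tz-rank = RankOne-cong (λ i → sym (TT⁻¹ _ i)) (tensor-RankOne d β∈)
      α-row : SameRow α z
      α-row = recognise-row α α-sc z Tz-rank (λ b → RankOne-cong
        (λ i → sym (cong₂ _+_ (proj₂ (row b) i) (TT⁻¹ _ i) ∙ sym (distribˡ (β i) _ _)))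
        (tensor-RankOne (proj₁ (row b) + d) β∈))
      α′-row : SameRow α′ z
      α′-row = recognise-row α′ α′-sc z Tz-rank (λ b → RankOne-cong
        (λ i → sym (cong₂ _+_ (proj₂ (proj₂ (column b)) i) (TT⁻¹ _ i) ∙ sym (distribʳ d _ _)))
        (tensor-RankOne {λ i → proj₁ (column b) i + β i} d (λ i → Fq.has-+ (proj₁ (proj₂ (column b)) i) (β∈ i))))

    unit-scalars : ∀ i → Scalars (unit i)
    unit-scalars i = Fq.has-unit i , i , λ eq → 1≢0 (sym (unit-diag i) ∙ eq)

    pair : Fin m → Vector
    pair i = unit o ⊞ unit i

    pair-o : ∀ {i} → i ≢ o → pair i o ≡ 1#
    pair-o i≢o = cong₂ _+_ (unit-diag o) (unit-off i≢o) ∙ +-identityʳ 1#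

    pair-i : ∀ {i} → i ≢ o → pair i i ≡ 1#
    pair-i {i} i≢o = cong₂ _+_ (unit-off (i≢o ∘ sym)) (unit-diag i) ∙ +-identityˡ 1#

    pair-scalars : ∀ {i} → i ≢ o → Scalars (pair i)
    pair-scalars {i} i≢o = (λ k → Fq.has-+ (Fq.has-unit o k) (Fq.has-unit i k)) , o , λ eq → 1≢0 (sym (pair-o i≢o) ∙ eq)

    -- A witness that `α` is not a multiple of `unit o`, so that by `not-mixed` it inherits the type
    -- of `unit o`. Unit vectors and pairs are the only instances that matter.
    Transverse : Vector → Set
    Transverse α = Σ (Fin m) λ i → i ≢ o × α i ≢ 0#

    transverse⇒nonparallel : ∀ {α} → Transverse α → ¬ (∀ i j → unit o i * α j ≡ unit o j * α i)
    transverse⇒nonparallel {α} (i , i≢o , αi≢0) parallel = αi≢0 (begin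
      α i              ≡⟨ *-identityˡ (α i) ⟨
      1# * α i         ≡⟨ cong (_* α i) (unit-diag o) ⟨
      unit o o * α i   ≡⟨ parallel o i ⟩
      unit o i * α o   ≡⟨ cong (_* α o) (unit-off (i≢o ∘ sym)) ⟩
      0# * α o         ≡⟨ zeroˡ _ ⟩
      0#               ∎)

    unit-transverse : ∀ {i} → i ≢ o → Transverse (unit i)
    unit-transverse {i} i≢o = i , i≢o , λ eq → 1≢0 (sym (unit-diag i) ∙ eq)

    pair-transverse : ∀ {i} → i ≢ o → Transverse (pair i)
    pair-transverse {i} i≢o = i , i≢o , λ eq → 1≢0 (sym (pair-i i≢o) ∙ eq)

    transverse-row : RowType (unit o) → ∀ {α} → Scalars α → Transverse α → RowType α
    transverse-row row {α} α-sc transverse = by-cases (row-or-column-type α α-sc)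
      where
      by-cases : RowType α ⊎ ColumnType α → RowType α
      by-cases (inj₁ row′) = row′
      by-cases (inj₂ column) = ⊥-elim (transverse⇒nonparallel transverse
        (not-mixed (unit-scalars o) α-sc row column))

    transverse-column : ColumnType (unit o) → ∀ {α} → Scalars α → Transverse α → ColumnType α
    transverse-column column {α} α-sc transverse = by-cases (row-or-column-type α α-sc)
      where
      by-cases : RowType α ⊎ ColumnType α → ColumnType α
      by-cases (inj₂ column′) = column′
      by-cases (inj₁ row) = ⊥-elim (transverse⇒nonparallel transverse (λ i j →
        (*-comm _ _) ∙ sym (not-mixed α-sc (unit-scalars o) row column i j) ∙ *-comm _ _))

    -- `N` sends each image of `α ⊗ K` to a vector compatible with all these images. By
    -- `recognise-row` the conjugate of `N` under `T` then maps `α ⊗ K` into itself.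
    Clique : (Vector → Vector) → Vector → Set
    Clique N α = ∀ b → RankOne (N (T (tensor α b))) × (∀ b′ → RankOne (T (tensor α b′) ⊞ N (T (tensor α b))))

    record Admissible (N : Vector → Vector) : Set where
      field
        N-cong : ∀ {v w} → (∀ i → v i ≡ w i) → ∀ i → N v i ≡ N w i
        N-+ : ∀ v w i → N (v ⊞ w) i ≡ N v i + N w i
        N-hom : ∀ {c} v → InFq c → ∀ i → N (λ k → c * v k) i ≡ c * N v i
        clique-unit : ∀ i → Clique N (unit i)
        clique-pair : ∀ i → i ≢ o → Clique N (pair i)

    conjugate : (Vector → Vector) → Vector → Vector
    conjugate N v = T⁻¹ (N (T v))

    pulled : (Vector → Vector) → K → K
    pulled N z = conjugate N (λ _ → z) o

    module Pull {N : Vector → Vector} (admissible : Admissible N) where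
      open Admissible admissible

      private
        S : Vector → Vector
        S = conjugate N

      S-cong : ∀ {v w} → (∀ i → v i ≡ w i) → ∀ i → S v i ≡ S w i
      S-cong eq = T⁻¹-cong (N-cong (T-cong eq))

      S-+ : ∀ v w i → S (v ⊞ w) i ≡ S v i + S w i
      S-+ v w i = T⁻¹-cong (λ k → N-cong (T-+ v w) k ∙ N-+ _ _ k) i ∙ T⁻¹-+ _ _ i

      S-hom : ∀ {c} v → InFq c → ∀ i → S (λ k → c * v k) i ≡ c * S v i
      S-hom {c} v c∈ i = T⁻¹-cong (λ k → N-cong (T-hom v c∈) k ∙ N-hom (T v) (σ∈ c∈) k) i ∙
        T⁻¹-hom (N (T v)) c∈ i

      S-0 : ∀ i → S (λ _ → 0#) i ≡ 0#
      S-0 i = +-cancelˡ (S (λ _ → 0#) i) (sym (S-+ _ _ i) ∙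
        S-cong (λ _ → +-identityˡ 0#) i ∙ sym (+-identityʳ _))

      S-sum : ∀ {d} (W : Fin d → Vector) i → S (λ k → sumF (λ l → W l k)) i ≡ sumF (λ l → S (W l) i)
      S-sum {zero} W i = S-0 i
      S-sum {suc d} W i = (S-+ (W Fin.zero) _ i) ∙ cong (S (W Fin.zero) i +_) (S-sum (W ∘ Fin.suc) i)

      S-row : ∀ α → Scalars α → Clique N α → ∀ b → SameRow α (S (tensor α b))
      S-row α α-sc clique b = recognise-row α α-sc _
        (RankOne-cong (λ i → sym (TT⁻¹ _ i)) (proj₁ (clique b)))
        (λ b′ → RankOne-cong (λ i → cong (T (tensor α b′) i +_) (sym (TT⁻¹ _ i))) (proj₂ (clique b) b′))

      entry : Fin m → K → K
      entry i z = S (tensor (unit i) z) i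

      S-unit : ∀ i z k → S (tensor (unit i) z) k ≡ entry i z * unit i k
      S-unit i z k = sym (cong (_* S (tensor (unit i) z) k) (unit-diag i) ∙ *-identityˡ _) ∙
        S-row (unit i) (unit-scalars i) (clique-unit i) z i k

      -- The conjugate also stabilises `pair i ⊗ K`, whose vectors have equal entries at `o` and
      -- `i`; so the maps on these two entries agree.
      entry-o : ∀ i z → entry i z ≡ entry o z
      entry-o i z = by-cases (i Fin.≟ o)
        where
        by-cases : Dec (i ≡ o) → entry i z ≡ entry o z
        by-cases (yes refl) = refl
        by-cases (no i≢o) = begin
          entry i z                        ≡⟨ at-i ⟨
          S (tensor (pair i) z) i          ≡⟨ *-identityˡ _ ⟨
          1# * S (tensor (pair i) z) i     ≡⟨ cong (_* S (tensor (pair i) z) i) (pair-o i≢o) ⟨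
          pair i o * S (tensor (pair i) z) i ≡⟨ S-row (pair i) (pair-scalars i≢o) (clique-pair i i≢o) z o i ⟩
          S (tensor (pair i) z) o * pair i i ≡⟨ cong (S (tensor (pair i) z) o *_) (pair-i i≢o) ⟩
          S (tensor (pair i) z) o * 1#     ≡⟨ *-identityʳ _ ⟩
          S (tensor (pair i) z) o          ≡⟨ at-o ⟩
          entry o z                        ∎
          where
          split : ∀ k → S (tensor (pair i) z) k ≡ entry o z * unit o k + entry i z * unit i k
          split k = S-cong (λ l → distribʳ z (unit o l) (unit i l)) k ∙
            S-+ (tensor (unit o) z) (tensor (unit i) z) k ∙ cong₂ _+_ (S-unit o z k) (S-unit i z k)
          at-i : S (tensor (pair i) z) i ≡ entry i z
          at-i = split i ∙ cong₂ _+_ (cong (entry o z *_) (unit-off (i≢o ∘ sym)) ∙ zeroʳ _)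
            (cong (entry i z *_) (unit-diag i) ∙ *-identityʳ _) ∙ +-identityˡ _
          at-o : S (tensor (pair i) z) o ≡ entry o z
          at-o = split o ∙ cong₂ _+_ (cong (entry o z *_) (unit-diag o) ∙ *-identityʳ _)
            (cong (entry i z *_) (unit-off i≢o) ∙ zeroʳ _) ∙ +-identityʳ _

      -- A vector is the sum of its tensors with unit vectors, each of which is stable. The
      -- conjugate is thus composition on the left with a single map of `K`, which `pulled` reads
      -- off from constant vectors.
      S-entry : ∀ v k → S v k ≡ entry o (v k)
      S-entry v k = begin
        S v k
          ≡⟨ S-cong (λ l → sym (sumF-unitʳ l v) ∙ sumF-cong {m} (λ i → *-comm (v i) (unit i l))) k ⟩
        S (λ l → sumF (λ i → tensor (unit i) (v i) l)) k
          ≡⟨ S-sum (λ i → tensor (unit i) (v i)) k ⟩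
        sumF (λ i → S (tensor (unit i) (v i)) k)
          ≡⟨ sumF-cong {m} (λ i → S-unit i (v i) k) ⟩
        sumF (λ i → entry i (v i) * unit i k)
          ≡⟨ sumF-unitʳ k (λ i → entry i (v i)) ⟩
        entry k (v k)
          ≡⟨ entry-o k (v k) ⟩
        entry o (v k) ∎

      conjugate-pulled : ∀ v k → conjugate N v k ≡ pulled N (v k)
      conjugate-pulled v k = S-entry v k ∙ sym (S-entry (λ _ → v k) o)

      pulled-linear : Linear (pulled N)
      pulled-linear = linear (λ x y → S-+ (λ _ → x) (λ _ → y) o) (λ x c∈ → S-hom (λ _ → x) c∈ o)

    row-clique : ∀ {A} → Linear A → ∀ {α} → RowType α → Clique (λ v i → A (v i)) α
    row-clique {A} A-lin {α} (β , β∈ , row) b = RankOne-cong (λ i → sym (image i)) (tensor-RankOne (A x) β∈) ,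
      λ b′ → RankOne-cong (λ i → sym (cong₂ _+_ (proj₂ (row b′) i) (image i) ∙ sym (distribˡ (β i) _ _)))
        (tensor-RankOne (proj₁ (row b′) + A x) β∈)
      where
      x : K
      x = proj₁ (row b)
      image : ∀ i → A (T (tensor α b) i) ≡ β i * A x
      image i = cong A (proj₂ (row b) i) ∙ hom A-lin x (β∈ i)

    -- The images share the factor `d`, and a matrix over F_q acts only on the other factor. In the
    -- row case the roles are exchanged, and linear maps of `K` act.
    column-clique : ∀ {M : Fin m → Fin m → K} → (∀ i k → InFq (M i k)) → ∀ {α} → ColumnType α →
                    Clique (λ v i → sumF (λ k → M i k * v k)) α
    column-clique {M} M∈ {α} (d , column) b = RankOne-cong (λ i → sym (image i)) (tensor-RankOne d γ∈) ,
      λ b′ → RankOne-cong (λ i → sym (cong₂ _+_ (proj₂ (proj₂ (column b′)) i) (image i) ∙ sym (distribʳ d _ _)))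
        (tensor-RankOne {λ i → proj₁ (column b′) i + γ i} d (λ i → Fq.has-+ (proj₁ (proj₂ (column b′)) i) (γ∈ i)))
      where
      γ : Vector
      γ i = sumF (λ k → M i k * proj₁ (column b) k)
      γ∈ : ∀ i → InFq (γ i)
      γ∈ i = Fq.has-sum {m} (λ k → Fq.has-* (M∈ i k) (proj₁ (proj₂ (column b)) k))
      image : ∀ i → sumF (λ k → M i k * T (tensor α b) k) ≡ γ i * d
      image i = sumF-cong {m} (λ k → cong (M i k *_) (proj₂ (proj₂ (column b)) k) ∙ sym (*-assoc _ _ _)) ∙
        sym (sumF-*ʳ {m} d (λ k → M i k * proj₁ (column b) k))

    row-admissible : RowType (unit o) → ∀ {A} → Linear A → Admissible (λ v i → A (v i))
    row-admissible row {A} A-lin = record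
      { N-cong = λ eq i → cong A (eq i)
      ; N-+ = λ v w i → add A-lin (v i) (w i)
      ; N-hom = λ v c∈ i → hom A-lin (v i) c∈
      ; clique-unit = λ i → row-clique A-lin (unit-row i (i Fin.≟ o))
      ; clique-pair = λ i i≢o → row-clique A-lin (transverse-row row (pair-scalars i≢o) (pair-transverse i≢o))
      }
      where
      unit-row : ∀ i → Dec (i ≡ o) → RowType (unit i)
      unit-row i (yes refl) = row
      unit-row i (no i≢o) = transverse-row row (unit-scalars i) (unit-transverse i≢o)

    column-admissible : ColumnType (unit o) → ∀ {M : Fin m → Fin m → K} → (∀ i k → InFq (M i k)) →
                        Admissible (λ v i → sumF (λ k → M i k * v k))
    column-admissible column {M} M∈ = record
      { N-cong = λ eq i → sumF-cong {m} (λ k → cong (M i k *_) (eq k))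
      ; N-+ = λ v w i → sumF-cong {m} (λ k → distribˡ (M i k) (v k) (w k)) ∙
                sumF-+ {m} (λ k → M i k * v k) (λ k → M i k * w k)
      ; N-hom = λ {c} v c∈ i → sumF-cong {m} (λ k → solve 3 (λ m c v → m :* (c :* v) := c :* (m :* v)) refl (M i k) c (v k)) ∙
          sym (sumF-*ˡ {m} c (λ k → M i k * v k))
      ; clique-unit = λ i → column-clique M∈ (unit-column i (i Fin.≟ o))
      ; clique-pair = λ i i≢o → column-clique M∈ (transverse-column column (pair-scalars i≢o) (pair-transverse i≢o))
      }
      where
      unit-column : ∀ i → Dec (i ≡ o) → ColumnType (unit i)
      unit-column i (yes refl) = column
      unit-column i (no i≢o) = transverse-column column (unit-scalars i) (unit-transverse i≢o)

  -- Expansion of linear maps on F_{q^m} in powers of Frobenius.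

  module Coefficients {{_ : ℕ.NonZero m}} (e : Fin m → K) (basis : IsBasis InFqm e) where
    open Congruence m

    e∈ : ∀ i → InFqm (e i)
    e∈ = proj₁ basis

    e-independent : LinIndep e
    e-independent = proj₁ (proj₂ basis)

    e-spans : Spans InFqm e
    e-spans = proj₂ (proj₂ basis)

    Fr-% : ∀ d {x} → InFqm x → Fr (d % m) x ≡ Fr d x
    Fr-% d {x} x∈ = sym (cong (λ r → Fr r x) (m≡m%n+[m/n]*n d m) ∙
      (Fr-∘ (d % m) _ x) ∙ cong (Fr (d % m)) (Fr-fixed-* x∈ (d / m)))

    private
      -- Row `i` of the inverse of the Moore matrix of `e`; `moore` says that the rows of that
      -- matrix are independent over `K`.
      left-inverse : ∀ i → Σ (Fin m → K) λ c → (∀ r → Whole (c r)) ×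
                     (∀ j → sumF (λ r → c r * Fr (toℕ r) (e j)) ≡ unit i j)
      left-inverse i = Elimination.spanning whole m (λ r j → Fr (toℕ r) (e j)) _ rows-independent (unit i) _
        where
        rows-independent : ∀ c → _ → (∀ j → sumF (λ r → c r * Fr (toℕ r) (e j)) ≡ 0#) → ∀ r → c r ≡ 0#
        rows-independent c _ vanishing r = sym (ext-toℕ c r) ∙ moore m e e-independent (ext c)
          (λ j → sym (sumF-ext c (λ r → Fr r (e j))) ∙ vanishing j) (toℕ r) (Finₚ.toℕ<n r)

    abstract
      dual : Fin m → ℕ → K
      dual i r = ext (proj₁ (left-inverse i)) (r % m)

      -- A linear φ is Σ_{r<m} coeff r φ · Fr r on F_{q^m}; the index r is read modulo m.
      coeff : ℕ → (K → K) → K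
      coeff r φ = sumF (λ i → φ (e i) * dual i r)

      dual-left-inverse : ∀ i j → sumN m (λ r → dual i r * Fr r (e j)) ≡ unit i j
      dual-left-inverse i j = sumN-cong m (λ r r<m →
          cong (λ s → ext (proj₁ (left-inverse i)) s * Fr r (e j)) (m<n⇒m%n≡m r<m)) ∙
        sym (sumF-ext (proj₁ (left-inverse i)) (λ r → Fr r (e j))) ∙ proj₂ (proj₂ (left-inverse i)) j

      -- The q-polynomial of q-degree below `m` taking the value `v i` at `e i`. It is a function on
      -- all of `K`, but only its restriction to F_{q^m} represents the vector.
      interpolate : (Fin m → K) → K → K
      interpolate v x = sumN m (λ r → sumF (λ i → v i * dual i r) * Fr r x)

      interpolate-linear : ∀ v → Linear (interpolate v)
      interpolate-linear v = sumN-linear m (λ r → ∘-linear (*ˡ-linear (sumF (λ i → v i * dual i r))) (Fr-linear r))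

      interpolate-e : ∀ v j → interpolate v (e j) ≡ v j
      interpolate-e v j = begin
        sumN m (λ r → sumF (λ i → v i * dual i r) * Fr r (e j))
          ≡⟨ sumN-cong m (λ r _ → sumF-*ʳ (Fr r (e j)) (λ i → v i * dual i r) ∙
               sumF-cong {m} (λ i → *-assoc _ _ _)) ⟩
        sumN m (λ r → sumF (λ i → v i * (dual i r * Fr r (e j))))
          ≡⟨ sumF-sumN-swap {m} m (λ i r → v i * (dual i r * Fr r (e j))) ⟨
        sumF (λ i → sumN m (λ r → v i * (dual i r * Fr r (e j))))
          ≡⟨ sumF-cong {m} (λ i → sym (sumN-*ˡ m (v i) _) ∙ cong (v i *_) (dual-left-inverse i j)) ⟩
        sumF (λ i → v i * unit i j)
          ≡⟨ sumF-unitʳ j v ⟩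
        v j ∎

      expand : ∀ {φ} → Linear φ → ∀ {x} → InFqm x → φ x ≡ sumN m (λ r → coeff r φ * Fr r x)
      expand {φ} φ-lin = linear-unique e-spans φ-lin (interpolate-linear (φ ∘ e))
        (λ j → sym (interpolate-e (φ ∘ e) j))

      coeff-cong : ∀ r {φ ψ} → (∀ {x} → InFqm x → φ x ≡ ψ x) → coeff r φ ≡ coeff r ψ
      coeff-cong r eq = sumF-cong {m} (λ i → cong (_* dual i r) (eq (e∈ i)))

      coeff-≋ : ∀ {r s} φ → r ≋ s → coeff r φ ≡ coeff s φ
      coeff-≋ φ r≋s = sumF-cong {m} (λ i → cong (λ k → φ (e i) * ext (proj₁ (left-inverse i)) k) r≋s)

      coeff-+ : ∀ r φ ψ → coeff r (λ x → φ x + ψ x) ≡ coeff r φ + coeff r ψ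
      coeff-+ r φ ψ = sumF-cong {m} (λ i → distribʳ (dual i r) _ _) ∙ (sumF-+ {m} _ _)

      coeff-*ˡ : ∀ r c φ → coeff r (λ x → c * φ x) ≡ c * coeff r φ
      coeff-*ˡ r c φ = sumF-cong {m} (λ i → *-assoc _ _ _) ∙ sym (sumF-*ˡ c (λ i → φ (e i) * dual i r))

      coeff-0 : ∀ r {φ} → (∀ {x} → InFqm x → φ x ≡ 0#) → coeff r φ ≡ 0#
      coeff-0 r eq = sumF-0 {m} (λ i → cong (_* dual i r) (eq (e∈ i)) ∙ zeroˡ _)

    coeff-sumN : ∀ r d (φ : ℕ → K → K) →
                       coeff r (λ x → sumN d (λ i → φ i x)) ≡ sumN d (λ i → coeff r (φ i))
    coeff-sumN r zero φ = coeff-0 r (λ _ → refl)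
    coeff-sumN r (suc d) φ = coeff-+ r (λ x → sumN d (λ i → φ i x)) (φ d) ∙
      cong (_+ coeff r (φ d)) (coeff-sumN r d φ)

    private
      expand-unique : ∀ (c d : ℕ → K) → (∀ {x} → InFqm x →
        sumN m (λ r → c r * Fr r x) ≡ sumN m (λ r → d r * Fr r x)) →
                      ∀ r → r < m → c r ≡ d r
      expand-unique c d eq r r<m = −≡0⇒≡ (moore m e e-independent (λ r → c r − d r) (λ i → begin
        sumN m (λ r → (c r − d r) * Fr r (e i))
          ≡⟨ sumN-cong m (λ r _ → distribʳ _ _ _) ⟩
        sumN m (λ r → c r * Fr r (e i) + - d r * Fr r (e i))
          ≡⟨ sumN-+ m _ _ ⟩
        sumN m (λ r → c r * Fr r (e i)) + sumN m (λ r → - d r * Fr r (e i))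
          ≡⟨ cong₂ _+_ (eq (e∈ i)) (sumN-cong m (λ r _ → sym (-‿distribˡ-* _ _))) ⟩
        sumN m (λ r → d r * Fr r (e i)) + sumN m (λ r → - (d r * Fr r (e i)))
          ≡⟨ cong (sumN m (λ r → d r * Fr r (e i)) +_) (sumN-additive m (λ a b → sym (-‿+-comm a b)) _) ⟨
        sumN m (λ r → d r * Fr r (e i)) − sumN m (λ r → d r * Fr r (e i))
          ≡⟨ -‿inverseʳ _ ⟩
        0# ∎) r r<m)

      delta : ℕ → K → ℕ → K
      delta s c r with r ℕ.≟ s
      ... | yes _ = c
      ... | no _ = 0#

      delta-hit : ∀ s c → delta s c s ≡ c
      delta-hit s c with s ℕ.≟ s
      ... | yes _ = refl
      ... | no s≢s = ⊥-elim (s≢s refl)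

      delta-miss : ∀ {s} c {r} → r ≢ s → delta s c r ≡ 0#
      delta-miss {s} c {r} r≢s with r ℕ.≟ s
      ... | yes r≡s = ⊥-elim (r≢s r≡s)
      ... | no _ = refl

      coeff-monomial : ∀ r c d → coeff r (λ x → c * Fr d x) ≡ delta (d % m) c (r % m)
      coeff-monomial r c d = coeff-≋ {r} {r % m} (λ x → c * Fr d x) (sym (≋-% r)) ∙
        expand-unique (λ r → coeff r (λ x → c * Fr d x)) (delta (d % m) c)
          (λ {x} x∈ → sym (expand (∘-linear (*ˡ-linear c) (Fr-linear d)) x∈) ∙ sym (begin
            sumN m (λ r → delta (d % m) c r * Fr r x)
              ≡⟨ sumN-single m (d % m) (m%n<n d m) _
                   (λ j _ j≢ → cong (_* Fr j x) (delta-miss c j≢) ∙ zeroˡ _) ⟩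
            delta (d % m) c (d % m) * Fr (d % m) x
              ≡⟨ cong₂ _*_ (delta-hit (d % m) c) (Fr-% d x∈) ⟩
            c * Fr d x ∎)) (r % m) (m%n<n r m)

    coeff-hit : ∀ {r d} c → r ≋ d → coeff r (λ x → c * Fr d x) ≡ c
    coeff-hit {r} {d} c r≋d = coeff-monomial r c d ∙
      cong (delta (d % m) c) r≋d ∙ delta-hit (d % m) c

    coeff-miss : ∀ {r d} c → ¬ (r ≋ d) → coeff r (λ x → c * Fr d x) ≡ 0#
    coeff-miss {r} {d} c r≢d = coeff-monomial r c d ∙ delta-miss c r≢d

    coeff-shift : ∀ r d {φ} → Linear φ → coeff (r ℕ.+ d) (λ x → φ (Fr d x)) ≡ coeff r φ
    coeff-shift r d {φ} φ-lin = begin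
      coeff (r ℕ.+ d) (λ x → φ (Fr d x))
        ≡⟨ coeff-cong (r ℕ.+ d) (λ {x} x∈ → expand φ-lin (Fr-Fqm d x∈) ∙
             sumN-cong m (λ s _ → cong (coeff s φ *_) (sym (Fr-∘ s d x)))) ⟩
      coeff (r ℕ.+ d) (λ x → sumN m (λ s → coeff s φ * Fr (s ℕ.+ d) x))
        ≡⟨ coeff-sumN (r ℕ.+ d) m (λ s x → coeff s φ * Fr (s ℕ.+ d) x) ⟩
      sumN m (λ s → coeff (r ℕ.+ d) (λ x → coeff s φ * Fr (s ℕ.+ d) x))
        ≡⟨ sumN-single m (r % m) (m%n<n r m) _ (λ s s<m s≢ → coeff-miss (coeff s φ)
             (λ eq → s≢ (sym (m<n⇒m%n≡m s<m) ∙ sym (≋-+-cancelʳ d {r} {s} eq)))) ⟩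
      coeff (r ℕ.+ d) (λ x → coeff (r % m) φ * Fr (r % m ℕ.+ d) x)
        ≡⟨ coeff-hit (coeff (r % m) φ) (≋-+ {r} {r % m} {d} {d} (sym (≋-% r)) refl) ⟩
      coeff (r % m) φ
        ≡⟨ coeff-≋ φ (≋-% r) ⟩
      coeff r φ ∎

    -- The twisted code.

    module TwistedCode
        (g t τ : ℕ) (η : K) (η≢0 : η ≢ 0#)
        (g-injective : ∀ {i j} → i < m → j < m → g ℕ.* i ≋ g ℕ.* j → i ≡ j)
        (g-surjective : ∀ r → Σ ℕ λ i → i < m × g ℕ.* i ≋ r)
        (1≤t : 1 ≤ t) (t+2≤m : t ℕ.+ 2 ≤ m) (τ≢gt : ¬ (τ ≋ g ℕ.* t))
      where
      -- An F_q-linear endomorphism of `K` is a sum of parts that are `Fr r`-semilinear over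
      -- F_{q^m}, one for each `r` modulo `m`; this is the part belonging to `r`, obtained by
      -- expanding `y ↦ Z (y * z)`.
      component : (K → K) → ℕ → K → K
      component Z r z = coeff r (λ y → Z (y * z))

      module _ {Z : K → K} (Z-linear : Linear Z) where
        component-expand : ∀ z {y} → InFqm y → Z (y * z) ≡ sumN m (λ r → component Z r z * Fr r y)
        component-expand z = expand (∘-linear Z-linear (*ʳ-linear z))

        -- Expand `Z ((x * y) * z)` in powers of Frobenius of `x * y`, then compare coefficients as
        -- functions of `x` alone.
        component-semilinear : ∀ r {y} z → InFqm y → component Z r (y * z) ≡ Fr r y * component Z r z
        component-semilinear r {y} z y∈ = begin
          coeff r (λ x → Z (x * (y * z)))
            ≡⟨ coeff-cong r (λ {x} x∈ → cong Z (sym (*-assoc x y z)) ∙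
                 component-expand z (Fqm.has-* x∈ y∈) ∙
                   sumN-cong m (λ s _ → cong (component Z s z *_) (Fr-* s x y) ∙
                     (solve 3 (λ c a b → c :* (a :* b) := b :* c :* a) refl _ _ _))) ⟩
          coeff r (λ x → sumN m (λ s → Fr s y * component Z s z * Fr s x))
            ≡⟨ coeff-sumN r m (λ s x → Fr s y * component Z s z * Fr s x) ⟩
          sumN m (λ s → coeff r (λ x → Fr s y * component Z s z * Fr s x))
            ≡⟨ sumN-single m (r % m) (m%n<n r m) _ (λ s s<m s≢ → coeff-miss _
                 (λ r≋s → s≢ (sym (r≋s ∙ m<n⇒m%n≡m s<m)))) ⟩
          coeff r (λ x → Fr (r % m) y * component Z (r % m) z * Fr (r % m) x)
            ≡⟨ coeff-hit _ (sym (≋-% r)) ⟩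
          Fr (r % m) y * component Z (r % m) z
            ≡⟨ cong₂ _*_ (Fr-% r y∈) (coeff-≋ _ (≋-% r)) ⟩
          Fr r y * component Z r z ∎

        component-monomial : ∀ r d b → coeff (r ℕ.+ d) (λ x → Z (b * Fr d x)) ≡ component Z r b
        component-monomial r d b = coeff-shift r d (∘-linear Z-linear (*ˡ-linear b)) ∙
          coeff-cong r (λ {x} _ → cong Z (*-comm b x))

      -- Different powers of Frobenius on F_{q^m} are linearly independent over `K`; the coefficient
      -- at `r` isolates `P`.
      distinct-exponents : ∀ {r s} P Q → ¬ (r ≋ s) → (∀ {y} → InFqm y → Fr r y * P + Fr s y * Q ≡ 0#) → P ≡ 0#
      distinct-exponents {r} {s} P Q r≢s vanishing = begin
        P      ≡⟨ +-identityʳ P ⟨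
        P + 0# ≡⟨ cong₂ _+_ (coeff-hit {r} {r} P refl) (coeff-miss {r} {s} Q r≢s) ⟨
        coeff r (λ y → P * Fr r y) + coeff r (λ y → Q * Fr s y)
          ≡⟨ coeff-+ r (λ y → P * Fr r y) (λ y → Q * Fr s y) ⟨
        coeff r (λ y → P * Fr r y + Q * Fr s y)
          ≡⟨ coeff-0 r (λ y∈ → cong₂ _+_ (*-comm _ _) (*-comm _ _) ∙ vanishing y∈) ⟩
        0# ∎

      -- Applying `A` to `c * Fr s x` gives `A c * Fr (a + s) x`: the exponent moves by `a`, and the
      -- coefficient is replaced by its image.
      semilinear-coeff : ∀ {A a φ} → Linear A → (∀ {y} z → InFqm y → A (y * z) ≡ Fr a y * A z) →
                               Linear φ → ∀ s → coeff (a ℕ.+ s) (A ∘ φ) ≡ A (coeff s φ)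
      semilinear-coeff {A} {a} {φ} A-lin A-semi φ-lin s = begin
        coeff (a ℕ.+ s) (A ∘ φ)
          ≡⟨ coeff-cong (a ℕ.+ s) (λ {x} x∈ → cong A (expand φ-lin x∈) ∙
               (sumN-additive m (add A-lin) _) ∙ sumN-cong m (λ r _ →
                 cong A (*-comm _ _) ∙ (A-semi _ (Fr-Fqm r x∈)) ∙
                   (*-comm _ _) ∙ cong (A (coeff r φ) *_) (sym (Fr-∘ a r x)))) ⟩
        coeff (a ℕ.+ s) (λ x → sumN m (λ r → A (coeff r φ) * Fr (a ℕ.+ r) x))
          ≡⟨ coeff-sumN (a ℕ.+ s) m (λ r x → A (coeff r φ) * Fr (a ℕ.+ r) x) ⟩
        sumN m (λ r → coeff (a ℕ.+ s) (λ x → A (coeff r φ) * Fr (a ℕ.+ r) x))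
          ≡⟨ sumN-single m (s % m) (m%n<n s m) _ (λ r r<m r≢ → coeff-miss _
               (λ eq → r≢ (sym (≋-+-cancelˡ a {s} {r} eq ∙ m<n⇒m%n≡m r<m)))) ⟩
        coeff (a ℕ.+ s) (λ x → A (coeff (s % m) φ) * Fr (a ℕ.+ s % m) x)
          ≡⟨ coeff-hit _ (≋-+ˡ a {s} {s % m} (sym (≋-% s))) ⟩
        A (coeff (s % m) φ)
          ≡⟨ cong A (coeff-≋ φ (≋-% s)) ⟩
        A (coeff s φ) ∎

      abstract
        Fr-surjective : ∀ d y → Σ K λ x → Fr d x ≡ y
        Fr-surjective d = injective⇒surjective (Fr d) (λ x y eq → −≡0⇒≡ (kernel (x − y)
          (additive-− (Fr-+ d) x y ∙ ≡⇒−≡0 eq)))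
          where
          kernel : ∀ x → Fr d x ≡ 0# → x ≡ 0#
          kernel x Fr≡0 with x ≟ 0#
          ... | yes x≡0 = x≡0
          ... | no x≢0 = ⊥-elim (Fr-nonzero d x≢0 Fr≡0)

      twist : K → K
      twist b = η * Fr τ b

      twist-* : ∀ y b → twist (y * b) ≡ Fr τ y * twist b
      twist-* y b = cong (η *_) (Fr-* τ y b) ∙
        solve 3 (λ η a b → η :* (a :* b) := a :* (η :* b)) refl η (Fr τ y) (Fr τ b)

      twist-nonzero : ∀ {b} → b ≢ 0# → twist b ≢ 0#
      twist-nonzero b≢0 = *-nonzero η≢0 (Fr-nonzero τ b≢0)

      twist-0⇒0 : ∀ {b} → twist b ≡ 0# → b ≡ 0#
      twist-0⇒0 {b} tb≡0 with b ≟ 0#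
      ... | yes b≡0 = b≡0
      ... | no b≢0 = ⊥-elim (twist-nonzero b≢0 tb≡0)

      twist-surjective : ∀ y → Σ K λ x → twist x ≡ y
      twist-surjective y = proj₁ root , cong (η *_) (proj₂ root) ∙ sym (*-assoc _ _ _) ∙
                             cong (_* y) (*-inv η≢0) ∙ *-identityˡ y
        where root = Fr-surjective τ (inv η≢0 * y)

      -- The twisted code, as linear maps on F_{q^m}: σ = Fr g, and the coefficients of
      -- σ^0 and σ^t are coupled by twist.
      InCode : (K → K) → Set
      InCode φ = Σ (ℕ → K) λ c → c t ≡ twist (c 0) ×
                 (∀ {x} → InFqm x → φ x ≡ sumN (suc t) (λ i → c i * Fr (g ℕ.* i) x))

      t<m : t < m
      t<m = ℕₚ.≤-trans (ℕₚ.≤-trans (ℕₚ.≤-reflexive (ℕₚ.+-comm 1 t)) (ℕₚ.+-monoʳ-≤ t (ℕ.s≤s ℕ.z≤n))) t+2≤m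

      0<m : 0 < m
      0<m = ℕₚ.≤-<-trans ℕ.z≤n t<m

      gt≢0 : ¬ (g ℕ.* t ≋ 0)
      gt≢0 eq = ℕₚ.<⇒≢ 1≤t (sym (g-injective t<m 0<m (eq ∙ cong (_% m) (sym (ℕₚ.*-zeroʳ g)))))

      module _ {φ : K → K} (code : InCode φ) where
        private
          c = proj₁ code

          coeff-terms : ∀ r → coeff r φ ≡ sumN (suc t) (λ i → coeff r (λ x → c i * Fr (g ℕ.* i) x))
          coeff-terms r = coeff-cong r (proj₂ (proj₂ code)) ∙
            coeff-sumN r (suc t) (λ i x → c i * Fr (g ℕ.* i) x)

        code-coeff : ∀ i → i ≤ t → coeff (g ℕ.* i) φ ≡ c i
        code-coeff i i≤t = coeff-terms (g ℕ.* i) ∙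
          (sumN-single (suc t) i (ℕ.s≤s i≤t) _ (λ j j≤t j≢i → coeff-miss (c j)
              (λ eq → j≢i (sym (g-injective (ℕₚ.≤-<-trans i≤t t<m) (ℕₚ.≤-trans j≤t t<m) eq))))) ∙
            coeff-hit {g ℕ.* i} (c i) refl

        code-vanishes : ∀ i → t < i → i < m → coeff (g ℕ.* i) φ ≡ 0#
        code-vanishes i t<i i<m = coeff-terms (g ℕ.* i) ∙ sumN-0 (suc t) (λ j j≤t → coeff-miss (c j)
          (λ eq → ℕₚ.<⇒≱ t<i (subst (_≤ t) (sym (g-injective i<m (ℕₚ.≤-trans j≤t t<m) eq)) (ℕ.s≤s⁻¹ j≤t))))

        code-twist : coeff (g ℕ.* t) φ ≡ twist (coeff 0 φ)
        code-twist = code-coeff t ℕₚ.≤-refl ∙ proj₁ (proj₂ code) ∙ cong twist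
          (sym (coeff-≋ {0} {g ℕ.* 0} φ (cong (_% m) (sym (ℕₚ.*-zeroʳ g))) ∙ code-coeff 0 ℕ.z≤n))

      monomial : ∀ b i → 1 ≤ i → i < t → InCode (λ x → b * Fr (g ℕ.* i) x)
      monomial b i 1≤i i<t = c , c-off t (ℕₚ.<⇒≢ i<t ∘ sym) ∙
          sym (cong twist (c-off 0 (ℕₚ.<⇒≢ 1≤i)) ∙ cong (η *_) (Fr-0 τ) ∙ zeroʳ η) ,
        λ {x} _ → sym ((sumN-single (suc t) i (ℕₚ.m<n⇒m<1+n i<t) _
            (λ j _ j≢i → cong (_* Fr (g ℕ.* j) x) (c-off j j≢i) ∙ zeroˡ _)) ∙
          cong (_* Fr (g ℕ.* i) x) c-on)
        where
        c : ℕ → K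
        c j with j ℕ.≟ i
        ... | yes _ = b
        ... | no _ = 0#
        c-on : c i ≡ b
        c-on with i ℕ.≟ i
        ... | yes _ = refl
        ... | no i≢i = ⊥-elim (i≢i refl)
        c-off : ∀ j → j ≢ i → c j ≡ 0#
        c-off j j≢i with j ℕ.≟ i
        ... | yes j≡i = ⊥-elim (j≢i j≡i)
        ... | no _ = refl

      twisted : ∀ b → InCode (λ x → b * x + twist b * Fr (g ℕ.* t) x)
      twisted b = c , c-t ∙ cong twist (sym c-0) ,
        λ {x} _ → sym (cong₂ _+_ ((sumN-single t 0 1≤t _ (λ j j<t j≢0 →
              cong (_* Fr (g ℕ.* j) x) (c-off j j≢0 (ℕₚ.<⇒≢ j<t)) ∙ zeroˡ _)) ∙
            cong₂ _*_ c-0 (cong (λ d → Fr d x) (ℕₚ.*-zeroʳ g) ∙ Fr-zero x))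
          (cong (_* Fr (g ℕ.* t) x) c-t))
        where
        c : ℕ → K
        c j with j ℕ.≟ 0 | j ℕ.≟ t
        ... | yes _ | _ = b
        ... | no _ | yes _ = twist b
        ... | no _ | no _ = 0#
        c-0 : c 0 ≡ b
        c-0 = refl
        c-t : c t ≡ twist b
        c-t with t ℕ.≟ 0 | t ℕ.≟ t
        ... | yes t≡0 | _ = ⊥-elim (ℕₚ.<⇒≢ 1≤t (sym t≡0))
        ... | no _ | yes _ = refl
        ... | no _ | no t≢t = ⊥-elim (t≢t refl)
        c-off : ∀ j → j ≢ 0 → j ≢ t → c j ≡ 0#
        c-off j j≢0 j≢t with j ℕ.≟ 0 | j ℕ.≟ t
        ... | yes j≡0 | _ = ⊥-elim (j≢0 j≡0)
        ... | no _ | yes j≡t = ⊥-elim (j≢t j≡t)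
        ... | no _ | no _ = refl

      -- Left multiplications preserving the code.

      module Idealiser {Z : K → K} (Z-linear : Linear Z)
                       (preserves : ∀ {φ} → InCode φ → InCode (Z ∘ φ)) where
        private
          module _ (i : ℕ) (1≤i : 1 ≤ i) (i<t : i < t) (b : K) where
            image : InCode (λ x → Z (b * Fr (g ℕ.* i) x))
            image = preserves (monomial b i 1≤i i<t)

            image-coeff : ∀ ρ → component Z (g ℕ.* ρ) b ≡ coeff (g ℕ.* (ρ ℕ.+ i)) (λ x → Z (b * Fr (g ℕ.* i) x))
            image-coeff ρ = sym ((coeff-≋ _ (cong (_% m) (ℕₚ.*-distribˡ-+ g ρ i))) ∙
              component-monomial Z-linear (g ℕ.* ρ) (g ℕ.* i) b)

            at-0 : component Z (g ℕ.* (m ∸ i)) b ≡ coeff 0 (λ x → Z (b * Fr (g ℕ.* i) x))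
            at-0 = image-coeff (m ∸ i) ∙ (coeff-≋ _
              (cong (λ r → (g ℕ.* r) % m) (ℕₚ.m∸n+n≡m (ℕₚ.<⇒≤ (ℕₚ.<-trans i<t t<m))) ∙ ≋-multiple 0 g))

            at-t : component Z (g ℕ.* (t ∸ i)) b ≡ coeff (g ℕ.* t) (λ x → Z (b * Fr (g ℕ.* i) x))
            at-t = image-coeff (t ∸ i) ∙ (coeff-≋ _
              (cong (λ r → (g ℕ.* r) % m) (ℕₚ.m∸n+n≡m (ℕₚ.<⇒≤ i<t))))

            -- The component of index `g * ρ` carries σ^i to σ^(ρ + i). Index `m - i` lands on σ^0
            -- and index `t - i` on σ^t, exactly where the code ties two coefficients together.
            coupled : component Z (g ℕ.* (t ∸ i)) b ≡ twist (component Z (g ℕ.* (m ∸ i)) b)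
            coupled = at-t ∙ code-twist image ∙ cong twist (sym at-0)

          -- The two coupled components are semilinear over F_{q^m} for different automorphisms.
          component-t : ∀ i → 1 ≤ i → i < t → ∀ b → component Z (g ℕ.* (t ∸ i)) b ≡ 0#
          component-t i 1≤i i<t b = distinct-exponents P (- P) different (λ {y} y∈ → begin
            Fr r y * P + Fr (τ ℕ.+ s) y * - P
              ≡⟨ cong₂ _+_ (sym (component-semilinear Z-linear r b y∈))
                   (sym (-‿distribʳ-* _ _) ∙ cong (λ z → - (Fr (τ ℕ.+ s) y * z)) (coupled i 1≤i i<t b)) ⟩
            component Z r (y * b) − Fr (τ ℕ.+ s) y * twist Q
              ≡⟨ cong₂ _−_ (coupled i 1≤i i<t (y * b)) (cong (_* twist Q) (Fr-∘ τ s y)) ⟩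
            twist (component Z s (y * b)) − Fr τ (Fr s y) * twist Q
              ≡⟨ cong (twist (component Z s (y * b)) −_) (sym (twist-* (Fr s y) Q)) ⟩
            twist (component Z s (y * b)) − twist (Fr s y * Q)
              ≡⟨ cong (λ z → twist z − twist (Fr s y * Q)) (component-semilinear Z-linear s b y∈) ⟩
            twist (Fr s y * Q) − twist (Fr s y * Q)
              ≡⟨ -‿inverseʳ _ ⟩
            0# ∎)
            where
            r = g ℕ.* (t ∸ i)
            s = g ℕ.* (m ∸ i)
            P = component Z r b
            Q = component Z s b
            different : ¬ (r ≋ τ ℕ.+ s)
            different eq = τ≢gt (sym (cong (_% m) (sym (r+gi t (ℕₚ.<⇒≤ i<t))) ∙
              ≋-+ {r} {τ ℕ.+ s} {g ℕ.* i} {g ℕ.* i} eq refl ∙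
                cong (_% m) (ℕₚ.+-assoc τ s (g ℕ.* i) ∙
                  cong (τ ℕ.+_) (r+gi m (ℕₚ.<⇒≤ (ℕₚ.<-trans i<t t<m)))) ∙ ≋-multiple τ g))
              where
              r+gi : ∀ a → i ≤ a → g ℕ.* (a ∸ i) ℕ.+ g ℕ.* i ≡ g ℕ.* a
              r+gi a i≤a = sym (ℕₚ.*-distribˡ-+ g (a ∸ i) i) ∙ cong (g ℕ.*_) (ℕₚ.m∸n+n≡m i≤a)

          component-0 : ∀ i → 1 ≤ i → i < t → ∀ b → component Z (g ℕ.* (m ∸ i)) b ≡ 0#
          component-0 i 1≤i i<t b = twist-0⇒0 (sym (coupled i 1≤i i<t b) ∙ component-t i 1≤i i<t b)

          -- Three ranges of ρ, with the free exponent i = t - 1 as the main probe. If t < ρ + i <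
          -- m, the product exponent is absent from the code. For ρ = 1 it is t itself. If ρ + i
          -- reaches m, then m - ρ is also a free exponent, and as a probe it lands on 0. The last
          -- two ranges fall under the coupling.
          large : 2 ≤ t → ∀ ρ → 1 ≤ ρ → ρ < m → ∀ b → component Z (g ℕ.* ρ) b ≡ 0#
          large 2≤t ρ 1≤ρ ρ<m b with (ρ ℕ.+ ℕ.pred t) ℕ.<? m | ρ ℕ.≟ 1
          ... | _ | yes refl = cong (λ i → component Z (g ℕ.* i) b) (sym t∸i≡1) ∙
                                 component-t (ℕ.pred t) 1≤i i<t b
            where
            1≤i : 1 ≤ ℕ.pred t
            1≤i = ℕₚ.pred-mono-≤ 2≤t
            suc-pred-t : suc (ℕ.pred t) ≡ t
            suc-pred-t = ℕₚ.suc-pred t {{ℕ.>-nonZero 1≤t}}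
            i<t : ℕ.pred t < t
            i<t = ℕₚ.≤-reflexive suc-pred-t
            t∸i≡1 : t ∸ ℕ.pred t ≡ 1
            t∸i≡1 = cong (_∸ ℕ.pred t) (sym suc-pred-t) ∙ ℕₚ.m+n∸n≡m 1 (ℕ.pred t)
          ... | yes p<m | no ρ≢1 = image-coeff (ℕ.pred t) 1≤i i<t b ρ ∙
                                     (code-vanishes (image (ℕ.pred t) 1≤i i<t b) _ t<p p<m)
            where
            1≤i : 1 ≤ ℕ.pred t
            1≤i = ℕₚ.pred-mono-≤ 2≤t
            suc-pred-t : suc (ℕ.pred t) ≡ t
            suc-pred-t = ℕₚ.suc-pred t {{ℕ.>-nonZero 1≤t}}
            i<t : ℕ.pred t < t
            i<t = ℕₚ.≤-reflexive suc-pred-t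
            t<p : t < ρ ℕ.+ ℕ.pred t
            t<p = subst (λ z → suc z ≤ ρ ℕ.+ ℕ.pred t) suc-pred-t (ℕₚ.+-monoˡ-≤ (ℕ.pred t) (ℕₚ.≤∧≢⇒< 1≤ρ (ρ≢1 ∘ sym)))
          ... | no p≮m | no _ = cong (λ i → component Z (g ℕ.* i) b) (sym (ℕₚ.m∸[m∸n]≡n (ℕₚ.<⇒≤ ρ<m))) ∙
                                  component-0 (m ∸ ρ) (ℕₚ.m<n⇒0<n∸m ρ<m) i<t b
            where
            suc-pred-t : suc (ℕ.pred t) ≡ t
            suc-pred-t = ℕₚ.suc-pred t {{ℕ.>-nonZero 1≤t}}
            i<t : m ∸ ρ < t
            i<t = subst (m ∸ ρ <_) suc-pred-t (ℕ.s≤s (ℕₚ.≤-trans (ℕₚ.∸-monoˡ-≤ ρ (ℕₚ.≮⇒≥ p≮m))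
                    (ℕₚ.≤-reflexive (ℕₚ.m+n∸m≡n ρ (ℕ.pred t)))))

          module _ (t≡1 : t ≡ 1) where
            g·1 : g ℕ.* t ≡ g
            g·1 = cong (g ℕ.*_) t≡1 ∙ ℕₚ.*-identityʳ g

            -- For t = 1 there are no free monomials, and only the words `b x + twist b σ(x)` are
            -- available. Their images have no term at σ^(ρ + 1), where two components of `Z` meet;
            -- `upper` separates these because they are semilinear for different powers of
            -- Frobenius.
            image-coeffs : ∀ ρ → 1 ≤ ρ → suc ρ < m → ∀ b →
                                 component Z (g ℕ.* suc ρ) b + component Z (g ℕ.* ρ) (twist b) ≡ 0#
            image-coeffs ρ 1≤ρ ρ+1<m b = begin
              component Z (g ℕ.* suc ρ) b + component Z (g ℕ.* ρ) (twist b)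
                ≡⟨ cong₂ _+_
                     (sym (component-monomial Z-linear (g ℕ.* suc ρ) 0 b) ∙
                       (coeff-≋ _ (cong (_% m) (ℕₚ.+-identityʳ _))) ∙
                         coeff-cong (g ℕ.* suc ρ) (λ {x} _ → cong (λ z → Z (b * z)) (Fr-zero x)))
                     (sym (component-monomial Z-linear (g ℕ.* ρ) (g ℕ.* t) (twist b)) ∙
                       (coeff-≋ _ (cong (_% m) (cong (g ℕ.* ρ ℕ.+_) g·1 ∙
                         ℕₚ.+-comm (g ℕ.* ρ) g ∙ sym (ℕₚ.*-suc g ρ))))) ⟩
              coeff (g ℕ.* suc ρ) (λ x → Z (b * x)) +
              coeff (g ℕ.* suc ρ) (λ x → Z (twist b * Fr (g ℕ.* t) x))
                ≡⟨ coeff-+ (g ℕ.* suc ρ) (λ x → Z (b * x)) _ ⟨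
              coeff (g ℕ.* suc ρ) (λ x → Z (b * x) + Z (twist b * Fr (g ℕ.* t) x))
                ≡⟨ coeff-cong (g ℕ.* suc ρ) (λ _ → sym (add Z-linear _ _)) ⟩
              coeff (g ℕ.* suc ρ) (λ x → Z (b * x + twist b * Fr (g ℕ.* t) x))
                ≡⟨ code-vanishes (preserves (twisted b)) (suc ρ) (subst (_< suc ρ) (sym t≡1) (ℕ.s≤s 1≤ρ)) ρ+1<m ⟩
              0# ∎

            upper : ∀ ρ → 1 ≤ ρ → suc ρ < m → ∀ b → component Z (g ℕ.* suc ρ) b ≡ 0#
            upper ρ 1≤ρ ρ+1<m b = distinct-exponents _ (component Z (g ℕ.* ρ) (twist b)) different (λ {y} y∈ → begin
              Fr (g ℕ.* suc ρ) y * component Z (g ℕ.* suc ρ) b + Fr (g ℕ.* ρ ℕ.+ τ) y * component Z (g ℕ.* ρ) (twist b)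
                ≡⟨ cong₂ _+_ (sym (component-semilinear Z-linear (g ℕ.* suc ρ) b y∈))
                     (cong (_* component Z (g ℕ.* ρ) (twist b)) (Fr-∘ (g ℕ.* ρ) τ y) ∙
                       sym (component-semilinear Z-linear (g ℕ.* ρ) (twist b) (Fr-Fqm τ y∈)) ∙
                         cong (component Z (g ℕ.* ρ)) (sym (twist-* y b))) ⟩
              component Z (g ℕ.* suc ρ) (y * b) + component Z (g ℕ.* ρ) (twist (y * b))
                ≡⟨ image-coeffs ρ 1≤ρ ρ+1<m (y * b) ⟩
              0# ∎)
              where
              different : ¬ (g ℕ.* suc ρ ≋ g ℕ.* ρ ℕ.+ τ)
              different eq = τ≢gt (sym (cong (_% m) g·1 ∙ ≋-+-cancelˡ (g ℕ.* ρ) {g} {τ}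
                (cong (_% m) (ℕₚ.+-comm (g ℕ.* ρ) g ∙ sym (ℕₚ.*-suc g ρ)) ∙ eq)))

            -- Once `upper` removes the first summand, the second one vanishes at every value of
            -- `twist`, hence everywhere.
            lower : ∀ ρ → 1 ≤ ρ → suc ρ < m → ∀ b → component Z (g ℕ.* ρ) b ≡ 0#
            lower ρ 1≤ρ ρ+1<m b = cong (component Z (g ℕ.* ρ)) (sym (proj₂ root)) ∙
              sym (+-identityˡ _) ∙ cong (_+ component Z (g ℕ.* ρ) (twist a))
                (sym (upper ρ 1≤ρ ρ+1<m a)) ∙ image-coeffs ρ 1≤ρ ρ+1<m a
              where
              root = twist-surjective b
              a = proj₁ root

            small : ∀ ρ → 1 ≤ ρ → ρ < m → ∀ b → component Z (g ℕ.* ρ) b ≡ 0#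
            -- `upper` starts only at index 2. Index 1 comes from `lower`, for which `t + 2 ≤ m`
            -- leaves just enough room.
            small (suc zero) 1≤ρ ρ<m = lower 1 ℕₚ.≤-refl (subst (λ k → k ℕ.+ 2 ≤ m) t≡1 t+2≤m)
            small (suc (suc ρ)) 1≤ρ ρ<m = upper (suc ρ) (ℕ.s≤s ℕ.z≤n) ρ<m

        component-vanishes : ∀ r → ¬ (r ≋ 0) → ∀ b → component Z r b ≡ 0#
        component-vanishes r r≢0 b with g-surjective r
        ... | ρ , ρ<m , gρ≋r = (coeff-≋ {r} {g ℕ.* ρ} _ (sym gρ≋r)) ∙ vanishes
          where
          1≤ρ : 1 ≤ ρ
          1≤ρ = ℕₚ.n≢0⇒n>0 (λ { refl → r≢0 (sym (cong (_% m) (sym (ℕₚ.*-zeroʳ g)) ∙ gρ≋r)) })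
          vanishes : component Z (g ℕ.* ρ) b ≡ 0#
          vanishes with t ℕ.≟ 1
          ... | yes t≡1 = small t≡1 ρ 1≤ρ ρ<m b
          ... | no t≢1 = large (ℕₚ.≤∧≢⇒< 1≤t (t≢1 ∘ sym)) ρ 1≤ρ ρ<m b

        -- Only the component at exponent 0 survives, and it multiplies `Fr 0 y`, which is `y`; the
        -- choice `y = 1` identifies that component with `Z z`.
        idealiser-linear : ∀ {y} z → InFqm y → Z (y * z) ≡ y * Z z
        idealiser-linear {y} z y∈ = begin
          Z (y * z)                          ≡⟨ value y∈ ⟩
          component Z 0 z * Fr 0 y           ≡⟨ cong (component Z 0 z *_) (Fr-zero y) ⟩
          component Z 0 z * y                ≡⟨ *-comm _ _ ⟩
          y * component Z 0 z                ≡⟨ cong (y *_) (sym (*-identityʳ _) ∙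
            cong (component Z 0 z *_) (sym (Fr-1 0))) ⟩
          y * (component Z 0 z * Fr 0 1#)    ≡⟨ cong (y *_) (value Fqm.has-1) ⟨
          y * Z (1# * z)                     ≡⟨ cong (λ x → y * Z x) (*-identityˡ z) ⟩
          y * Z z                            ∎
          where
          value : ∀ {y} → InFqm y → Z (y * z) ≡ component Z 0 z * Fr 0 y
          value {y} y∈ = component-expand Z-linear z y∈ ∙ (sumN-single m 0 0<m _ (λ r r<m r≢0 →
            cong (_* Fr r y) (component-vanishes r (λ r≋0 → r≢0
              (sym (m<n⇒m%n≡m r<m) ∙ r≋0 ∙ m<n⇒m%n≡m 0<m)) z) ∙ zeroˡ _))

      -- A field of left multiplications acting on the code.

      module FieldAction
          (X : K → K → K) (X-linear : ∀ c → Linear (X c))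
          (X-+ : ∀ c d z → X (c + d) z ≡ X c z + X d z)
          (X-* : ∀ c d z → X (c * d) z ≡ X c (X d z))
          (X-1 : ∀ z → X 1# z ≡ z)
          (X-preserves : ∀ c {φ} → InCode φ → InCode (X c ∘ φ))
          (Y : K → K) (Y-linear : Linear Y) (Y-injective : ∀ {z} → Y z ≡ 0# → z ≡ 0#)
          (j : ℕ) (Y-X : ∀ c z → Y (X c z) ≡ X (Fr j c) (Y z))
          (j-cancel : ∀ {i k} → i ℕ.* j ≋ k ℕ.* j → i ≋ k)
          (j-surjective : ∀ r → Σ ℕ λ i → i < m × i ℕ.* j ≋ r)
          (t′ : ℕ) (1≤t′ : 1 ≤ t′) (t′≤m : t′ ≤ m)
          (γ : K → K) (γ-linear : Linear γ)
          (spanned : ∀ {φ} → InCode φ → Σ (ℕ → K) λ c →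
                       ∀ {x} → InFqm x → φ x ≡ sumN t′ (λ r → X (c r) (iterate Y r (γ x))))
          (contained : ∀ c r → r < t′ → InCode (λ x → X c (iterate Y r (γ x))))
          (untwisted : t ≡ 1 → ¬ (τ ≋ 0))
        where

        sumN-nonzero : ∀ d (f : ℕ → K) → sumN d f ≢ 0# → Σ ℕ λ r → r < d × f r ≢ 0#
        sumN-nonzero zero f 0≢0 = ⊥-elim (0≢0 refl)
        sumN-nonzero (suc d) f sum≢0 with f d ≟ 0#
        ... | no fd≢0 = d , ℕₚ.n<1+n d , fd≢0
        ... | yes fd≡0 with sumN-nonzero d f (λ s≡0 → sum≢0 (cong₂ _+_ s≡0 fd≡0 ∙ +-identityˡ 0#))
        ...   | r , r<d , fr≢0 = r , ℕₚ.m<n⇒m<1+n r<d , fr≢0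

        X-0 : ∀ z → X 0# z ≡ 0#
        X-0 z = additive-0 {λ c → X c z} (λ c d → X-+ c d z)

        X-kernel : ∀ {c z} → c ≢ 0# → X c z ≡ 0# → z ≡ 0#
        X-kernel {c} {z} c≢0 Xcz≡0 = begin
          z                         ≡⟨ X-1 z ⟨
          X 1# z                    ≡⟨ cong (λ a → X a z) (*-comm _ _ ∙ *-inv c≢0) ⟨
          X (inv c≢0 * c) z         ≡⟨ X-* _ _ z ⟩
          X (inv c≢0) (X c z)       ≡⟨ cong (X (inv c≢0)) Xcz≡0 ⟩
          X (inv c≢0) 0#            ≡⟨ map-0 (X-linear _) ⟩
          0#                        ∎

        X-Fqm : ∀ c {y} z → InFqm y → X c (y * z) ≡ y * X c z
        X-Fqm c = Idealiser.idealiser-linear (X-linear c) (X-preserves c)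

        abstract
          -- The orbit map of 1 is additive with trivial kernel, hence injective, hence onto by
          -- finiteness.
          X-transitive : ∀ z → Σ K λ c → X c 1# ≡ z
          X-transitive = injective⇒surjective (λ c → X c 1#) (λ c d eq → −≡0⇒≡ (trivial (c − d)
            (additive-− {λ c → X c 1#} (λ c d → X-+ c d 1#) c d ∙ ≡⇒−≡0 eq)))
            where
            trivial : ∀ c → X c 1# ≡ 0# → c ≡ 0#
            trivial c Xc1≡0 with c ≟ 0#
            ... | yes c≡0 = c≡0
            ... | no c≢0 = ⊥-elim (1≢0 (X-kernel c≢0 Xc1≡0))

        -- X is a field acting transitively on K ∖ 0, hence is its own centraliser;
        -- it commutes with F_{q^m}, hence contains it.
        scalar : ∀ {y} → InFqm y → Σ K λ d → ∀ z → X d z ≡ y * z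
        scalar {y} y∈ = d , λ z → let c = proj₁ (X-transitive z) ; Xc1≡z = proj₂ (X-transitive z) in begin
          X d z            ≡⟨ cong (X d) Xc1≡z ⟨
          X d (X c 1#)     ≡⟨ X-* d c 1# ⟨
          X (d * c) 1#     ≡⟨ cong (λ a → X a 1#) (*-comm d c) ⟩
          X (c * d) 1#     ≡⟨ X-* c d 1# ⟩
          X c (X d 1#)     ≡⟨ cong (X c) (proj₂ (X-transitive y) ∙ sym (*-identityʳ y)) ⟩
          X c (y * 1#)     ≡⟨ X-Fqm c 1# y∈ ⟩
          y * X c 1#       ≡⟨ cong (y *_) Xc1≡z ⟩
          y * z            ∎
          where
          d = proj₁ (X-transitive y)

        -- `Fr j` is a power map. So if `d` acts as the scalar `y`, then `Fr j d` acts as `Fr j y`,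
        -- and the commutation of `Y` with `X` becomes semilinearity over F_{q^m}.
        X-pow : ∀ {d y} → (∀ z → X d z ≡ y * z) → ∀ N z → X (pow d N) z ≡ pow y N * z
        X-pow Xd zero z = X-1 z ∙ sym (*-identityˡ z)
        X-pow {d} {y} Xd (suc N) z = begin
          X (d * pow d N) z     ≡⟨ X-* d (pow d N) z ⟩
          X d (X (pow d N) z)   ≡⟨ Xd _ ⟩
          y * X (pow d N) z     ≡⟨ cong (y *_) (X-pow Xd N z) ⟩
          y * (pow y N * z)     ≡⟨ *-assoc _ _ _ ⟨
          y * pow y N * z       ∎

        Y-semilinear : ∀ {y} z → InFqm y → Y (y * z) ≡ Fr j y * Y z
        Y-semilinear {y} z y∈ = cong Y (sym (proj₂ (scalar y∈) z)) ∙
          Y-X (proj₁ (scalar y∈)) z ∙ X-pow (proj₂ (scalar y∈)) (q ^ j) (Y z)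

        Y^_ : ℕ → K → K
        Y^ r = iterate Y r

        Y^-linear : ∀ r → Linear (Y^ r)
        Y^-linear = iterate-linear Y-linear

        Y^-kernel : ∀ r {z} → (Y^ r) z ≡ 0# → z ≡ 0#
        Y^-kernel zero z≡0 = z≡0
        Y^-kernel (suc r) eq = Y^-kernel r (Y-injective eq)

        Y^-semilinear : ∀ r {y} z → InFqm y → (Y^ r) (y * z) ≡ Fr (r ℕ.* j) y * (Y^ r) z
        Y^-semilinear zero {y} z _ = cong (_* z) (sym (Fr-zero y))
        Y^-semilinear (suc r) {y} z y∈ = cong Y (Y^-semilinear r z y∈) ∙
          (Y-semilinear _ (Fr-Fqm (r ℕ.* j) y∈)) ∙ cong (_* (Y^ suc r) z) (sym (Fr-∘ j (r ℕ.* j) y))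

        XY-semilinear : ∀ c r {y} z → InFqm y → X c ((Y^ r) (y * z)) ≡ Fr (r ℕ.* j) y * X c ((Y^ r) z)
        XY-semilinear c r z y∈ = cong (X c) (Y^-semilinear r z y∈) ∙ (X-Fqm c _ (Fr-Fqm (r ℕ.* j) y∈))

        -- The code is closed under F_{q^m}, so twist commutes with F_{q^m}.
        τ≋0 : ¬ ¬ (τ ≋ 0)
        τ≋0 τ≢0 = P≢0 (distinct-exponents {τ} {0} P (- P) τ≢0 (λ {y} y∈ → begin
          Fr τ y * P + Fr 0 y * - P    ≡⟨ cong₂ _+_ (cong (Fr τ y *_) P≡ ∙ sym (twist-* y _) ∙ sym (closed y∈))
                                            (cong (_* - P) (Fr-zero y) ∙ sym (-‿distribʳ-* y P)) ⟩
          y * P − y * P                ≡⟨ -‿inverseʳ _ ⟩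
          0#                           ∎))
          where
          φ : K → K
          φ x = 1# * x + twist 1# * Fr (g ℕ.* t) x
          φ∈ : InCode φ
          φ∈ = twisted 1#
          P = coeff (g ℕ.* t) φ
          P≡ : P ≡ twist (coeff 0 φ)
          P≡ = code-twist φ∈
          start : coeff 0 φ ≡ 1#
          start = coeff-≋ φ (cong (_% m) (sym (ℕₚ.*-zeroʳ g))) ∙ code-coeff φ∈ 0 ℕ.z≤n
          P≢0 : P ≢ 0#
          P≢0 P≡0 = twist-nonzero 1≢0 (cong twist (sym start) ∙ sym P≡ ∙ P≡0)
          closed : ∀ {y} → InFqm y → y * P ≡ twist (y * coeff 0 φ)
          closed {y} y∈ = sym (scaled (g ℕ.* t)) ∙
            code-twist (X-preserves (proj₁ (scalar y∈)) φ∈) ∙ cong twist (scaled 0)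
            where
            scaled : ∀ r → coeff r (X (proj₁ (scalar y∈)) ∘ φ) ≡ y * coeff r φ
            scaled r = coeff-cong r (λ {x} _ → proj₂ (scalar y∈) (φ x)) ∙ coeff-*ˡ r y φ

        -- Supports of skew polynomials, for t at least 2.

        module Supports (2≤t : 2 ≤ t) where
          -- The exponent g (m - 1) does not occur in the code; exponents are counted
          -- from it in steps of j, the exponent of Y.
          position : ℕ → ℕ
          position ν = g ℕ.* (m ∸ 1) ℕ.+ ν ℕ.* j

          position-≋ : ∀ {ν ν′} → ν ≋ ν′ → position ν ≋ position ν′
          position-≋ {ν} {ν′} ν≋ν′ = ≋-+ˡ (g ℕ.* (m ∸ 1)) (%-distribˡ-* ν j m ∙
            cong (λ a → (a ℕ.* (j % m)) % m) ν≋ν′ ∙ sym (%-distribˡ-* ν′ j m))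

          position-cancel : ∀ {ν ν′} → position ν ≋ position ν′ → ν ≋ ν′
          position-cancel {ν} {ν′} eq = j-cancel (≋-+-cancelˡ (g ℕ.* (m ∸ 1)) {ν ℕ.* j} {ν′ ℕ.* j} eq)

          position-surjective : ∀ r → Σ ℕ λ ν → ν < m × position ν ≋ r
          position-surjective r = ν , proj₁ (proj₂ found) ,
            ≋-+ˡ (g ℕ.* (m ∸ 1)) {ν ℕ.* j} {r ℕ.+ g} (proj₂ (proj₂ found)) ∙
              cong (_% m) rearranged ∙ ≋-multiple r g
            where
            found = j-surjective (r ℕ.+ g)
            ν = proj₁ found
            rearranged : g ℕ.* (m ∸ 1) ℕ.+ (r ℕ.+ g) ≡ r ℕ.+ g ℕ.* m
            rearranged = Rearrangements.wrap g (m ∸ 1) r ∙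
              cong (λ a → r ℕ.+ g ℕ.* a) (ℕₚ.m∸n+n≡m 0<m)

          γ̂ : ℕ → K
          γ̂ ν = coeff (position ν) γ

          γ̂-≋ : ∀ {ν ν′} → ν ≋ ν′ → γ̂ ν ≡ γ̂ ν′
          γ̂-≋ {ν} {ν′} eq = coeff-≋ γ (position-≋ {ν} {ν′} eq)

          -- `X c` is linear and `Y^ r` is `Fr (r * j)`-semilinear over F_{q^m}, so together they
          -- advance the position by exactly `r`.
          term-coeff : ∀ c r ν → coeff (position (r ℕ.+ ν)) (λ x → X c ((Y^ r) (γ x))) ≡ X c ((Y^ r) (γ̂ ν))
          term-coeff c r ν = (coeff-≋ _ (cong (_% m) (Rearrangements.shift (g ℕ.* (m ∸ 1)) r ν j))) ∙
            semilinear-coeff {a = r ℕ.* j} (∘-linear (X-linear c) (Y^-linear r)) (λ z → XY-semilinear c r z)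
              γ-linear (position ν)

          -- The word `Y^ r ∘ γ` lies in the code and thus has no term at position 0, the exponent
          -- `g * (m - 1)` with `t < m - 1`. Going back `r` steps and cancelling the injective
          -- `Y^ r` gives a zero of `γ̂`.
          missing : ∀ r → r < t′ → γ̂ (m ∸ r) ≡ 0#
          missing r r<t′ = Y^-kernel r (sym (X-1 _) ∙ sym (term-coeff 1# r (m ∸ r)) ∙
            (coeff-≋ _ position≋) ∙ code-vanishes (contained 1# r r<t′) (m ∸ 1) t<m-1 m-1<m)
            where
            position≋ : position (r ℕ.+ (m ∸ r)) ≋ g ℕ.* (m ∸ 1)
            position≋ = cong (λ ν → position ν % m) (ℕₚ.m+[n∸m]≡n (ℕₚ.≤-trans (ℕₚ.<⇒≤ r<t′) t′≤m)) ∙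
              cong (λ a → (g ℕ.* (m ∸ 1) ℕ.+ a) % m) (ℕₚ.*-comm m j) ∙ ≋-multiple _ j
            t<m-1 : t < m ∸ 1
            t<m-1 = ℕₚ.m+n≤o⇒m≤o∸n (suc t) (subst (_≤ m) (ℕₚ.+-suc t 1) t+2≤m)
            m-1<m : m ∸ 1 < m
            m-1<m = ℕₚ.∸-monoʳ-< ℕ.z<s 0<m

          -- The gaps from `missing` fill position 0 and the top `t′ - 1` positions. Hence
          -- `r + ν < m` whenever `r < t′`: products never wrap around, and positions are ordered as
          -- natural numbers.
          support : ∀ {ν} → ν < m → γ̂ ν ≢ 0# → 1 ≤ ν × ν ℕ.+ t′ ≤ m
          support {ν} ν<m γ̂ν≢0 = ℕₚ.n≢0⇒n>0 ν≢0 , ℕₚ.≮⇒≥ (λ m<ν+t′ → γ̂ν≢0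
            (cong γ̂ (sym (ℕₚ.m∸[m∸n]≡n (ℕₚ.<⇒≤ ν<m))) ∙ missing (m ∸ ν)
              (ℕₚ.m<n+o⇒m∸n<o m ν {{ℕ.>-nonZero 1≤t′}} m<ν+t′)))
            where
            ν≢0 : ν ≢ 0
            ν≢0 refl = γ̂ν≢0 (γ̂-≋ {0} {m}
              (sym (cong (_% m) (sym (ℕₚ.*-identityˡ m)) ∙ ≋-multiple 0 1)) ∙ missing 0 1≤t′)

          -- The value of `γ̂` at ν - r modulo `m`, written so that no truncated subtraction occurs
          -- when ν < r.
          shifted : ℕ → ℕ → K
          shifted ν r = γ̂ (ν ℕ.+ (m ∸ r))

          shifted-≥ : ∀ {ν r} → r ≤ ν → r < t′ → shifted ν r ≡ γ̂ (ν ∸ r)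
          shifted-≥ {ν} {r} r≤ν r<t′ = γ̂-≋ {ν ℕ.+ (m ∸ r)} {ν ∸ r ℕ.+ 1 ℕ.* m} (cong (_% m) (begin
              ν ℕ.+ (m ∸ r)                       ≡⟨ cong (ℕ._+ (m ∸ r)) (ℕₚ.m∸n+n≡m r≤ν) ⟨
              ν ∸ r ℕ.+ r ℕ.+ (m ∸ r)           ≡⟨ ℕₚ.+-assoc (ν ∸ r) r _ ⟩
              ν ∸ r ℕ.+ (r ℕ.+ (m ∸ r))         ≡⟨ cong (ν ∸ r ℕ.+_) (ℕₚ.m+[n∸m]≡n (ℕₚ.≤-trans (ℕₚ.<⇒≤ r<t′) t′≤m)) ⟩
              ν ∸ r ℕ.+ m                         ≡⟨ cong (ν ∸ r ℕ.+_) (ℕₚ.+-identityʳ m) ⟨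
              ν ∸ r ℕ.+ 1 ℕ.* m                   ∎)) ∙
            γ̂-≋ {ν ∸ r ℕ.+ 1 ℕ.* m} {ν ∸ r} (≋-multiple (ν ∸ r) 1)

          -- A wrapped index lies strictly between `m - t′` and `m`, outside the range allowed by
          -- `support`.
          shifted-< : ∀ {ν r} → ν < r → r < t′ → shifted ν r ≡ 0#
          shifted-< {ν} {r} ν<r r<t′ with shifted ν r ≟ 0#
          ... | yes eq = eq
          ... | no ≢0 = ⊥-elim (ℕₚ.<⇒≱ overflow (proj₂ (support inside ≢0)))
            where
            r≤m = ℕₚ.≤-trans (ℕₚ.<⇒≤ r<t′) t′≤m
            inside : ν ℕ.+ (m ∸ r) < m
            inside = subst (ν ℕ.+ (m ∸ r) <_) (ℕₚ.m+[n∸m]≡n r≤m) (ℕₚ.+-monoˡ-< (m ∸ r) ν<r)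
            overflow : m < ν ℕ.+ (m ∸ r) ℕ.+ t′
            overflow = ℕₚ.<-≤-trans (subst (_< m ∸ r ℕ.+ t′) (ℕₚ.m∸n+n≡m r≤m) (ℕₚ.+-monoʳ-< (m ∸ r) r<t′))
              (ℕₚ.+-monoˡ-≤ t′ (ℕₚ.m≤n+m (m ∸ r) ν))

          module _ {φ : K → K} (c : ℕ → K)
                   (expansion : ∀ {x} → InFqm x → φ x ≡ sumN t′ (λ r → X (c r) ((Y^ r) (γ x)))) where
            -- The product rule for skew polynomials in `Y`: the term of index `r` reaches ν only
            -- from position ν - r of `γ`.
            convolution : ∀ ν → coeff (position ν) φ ≡ sumN t′ (λ r → X (c r) ((Y^ r) (shifted ν r)))
            convolution ν = coeff-cong (position ν) expansion ∙
              coeff-sumN (position ν) t′ (λ r x → X (c r) ((Y^ r) (γ x))) ∙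
                sumN-cong t′ (λ r r<t′ → (coeff-≋ _ (position-≋ {ν} {r ℕ.+ (ν ℕ.+ (m ∸ r))} (same r r<t′))) ∙
                  term-coeff (c r) r (ν ℕ.+ (m ∸ r)))
              where
              same : ∀ r → r < t′ → ν ≋ r ℕ.+ (ν ℕ.+ (m ∸ r))
              same r r<t′ = sym (≋-multiple ν 1) ∙ cong (_% m) (cong (ν ℕ.+_) (ℕₚ.+-identityʳ m ∙
                sym (ℕₚ.m+[n∸m]≡n (ℕₚ.≤-trans (ℕₚ.<⇒≤ r<t′) t′≤m))) ∙
                Rearrangements.exchange ν r (m ∸ r))

            contributes : ∀ ν → coeff (position ν) φ ≢ 0# →
                          Σ ℕ λ r → r < t′ × r ≤ ν × c r ≢ 0# × γ̂ (ν ∸ r) ≢ 0#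
            contributes ν ≢0 = r , r<t′ , r≤ν ,
                (λ cr≡0 → term≢0 (cong (λ a → X a ((Y^ r) (shifted ν r))) cr≡0 ∙ X-0 _)) ,
                (λ γ̂≡0 → term≢0 (vanishing-term (shifted-≥ r≤ν r<t′ ∙ γ̂≡0)))
              where
              terms : ℕ → K
              terms r = X (c r) ((Y^ r) (shifted ν r))
              found : Σ ℕ λ r → r < t′ × terms r ≢ 0#
              found = sumN-nonzero t′ terms (λ s≡0 → ≢0 (convolution ν ∙ s≡0))
              r : ℕ
              r = proj₁ found
              r<t′ : r < t′
              r<t′ = proj₁ (proj₂ found)
              term≢0 : terms r ≢ 0#
              term≢0 = proj₂ (proj₂ found)
              vanishing-term : shifted ν r ≡ 0# → terms r ≡ 0#
              vanishing-term eq = cong (λ a → X (c r) ((Y^ r) a)) eq ∙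
                map-0 (∘-linear (X-linear (c r)) (Y^-linear r))
              r≤ν : r ≤ ν
              r≤ν = ℕₚ.≮⇒≥ (λ ν<r → term≢0 (vanishing-term (shifted-< ν<r r<t′)))

            -- Extreme terms of c and γ̂ cannot cancel.
            extreme : ∀ a ν → a < t′ → ν < m → c a ≢ 0# → γ̂ ν ≢ 0# →
                      (∀ r → r < t′ → r ≤ a ℕ.+ ν → r ≢ a → c r ≢ 0# → γ̂ (a ℕ.+ ν ∸ r) ≡ 0#) →
                      coeff (position (a ℕ.+ ν)) φ ≢ 0#
            extreme a ν a<t′ ν<m ca≢0 γ̂ν≢0 others-vanish eq = γ̂ν≢0 (Y^-kernel a (X-kernel ca≢0
              (cong (λ z → X (c a) ((Y^ a) z)) (sym (shifted-≥ (ℕₚ.m≤m+n a ν) a<t′ ∙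
                  cong γ̂ (ℕₚ.m+n∸m≡n a ν))) ∙
                sym (sumN-single t′ a a<t′ _ zeros) ∙ sym (convolution (a ℕ.+ ν)) ∙ eq)))
              where
              zeros : ∀ r → r < t′ → r ≢ a → X (c r) ((Y^ r) (shifted (a ℕ.+ ν) r)) ≡ 0#
              zeros r r<t′ r≢a with c r ≟ 0# | r ℕ.≤? a ℕ.+ ν
              ... | yes cr≡0 | _ = cong (λ b → X b _) cr≡0 ∙ X-0 _
              ... | no cr≢0 | yes r≤ = cong (λ z → X (c r) ((Y^ r) z))
                      (shifted-≥ r≤ r<t′ ∙ others-vanish r r<t′ r≤ r≢a cr≢0) ∙
                    map-0 (∘-linear (X-linear (c r)) (Y^-linear r))
              ... | no _ | no r≰ = cong (λ z → X (c r) ((Y^ r) z)) (shifted-< (ℕₚ.≰⇒> r≰) r<t′) ∙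
                    map-0 (∘-linear (X-linear (c r)) (Y^-linear r))

          -- The code contains the monomial Fr g, whose expansion has a single position.
          single-support : Σ ℕ λ ν₀ → ν₀ < m × (∀ {ν} → ν < m → γ̂ ν ≢ 0# → ν ≡ ν₀)
          single-support = lo , lo<m , λ {ν} ν<m γ̂ν≢0 → ℕₚ.≤-antisym
              (ℕₚ.≮⇒≥ (λ lo<ν → γ̂ν≢0 (above ν (subst (_< ν) lo≡hi lo<ν) ν<m)))
              (ℕₚ.≮⇒≥ (λ ν<lo → γ̂ν≢0 (below ν ν<lo)))
            where
            module S = Search (_≡ 0#) (_≟ 0#)
            φ : K → K
            φ x = 1# * Fr (g ℕ.* 1) x
            φ∈ : InCode φ
            φ∈ = monomial 1# 1 ℕₚ.≤-refl 2≤t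
            c : ℕ → K
            c = proj₁ (spanned φ∈)
            expansion : ∀ {x} → InFqm x → φ x ≡ sumN t′ (λ r → X (c r) ((Y^ r) (γ x)))
            expansion = proj₂ (spanned φ∈)
            p₁ : Σ ℕ λ ν → ν < m × position ν ≋ g ℕ.* 1
            p₁ = position-surjective (g ℕ.* 1)
            term : Σ ℕ λ r → r < t′ × r ≤ proj₁ p₁ × c r ≢ 0# × γ̂ (proj₁ p₁ ∸ r) ≢ 0#
            term = contributes c expansion (proj₁ p₁) (λ eq → 1≢0 (sym (coeff-hit 1# (proj₂ (proj₂ p₁))) ∙ eq))
            c-nonzero : Σ ℕ λ r → r < t′ × c r ≢ 0#
            c-nonzero = proj₁ term , proj₁ (proj₂ term) , proj₁ (proj₂ (proj₂ (proj₂ term)))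
            γ̂-nonzero : Σ ℕ λ ν → ν < m × γ̂ ν ≢ 0#
            γ̂-nonzero = proj₁ p₁ ∸ proj₁ term , ℕₚ.≤-<-trans (ℕₚ.m∸n≤m _ (proj₁ term)) (proj₁ (proj₂ p₁)) ,
                        proj₂ (proj₂ (proj₂ (proj₂ term)))
            first-c = S.first t′ c c-nonzero
            last-c = S.last t′ c c-nonzero
            first-γ̂ = S.first m γ̂ γ̂-nonzero
            last-γ̂ = S.last m γ̂ γ̂-nonzero
            a = proj₁ first-c
            b = proj₁ last-c
            lo = proj₁ first-γ̂
            hi = proj₁ last-γ̂
            a<t′ = proj₁ (proj₂ first-c)
            b<t′ = proj₁ (proj₂ last-c)
            lo<m = proj₁ (proj₂ first-γ̂)
            hi<m = proj₁ (proj₂ last-γ̂)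
            lo≢0 = proj₁ (proj₂ (proj₂ first-γ̂))
            hi≢0 = proj₁ (proj₂ (proj₂ last-γ̂))
            below : ∀ ν → ν < lo → γ̂ ν ≡ 0#
            below = proj₂ (proj₂ (proj₂ first-γ̂))
            above : ∀ ν → hi < ν → ν < m → γ̂ ν ≡ 0#
            above = proj₂ (proj₂ (proj₂ last-γ̂))
            within : ∀ {r ν} → r < t′ → ν < m → γ̂ ν ≢ 0# → r ℕ.+ ν < m
            within {r} {ν} r<t′ ν<m γ̂ν≢0 = ℕₚ.<-≤-trans (ℕₚ.+-monoˡ-< ν r<t′)
              (subst (_≤ m) (ℕₚ.+-comm ν t′) (proj₂ (support ν<m γ̂ν≢0)))
            at-a : coeff (position (a ℕ.+ lo)) φ ≢ 0#
            at-a = extreme c expansion a lo a<t′ lo<m (proj₁ (proj₂ (proj₂ first-c))) lo≢0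
              (λ r r<t′ r≤ r≢a cr≢0 → below _ (ℕₚ.m<n+o⇒m∸n<o (a ℕ.+ lo) r {{ℕ.>-nonZero (proj₁ (support lo<m lo≢0))}}
                (ℕₚ.+-monoˡ-< lo (ℕₚ.≤∧≢⇒< (ℕₚ.≮⇒≥ (λ r<a → cr≢0 (proj₂ (proj₂ (proj₂ first-c)) r r<a))) (r≢a ∘ sym)))))
            at-b : coeff (position (b ℕ.+ hi)) φ ≢ 0#
            at-b = extreme c expansion b hi b<t′ hi<m (proj₁ (proj₂ (proj₂ last-c))) hi≢0
              (λ r r<t′ r≤ r≢b cr≢0 → above _
                (ℕₚ.m+n≤o⇒m≤o∸n (suc hi) (subst (_≤ b ℕ.+ hi) (ℕₚ.+-comm r (suc hi))
                  (subst (_≤ b ℕ.+ hi) (sym (ℕₚ.+-suc r hi)) (ℕₚ.+-monoˡ-< hi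
                    (ℕₚ.≤∧≢⇒< (ℕₚ.≮⇒≥ (λ b<r → cr≢0 (proj₂ (proj₂ (proj₂ last-c)) r b<r r<t′))) r≢b)))))
                (ℕₚ.≤-<-trans (ℕₚ.m∸n≤m _ r) (within b<t′ hi<m hi≢0)))
            located : ∀ {ν} → coeff (position ν) φ ≢ 0# → position ν ≋ g ℕ.* 1
            located {ν} ≢0 with position ν % m ℕ.≟ (g ℕ.* 1) % m
            ... | yes eq = eq
            ... | no ≢ = ⊥-elim (≢0 (coeff-miss 1# ≢))
            -- Both positions belong to the single term of the monomial, and both are below `m`, so
            -- the congruence is an equality. With `a ≤ b` and `lo ≤ hi` it forces `lo ≡ hi`.
            same-place : a ℕ.+ lo ≡ b ℕ.+ hi
            same-place = sym (m<n⇒m%n≡m (within a<t′ lo<m lo≢0)) ∙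
              position-cancel {a ℕ.+ lo} {b ℕ.+ hi} (located {a ℕ.+ lo} at-a ∙ sym (located {b ℕ.+ hi} at-b)) ∙
                m<n⇒m%n≡m (within b<t′ hi<m hi≢0)
            lo≤hi : lo ≤ hi
            lo≤hi = ℕₚ.≮⇒≥ (λ hi<lo → hi≢0 (below hi hi<lo))
            a≤b : a ≤ b
            a≤b = ℕₚ.≮⇒≥ (λ b<a → proj₁ (proj₂ (proj₂ last-c)) (proj₂ (proj₂ (proj₂ first-c)) b b<a))
            lo≡hi : lo ≡ hi
            lo≡hi = ℕₚ.≤-antisym lo≤hi (ℕₚ.+-cancelˡ-≤ b hi lo
              (subst (_≤ b ℕ.+ lo) same-place (ℕₚ.+-monoˡ-≤ lo a≤b)))

          -- An expansion of `x + twist 1 σ^t(x)` supplies an `r` for which the single term of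
          -- `Y^ r ∘ γ` sits at σ^0. That word lies in the code, so the coupling demands a nonzero
          -- term at σ^t as well; with one term only, σ^0 and σ^t would coincide.
          contradictory : ⊥
          contradictory = gt≢0 (sym (proj₂ (proj₂ pt)) ∙
              position-≋ {proj₁ pt} {proj₁ p₀} pt≋p₀ ∙ proj₂ (proj₂ p₀))
            where
            ν₀ = proj₁ single-support
            φ : K → K
            φ x = 1# * x + twist 1# * Fr (g ℕ.* t) x
            φ∈ : InCode φ
            φ∈ = twisted 1#
            p₀ : Σ ℕ λ ν → ν < m × position ν ≋ 0
            p₀ = position-surjective 0
            pt : Σ ℕ λ ν → ν < m × position ν ≋ g ℕ.* t
            pt = position-surjective (g ℕ.* t)
            start : coeff (position (proj₁ p₀)) φ ≡ 1#
            start = coeff-≋ φ (proj₂ (proj₂ p₀) ∙ cong (_% m) (sym (ℕₚ.*-zeroʳ g))) ∙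
              code-coeff φ∈ 0 ℕ.z≤n
            term : Σ ℕ λ r → r < t′ × r ≤ proj₁ p₀ × _ × γ̂ (proj₁ p₀ ∸ r) ≢ 0#
            term = contributes (proj₁ (spanned φ∈)) (proj₂ (spanned φ∈)) (proj₁ p₀) (λ eq → 1≢0 (sym start ∙
              eq))
            r = proj₁ term
            r<t′ = proj₁ (proj₂ term)
            r≤p₀ = proj₁ (proj₂ (proj₂ term))
            γ̂≢0 = proj₂ (proj₂ (proj₂ (proj₂ term)))
            p₀-r≡ν₀ : proj₁ p₀ ∸ r ≡ ν₀
            p₀-r≡ν₀ = proj₂ (proj₂ single-support) (ℕₚ.≤-<-trans (ℕₚ.m∸n≤m _ r) (proj₁ (proj₂ p₀))) γ̂≢0
            ψ : K → K
            ψ x = X 1# ((Y^ r) (γ x))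
            ψ∈ : InCode ψ
            ψ∈ = contained 1# r r<t′
            ψ-coeff : ∀ ν → coeff (position (r ℕ.+ ν)) ψ ≡ (Y^ r) (γ̂ ν)
            ψ-coeff ν = term-coeff 1# r ν ∙ X-1 _
            ψ-0 : coeff 0 ψ ≢ 0#
            ψ-0 eq = γ̂≢0 (Y^-kernel r (sym (ψ-coeff _) ∙ cong (λ ν → coeff (position ν) ψ)
              (ℕₚ.m+[n∸m]≡n r≤p₀) ∙ coeff-≋ ψ (proj₂ (proj₂ p₀)) ∙ eq))
            -- The position of σ^t moved back by `r` steps, modulo `m`.
            index = proj₁ pt ℕ.+ (m ∸ r)
            r+index : r ℕ.+ index ≡ proj₁ pt ℕ.+ 1 ℕ.* m
            r+index = Rearrangements.exchange r (proj₁ pt) (m ∸ r) ∙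
              cong (proj₁ pt ℕ.+_) (ℕₚ.m+[n∸m]≡n (ℕₚ.≤-trans (ℕₚ.<⇒≤ r<t′) t′≤m) ∙ sym (ℕₚ.+-identityʳ m))
            r+index≋ : r ℕ.+ index ≋ proj₁ pt
            r+index≋ = cong (_% m) r+index ∙ ≋-multiple (proj₁ pt) 1
            ψ-t : γ̂ index ≢ 0#
            ψ-t eq = twist-nonzero ψ-0 (sym (code-twist ψ∈) ∙ coeff-≋ ψ (sym (proj₂ (proj₂ pt)) ∙
              position-≋ {proj₁ pt} {r ℕ.+ index} (sym r+index≋)) ∙
              ψ-coeff index ∙ cong (Y^ r) eq ∙ map-0 (Y^-linear r))
            index≋ν₀ : index ≋ ν₀
            index≋ν₀ = proj₂ (proj₂ single-support) (m%n<n index m) (λ eq → ψ-t (γ̂-≋ {index} {index % m} (sym (≋-% index)) ∙ eq)) ∙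
              sym (m<n⇒m%n≡m (proj₁ (proj₂ single-support)))
            pt≋p₀ : proj₁ pt ≋ proj₁ p₀
            pt≋p₀ = sym r+index≋ ∙ ≋-+ˡ r {index} {ν₀} index≋ν₀ ∙
              cong (_% m) (cong (r ℕ.+_) (sym p₀-r≡ν₀) ∙ ℕₚ.m+[n∸m]≡n r≤p₀)

        contradiction : ⊥
        contradiction with t ℕ.≟ 1
        ... | yes t≡1 = τ≋0 (untwisted t≡1)
        ... | no t≢1 = Supports.contradictory (ℕₚ.≤∧≢⇒< 1≤t (t≢1 ∘ sym))

      InGabidulin : ℕ → ℕ → Vector → Vector → Set
      InGabidulin t′ J Γ w = Σ (ℕ → K) λ c → ∀ i → w i ≡ sumN t′ (λ r → c r * Fr (r ℕ.* J) (Γ i))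

      InCode-cong : ∀ {φ ψ} → (∀ {x} → InFqm x → φ x ≡ ψ x) → InCode φ → InCode ψ
      InCode-cong eq (c , coupled , expansion) = c , coupled , λ x∈ → sym (eq x∈) ∙ expansion x∈

      code-interpolate : ∀ {φ} → InCode φ → ∀ {x} → InFqm x → φ x ≡ interpolate (φ ∘ e) x
      code-interpolate {φ} (c , _ , expansion) x∈ = expansion x∈ ∙ linear-unique e-spans
        (sumN-linear (suc t) (λ i → ∘-linear (*ˡ-linear (c i)) (Fr-linear (g ℕ.* i)))) (interpolate-linear (φ ∘ e))
        (λ i → sym (expansion (e∈ i)) ∙ sym (interpolate-e (φ ∘ e) i)) x∈

      -- Pulling the two actions on a Gabidulin code back along T.

      module CodeEquivalence
          (untwisted : t ≡ 1 → ¬ (τ ≋ 0))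
          {θ : K} (θ∉ : ¬ InFq θ) (o : Fin m)
          (T T⁻¹ : Vector → Vector) (σ : K → K)
          (T-cong : ∀ {v w} → (∀ i → v i ≡ w i) → ∀ i → T v i ≡ T w i)
          (T⁻¹-cong : ∀ {v w} → (∀ i → v i ≡ w i) → ∀ i → T⁻¹ v i ≡ T⁻¹ w i)
          (T-+ : ∀ v w i → T (v ⊞ w) i ≡ T v i + T w i)
          (T-hom : ∀ {c} v → InFq c → ∀ i → T (λ k → c * v k) i ≡ σ c * T v i)
          (σ∈ : ∀ {c} → InFq c → InFq (σ c))
          (T⁻¹T : ∀ v i → T⁻¹ (T v) i ≡ v i) (TT⁻¹ : ∀ v i → T (T⁻¹ v) i ≡ v i)
          (T-rank : ∀ {v} → RankOne v → RankOne (T v))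
          (T-rank⁻¹ : ∀ {v} → RankOne (T v) → RankOne v)
          (t′ : ℕ) (1≤t′ : 1 ≤ t′) (t′≤m : t′ ≤ m) (J : ℕ) (Γ : Vector)
          (code⇒gabidulin : ∀ v → InCode (interpolate v) → InGabidulin t′ J Γ (T v))
          (gabidulin⇒code : ∀ v → InGabidulin t′ J Γ (T v) → InCode (interpolate v))
        where
        open Preserver θ∉ o T T⁻¹ σ T-cong T⁻¹-cong T-+ T-hom σ∈ T⁻¹T TT⁻¹ T-rank T-rank⁻¹

        InImage : Vector → Set
        InImage = InGabidulin t′ J Γ

        InImage-cong : ∀ {v w} → (∀ i → v i ≡ w i) → InImage v → InImage w
        InImage-cong eq (c , expansion) = c , λ i → sym (eq i) ∙ expansion i

        image-term : ∀ c r → r < t′ → InImage (λ i → c * Fr (r ℕ.* J) (Γ i))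
        image-term c r r<t′ = δ , λ i → sym ((sumN-single t′ r r<t′ _
            (λ s _ s≢r → cong (_* Fr (s ℕ.* J) (Γ i)) (δ-off (s ℕ.≟ r) s≢r) ∙ zeroˡ _)) ∙
          cong (_* Fr (r ℕ.* J) (Γ i)) (δ-on (r ℕ.≟ r)))
          where
          select : ∀ {s} → Dec (s ≡ r) → K
          select (yes _) = c
          select (no _) = 0#
          δ : ℕ → K
          δ s = select (s ℕ.≟ r)
          δ-on : (d : Dec (r ≡ r)) → select d ≡ c
          δ-on (yes _) = refl
          δ-on (no r≢r) = ⊥-elim (r≢r refl)
          δ-off : ∀ {s} (d : Dec (s ≡ r)) → s ≢ r → select d ≡ 0#
          δ-off (yes s≡r) s≢r = ⊥-elim (s≢r s≡r)
          δ-off (no _) _ = refl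

        -- K acts on the Gabidulin code, which is spanned over K by the orbit of Γ under Θ.
        record Action : Set where
          field
            N : K → Vector → Vector
            Θ : Vector → Vector
            N-admissible : ∀ c → Admissible (N c)
            Θ-admissible : Admissible Θ
            N-+ˡ : ∀ c d v i → N (c + d) v i ≡ N c v i + N d v i
            N-* : ∀ c d v i → N (c * d) v i ≡ N c (N d v) i
            N-1 : ∀ v i → N 1# v i ≡ v i
            -- Equal to `J` for the left action, but to the exponent of the inverse automorphism for
            -- the right action.
            j : ℕ
            j-cancel : ∀ {i k} → i ℕ.* j ≋ k ℕ.* j → i ≋ k
            j-surjective : ∀ r → Σ ℕ λ i → i < m × i ℕ.* j ≋ r
            Θ-N : ∀ c v i → Θ (N c v) i ≡ N (Fr j c) (Θ v) i
            Θ-kernel : ∀ {v} → (∀ i → Θ v i ≡ 0#) → ∀ i → v i ≡ 0#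
            N-preserves : ∀ c {w} → InImage w → InImage (N c w)
            spanned : ∀ {w} → InImage w → Σ (ℕ → K) λ c → ∀ i → w i ≡ sumN t′ (λ r → N (c r) (iterate Θ r Γ) i)
            contained : ∀ c r → r < t′ → InImage (N c (iterate Θ r Γ))

        module PullBack (action : Action) where
          open Action action

          X : K → K → K
          X c = pulled (N c)

          Y : K → K
          Y = pulled Θ

          pulled-cong : ∀ {N N′} → (∀ v i → N v i ≡ N′ v i) → ∀ z → pulled N z ≡ pulled N′ z
          pulled-cong eq z = T⁻¹-cong (eq _) o

          -- Conjugation by `T` respects composition, and by `conjugate-pulled` the inner conjugate
          -- of a constant vector is again constant.
          pulled-∘ : ∀ {N N′} → Admissible N → Admissible N′ → ∀ z → pulled (N ∘ N′) z ≡ pulled N (pulled N′ z)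
          pulled-∘ {N} {N′} N-adm N′-adm z = sym (T⁻¹-cong (Admissible.N-cong N-adm (λ i →
            T-cong (λ k → sym (Pull.conjugate-pulled N′-adm (λ _ → z) k)) i ∙ TT⁻¹ _ i)) o)

          pulled-T⁻¹ : ∀ {N} → Admissible N → ∀ w i → T⁻¹ (N w) i ≡ pulled N (T⁻¹ w i)
          pulled-T⁻¹ N-adm w i = T⁻¹-cong (Admissible.N-cong N-adm (λ k → sym (TT⁻¹ w k))) i ∙
            Pull.conjugate-pulled N-adm (T⁻¹ w) i

          X-linear : ∀ c → Linear (X c)
          X-linear c = Pull.pulled-linear (N-admissible c)

          Y-linear : Linear Y
          Y-linear = Pull.pulled-linear Θ-admissible

          X-+ : ∀ c d z → X (c + d) z ≡ X c z + X d z
          X-+ c d z = T⁻¹-cong (N-+ˡ c d (T (λ _ → z))) o ∙ T⁻¹-+ _ _ o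

          X-* : ∀ c d z → X (c * d) z ≡ X c (X d z)
          X-* c d z = pulled-cong {N (c * d)} {N c ∘ N d} (N-* c d) z ∙
            pulled-∘ (N-admissible c) (N-admissible d) z

          X-1 : ∀ z → X 1# z ≡ z
          X-1 z = T⁻¹-cong (N-1 _) o ∙ T⁻¹T _ o

          Y-X : ∀ c z → Y (X c z) ≡ X (Fr j c) (Y z)
          Y-X c z = sym (pulled-∘ Θ-admissible (N-admissible c) z) ∙
            pulled-cong {Θ ∘ N c} {N (Fr j c) ∘ Θ} (Θ-N c) z ∙ pulled-∘ (N-admissible (Fr j c)) Θ-admissible z

          Y-kernel : ∀ {z} → Y z ≡ 0# → z ≡ 0#
          Y-kernel {z} Yz≡0 = T-injective {λ _ → z} (λ i → Tz≡0 i ∙ sym (T-0 i)) o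
            where
            Tz≡0 : ∀ i → T (λ _ → z) i ≡ 0#
            Tz≡0 = Θ-kernel (λ i → sym (TT⁻¹ _ i) ∙ T-cong (λ k →
              Pull.conjugate-pulled Θ-admissible (λ _ → z) k ∙ Yz≡0) i ∙ T-0 i)

          -- The round trip through the Gabidulin code: send the word there by `T`, act by `N c`,
          -- return. By `conjugate-pulled` this is composition with `X c`.
          X-preserves : ∀ c {φ} → InCode φ → InCode (X c ∘ φ)
          X-preserves c {φ} φ∈ = InCode-cong agree (gabidulin⇒code (X c ∘ φ ∘ e) (InImage-cong transported
              (N-preserves c (code⇒gabidulin (φ ∘ e) (InCode-cong (code-interpolate φ∈) φ∈)))))
            where
            transported : ∀ i → N c (T (φ ∘ e)) i ≡ T (X c ∘ φ ∘ e) i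
            transported i = sym (TT⁻¹ _ i) ∙ T-cong (Pull.conjugate-pulled (N-admissible c) (φ ∘ e)) i
            agree : ∀ {x} → InFqm x → interpolate (X c ∘ φ ∘ e) x ≡ X c (φ x)
            agree x∈ = linear-unique e-spans (interpolate-linear _) (∘-linear (X-linear c) (interpolate-linear (φ ∘ e)))
              (λ i → interpolate-e _ i ∙ cong (X c) (sym (interpolate-e (φ ∘ e) i))) x∈ ∙
              cong (X c) (sym (code-interpolate φ∈ x∈))

          γ : K → K
          γ = interpolate (T⁻¹ Γ)

          XY-linear : ∀ c r → Linear (λ x → X c (iterate Y r (γ x)))
          XY-linear c r = ∘-linear (X-linear c) (∘-linear (iterate-linear Y-linear r) (interpolate-linear (T⁻¹ Γ)))

          T⁻¹-iterate : ∀ r i → T⁻¹ (iterate Θ r Γ) i ≡ iterate Y r (T⁻¹ Γ i)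
          T⁻¹-iterate zero i = refl
          T⁻¹-iterate (suc r) i = pulled-T⁻¹ Θ-admissible (iterate Θ r Γ) i ∙ cong Y (T⁻¹-iterate r i)

          T⁻¹-term : ∀ c r i → T⁻¹ (N c (iterate Θ r Γ)) i ≡ X c (iterate Y r (γ (e i)))
          T⁻¹-term c r i = pulled-T⁻¹ (N-admissible c) (iterate Θ r Γ) i ∙
            cong (X c) (T⁻¹-iterate r i ∙ cong (iterate Y r) (sym (interpolate-e (T⁻¹ Γ) i)))

          T⁻¹-sum : ∀ d (W : ℕ → Vector) i → T⁻¹ (λ k → sumN d (λ r → W r k)) i ≡ sumN d (λ r → T⁻¹ (W r) i)
          T⁻¹-sum zero W i = T⁻¹-0 i
          T⁻¹-sum (suc d) W i = (T⁻¹-+ _ (W d) i) ∙ cong (_+ T⁻¹ (W d) i) (T⁻¹-sum d W i)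

          γ-spans : ∀ {φ} → InCode φ → Σ (ℕ → K) λ c →
                    ∀ {x} → InFqm x → φ x ≡ sumN t′ (λ r → X (c r) (iterate Y r (γ x)))
          γ-spans {φ} φ∈ = c , λ x∈ → code-interpolate φ∈ x∈ ∙
            linear-unique e-spans (interpolate-linear (φ ∘ e))
              (sumN-linear t′ (λ r → XY-linear (c r) r)) (λ i → interpolate-e (φ ∘ e) i ∙ expansion i) x∈
            where
            found : Σ (ℕ → K) λ c → ∀ i → T (φ ∘ e) i ≡ sumN t′ (λ r → N (c r) (iterate Θ r Γ) i)
            found = spanned (code⇒gabidulin (φ ∘ e) (InCode-cong (code-interpolate φ∈) φ∈))
            c : ℕ → K
            c = proj₁ found
            expansion : ∀ i → φ (e i) ≡ sumN t′ (λ r → X (c r) (iterate Y r (γ (e i))))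
            expansion i = sym (T⁻¹T (φ ∘ e) i) ∙ T⁻¹-cong (proj₂ found) i ∙
              T⁻¹-sum t′ (λ r → N (c r) (iterate Θ r Γ)) i ∙ sumN-cong t′ (λ r _ → T⁻¹-term (c r) r i)

          γ-contained : ∀ c r → r < t′ → InCode (λ x → X c (iterate Y r (γ x)))
          γ-contained c r r<t′ = InCode-cong
            (linear-unique e-spans (interpolate-linear _) (XY-linear c r)
              (λ i → interpolate-e _ i ∙ T⁻¹-term c r i))
            (gabidulin⇒code (T⁻¹ (N c (iterate Θ r Γ))) (InImage-cong (λ i → sym (TT⁻¹ _ i)) (contained c r r<t′)))

          contradiction : ⊥
          contradiction = FieldAction.contradiction X X-linear X-+ X-* X-1 X-preserves Y Y-linear Y-kernel j Y-X
            j-cancel j-surjective t′ 1≤t′ t′≤m γ (interpolate-linear (T⁻¹ Γ)) γ-spans γ-contained untwisted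

        module _ (J-cancel : ∀ {i k} → i ℕ.* J ≋ k ℕ.* J → i ≋ k)
                 (J-surjective : ∀ r → Σ ℕ λ i → i < m × i ℕ.* J ≋ r) where
          -- Scalar multiplication on the left is entrywise, hence admissible for row type, and
          -- `Fr J` produces the successive generators of the code from `Γ`.
          not-row : ¬ RowType (unit o)
          not-row row = PullBack.contradiction (record
            { N = N
            ; Θ = Θ
            ; N-admissible = λ c → row-admissible row (*ˡ-linear c)
            ; Θ-admissible = row-admissible row (Fr-linear J)
            ; N-+ˡ = λ c d v i → distribʳ (v i) c d
            ; N-* = λ c d v i → *-assoc c d (v i)
            ; N-1 = λ v i → *-identityˡ (v i)
            ; j = J
            ; j-cancel = J-cancel
            ; j-surjective = J-surjective
            ; Θ-N = λ c v i → Fr-* J c (v i)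
            ; Θ-kernel = λ {v} Θv≡0 i → decidable-stable (v i ≟ 0#) (λ vi≢0 → Fr-nonzero J vi≢0 (Θv≡0 i))
            ; N-preserves = λ { c (a , expansion) → (λ r → c * a r) , λ i → cong (c *_) (expansion i) ∙
                (sumN-*ˡ t′ c _) ∙ sumN-cong t′ (λ r _ → sym (*-assoc _ _ _)) }
            ; spanned = λ { (a , expansion) → a , λ i → expansion i ∙
                sumN-cong t′ (λ r _ → cong (a r *_) (sym (orbit r i))) }
            ; contained = λ c r r<t′ → InImage-cong (λ i → cong (c *_) (sym (orbit r i))) (image-term c r r<t′)
            })
            where
            open import Relation.Nullary.Decidable using (decidable-stable)
            N : K → Vector → Vector
            N c v i = c * v i
            Θ : Vector → Vector
            Θ v i = Fr J (v i)
            orbit : ∀ r i → iterate Θ r Γ i ≡ Fr (r ℕ.* J) (Γ i)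
            orbit zero i = sym (Fr-zero (Γ i))
            orbit (suc r) i = cong (Fr J) (orbit r i) ∙ sym (Fr-∘ J (r ℕ.* J) (Γ i))

        module _ (Γ-independent : LinIndep Γ) (Γ-spans : Spans Whole Γ)
                 (J′ : ℕ) (J-inverse : ∀ x → Fr J (Fr J′ x) ≡ x)
                 (J′-cancel : ∀ {i k} → i ℕ.* J′ ≋ k ℕ.* J′ → i ≋ k)
                 (J′-surjective : ∀ r → Σ ℕ λ i → i < m × i ℕ.* J′ ≋ r) where
          open Coordinates Γ Γ-independent Γ-spans

          -- Vectors are now the linear maps K → K, through their values on Γ, and
          -- precompose acts on the right.
          precompose : (K → K) → Vector → Vector
          precompose Z v i = extend v (Z (Γ i))

          extend-precompose : ∀ {Z} → Linear Z → ∀ v x → extend (precompose Z v) x ≡ extend v (Z x)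
          extend-precompose Z-lin v x = linear-unique Γ-spans (extend-linear _) (∘-linear (extend-linear v) Z-lin)
            (extend-basis _) {x} _

          extend-unique : ∀ {φ} → Linear φ → ∀ {v} → (∀ i → v i ≡ φ (Γ i)) → ∀ x → extend v x ≡ φ x
          extend-unique φ-lin {v} eq x = linear-unique Γ-spans (extend-linear v) φ-lin
            (λ i → extend-basis v i ∙ eq i) {x} _

          -- Precomposition is multiplication by a matrix over F_q, hence admissible for column
          -- type. Order is reversed: moving `c` past `Fr J` on this side applies the inverse
          -- automorphism, whence `J′`. In a term `Fr (r * J)` the scalar reappears as
          -- `Fr (r * J) c`, so coefficients are matched through Frobenius roots.
          not-column : ¬ ColumnType (unit o)
          not-column column = PullBack.contradiction (record
            { N = N
            ; Θ = Θ
            ; N-admissible = λ c → column-admissible column (λ i → coordinate∈ (c * Γ i))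
            ; Θ-admissible = column-admissible column (λ i → coordinate∈ (Fr J (Γ i)))
            ; N-+ˡ = λ c d v i → cong (extend v) (distribʳ (Γ i) c d) ∙ (add (extend-linear v) _ _)
            ; N-* = λ c d v i → cong (extend v) (cong (_* Γ i) (*-comm c d) ∙ *-assoc d c (Γ i)) ∙
                sym (extend-precompose (*ˡ-linear d) v (c * Γ i))
            ; N-1 = λ v i → cong (extend v) (*-identityˡ (Γ i)) ∙ extend-basis v i
            ; j = J′
            ; j-cancel = J′-cancel
            ; j-surjective = J′-surjective
            ; Θ-N = λ c v i → extend-precompose (*ˡ-linear c) v (Fr J (Γ i)) ∙
                sym (extend-precompose (Fr-linear J) v (Fr J′ c * Γ i) ∙
                  cong (extend v) (Fr-* J _ _ ∙ cong (_* Fr J (Γ i)) (J-inverse c)))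
            ; Θ-kernel = λ {v} Θv≡0 i → sym (extend-basis v i) ∙ cong (extend v) (sym (J-inverse (Γ i))) ∙
                sym (extend-precompose (Fr-linear J) v (Fr J′ (Γ i))) ∙ lc-right-0 Θv≡0
            ; N-preserves = λ { c {w} (a , expansion) → (λ r → a r * Fr (r ℕ.* J) c) , λ i →
                extend-unique (sumN-linear t′ (λ r → ∘-linear (*ˡ-linear (a r)) (Fr-linear (r ℕ.* J)))) expansion (c * Γ i) ∙
                  sumN-cong t′ (λ r _ → cong (a r *_) (Fr-* (r ℕ.* J) c (Γ i)) ∙ sym (*-assoc _ _ _)) }
            ; spanned = λ { (a , expansion) → (λ r → proj₁ (root (a r) r)) , λ i → expansion i ∙
                sumN-cong t′ (λ r _ → cong (_* Fr (r ℕ.* J) (Γ i)) (sym (proj₂ (root (a r) r))) ∙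
                  sym (term (proj₁ (root (a r) r)) r i)) }
            ; contained = λ c r r<t′ → InImage-cong (λ i → sym (term c r i)) (image-term (Fr (r ℕ.* J) c) r r<t′)
            })
            where
            N : K → Vector → Vector
            N c = precompose (c *_)
            Θ : Vector → Vector
            Θ = precompose (Fr J)
            lc-right-0 : ∀ {v x} → (∀ i → v i ≡ 0#) → extend v x ≡ 0#
            lc-right-0 {v} {x} v≡0 = sumF-0 {m} (λ i → cong (coordinate x i *_) (v≡0 i) ∙ zeroʳ _)
            orbit : ∀ r i → iterate Θ r Γ i ≡ Fr (r ℕ.* J) (Γ i)
            orbit zero i = sym (Fr-zero (Γ i))
            orbit (suc r) i = extend-unique (Fr-linear (r ℕ.* J)) (orbit r) (Fr J (Γ i)) ∙
              Fr-comm (r ℕ.* J) J (Γ i) ∙ sym (Fr-∘ J (r ℕ.* J) (Γ i))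
            term : ∀ c r i → N c (iterate Θ r Γ) i ≡ Fr (r ℕ.* J) c * Fr (r ℕ.* J) (Γ i)
            term c r i = extend-unique (Fr-linear (r ℕ.* J)) (orbit r) (c * Γ i) ∙ Fr-* (r ℕ.* J) c (Γ i)
            root : ∀ a r → Σ K λ d → Fr (r ℕ.* J) d ≡ a
            root a r = Fr-surjective (r ℕ.* J) a

        module _ (σ-0 : σ 0# ≡ 0#) (σ-surjective : ∀ {c} → InFq c → Σ K λ d → InFq d × σ d ≡ c) where
          T-sum : ∀ {d} (W : Fin d → Vector) i → T (λ k → sumF (λ l → W l k)) i ≡ sumF (λ l → T (W l) i)
          T-sum {zero} W i = T-0 i
          T-sum {suc d} W i = (T-+ (W Fin.zero) _ i) ∙ cong (T (W Fin.zero) i +_) (T-sum (W ∘ Fin.suc) i)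

          -- `T` embeds `unit o ⊗ K` semilinearly into F_q^m ⊗ y, a space of dimension at most `m`;
          -- a longer independent family would have dependent images.
          column-dimension : ∀ {d} (u : Fin d → K) → LinIndep u → ColumnType (unit o) → d ≤ m
          column-dimension {zero} _ _ _ = ℕ.z≤n
          column-dimension {suc d} u u-independent (y , column) = ℕₚ.≰⇒> λ m≤d → impossible m≤d
            where
            rows : Fin (suc d) → Vector
            rows l = proj₁ (column (u l))
            rows∈ : ∀ l i → InFq (rows l i)
            rows∈ l = proj₁ (proj₂ (column (u l)))
            module _ (m≤d : m ≤ d) where
              -- The rows have length `m ≤ d`; padding with zeros gives them the length `d` that
              -- elimination expects.
              relation = Elimination.dependence FqField d (λ l i → ext (rows l) (toℕ i)) (λ l i → ext-Fq (rows∈ l) (toℕ i))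
              c : Fin (suc d) → K
              c = proj₁ relation
              c∈ : ∀ l → InFq (c l)
              c∈ = proj₁ (proj₂ relation)
              c-rows : ∀ i → sumF (λ l → c l * rows l i) ≡ 0#
              c-rows i = sumF-cong {suc d} (λ l → cong (c l *_) (sym (ext-toℕ (rows l) i) ∙
                  cong (ext (rows l)) (sym (Finₚ.toℕ-fromℕ< i<d)))) ∙
                proj₂ (proj₂ (proj₂ relation)) (Fin.fromℕ< i<d)
                where
                i<d : toℕ i < d
                i<d = ℕₚ.<-≤-trans (Finₚ.toℕ<n i) m≤d
              -- `T` applies `σ` to scalars, so the relation among the images is lifted through
              -- preimages under `σ`.
              c′ : Fin (suc d) → K
              c′ l = proj₁ (σ-surjective (c∈ l))
              c′∈ : ∀ l → InFq (c′ l)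
              c′∈ l = proj₁ (proj₂ (σ-surjective (c∈ l)))
              σc′ : ∀ l → σ (c′ l) ≡ c l
              σc′ l = proj₂ (proj₂ (σ-surjective (c∈ l)))
              image-0 : ∀ i → T (tensor (unit o) (lc c′ u)) i ≡ 0#
              image-0 i = begin
                T (tensor (unit o) (lc c′ u)) i
                  ≡⟨ T-cong (λ k → sumF-*ˡ {suc d} (unit o k) (λ l → c′ l * u l) ∙ sumF-cong {suc d} (λ l →
                       solve 3 (λ a c u → a :* (c :* u) := c :* (a :* u)) refl (unit o k) (c′ l) (u l))) i ⟩
                T (λ k → sumF (λ l → c′ l * tensor (unit o) (u l) k)) i
                  ≡⟨ T-sum (λ l k → c′ l * tensor (unit o) (u l) k) i ⟩
                sumF (λ l → T (λ k → c′ l * tensor (unit o) (u l) k) i)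
                  ≡⟨ sumF-cong {suc d} (λ l → (T-hom _ (c′∈ l) i) ∙
                    cong₂ _*_ (σc′ l) (proj₂ (proj₂ (column (u l))) i) ∙
                       sym (*-assoc _ _ _)) ⟩
                sumF (λ l → c l * rows l i * y)
                  ≡⟨ sumF-*ʳ {suc d} y (λ l → c l * rows l i) ⟨
                sumF (λ l → c l * rows l i) * y
                  ≡⟨ cong (_* y) (c-rows i) ∙ zeroˡ y ⟩
                0# ∎
              combination-0 : lc c′ u ≡ 0#
              combination-0 = sym (cong (_* lc c′ u) (unit-diag o) ∙ *-identityˡ _) ∙
                T-injective (λ i → image-0 i ∙ sym (T-0 i)) o
              impossible : ⊥
              impossible = proj₂ (proj₁ (proj₂ (proj₂ relation))) (sym (σc′ _) ∙
                cong σ (u-independent c′ c′∈ combination-0 _) ∙ σ-0)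

        resize : ∀ {d d′} → d ≡ d′ → (b : Fin d → K) → IsBasis Whole b → Σ (Fin d′ → K) (IsBasis Whole)
        resize refl b b-basis = b , b-basis

        -- For column type the dimension count gives `d ≡ m`; then the `m` independent entries of
        -- `Γ` form a basis of `K`, as the right action requires.
        not-equivalent : (∀ {i k} → i ℕ.* J ≋ k ℕ.* J → i ≋ k) → (∀ r → Σ ℕ λ i → i < m × i ℕ.* J ≋ r) →
                         LinIndep Γ → ∀ J′ → (∀ x → Fr J (Fr J′ x) ≡ x) →
                         (∀ {i k} → i ℕ.* J′ ≋ k ℕ.* J′ → i ≋ k) → (∀ r → Σ ℕ λ i → i < m × i ℕ.* J′ ≋ r) →
                         σ 0# ≡ 0# → (∀ {c} → InFq c → Σ K λ d → InFq d × σ d ≡ c) →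
                         ∀ {d} (u : Fin d → K) → IsBasis Whole u → m ≤ d → ⊥
        not-equivalent J-cancel J-surjective Γ-independent J′ J-inverse J′-cancel J′-surjective σ-0 σ-surjective
            {d} u u-basis m≤d = by-cases (row-or-column-type (unit o) (unit-scalars o))
          where
          by-cases : RowType (unit o) ⊎ ColumnType (unit o) → ⊥
          by-cases (inj₁ row) = not-row J-cancel J-surjective row
          by-cases (inj₂ column) = not-column Γ-independent (independent-spans (proj₂ square) Γ-independent)
              J′ J-inverse J′-cancel J′-surjective column
            where
            d≡m : d ≡ m
            d≡m = ℕₚ.≤-antisym (column-dimension σ-0 σ-surjective u (proj₁ (proj₂ u-basis)) column) m≤d
            square : Σ (Fin m → K) (IsBasis Whole)
            square = resize d≡m u u-basis

    -- Bilinear forms as vectors, through the trace.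

    module BilinearForms
        (0<n : 0 < n) (e′ u : Fin n → K) (e′-basis : IsBasis Whole e′) (u-basis : IsBasis Whole u)
      where
      Tr-linear : Linear Tr
      Tr-linear = sumN-linear n Fr-linear

      Tr-Fr1 : ∀ y → sumN n (λ i → Fr (suc i) y) ≡ Tr y
      Tr-Fr1 y = +-cancelˡ (Fr 0 y) (sym (sumN-suc n (λ i → Fr i y)) ∙
        cong (Tr y +_) (fermat y ∙ sym (Fr-zero y)) ∙ +-comm _ _)

      Tr-Fr : ∀ a y → Tr (Fr a y) ≡ Tr y
      Tr-Fr zero y = cong Tr (Fr-zero y)
      Tr-Fr (suc a) y = cong Tr (Fr-∘ 1 a y) ∙ sumN-cong n (λ i _ → sym (Fr-∘ i 1 (Fr a y)) ∙
        cong (λ b → Fr b (Fr a y)) (ℕₚ.+-comm i 1)) ∙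
        Tr-Fr1 (Fr a y) ∙ Tr-Fr a y

      Tr∈ : ∀ y → InFq (Tr y)
      Tr∈ y = fixed⇒Fq ((sumN-additive n (Fr-+ 1) _) ∙
        sumN-cong n (λ i _ → sym (Fr-∘ 1 i y)) ∙ Tr-Fr1 y)

      -- The traces `Tr (z * e′ l)` are values at `e′ l` of the q-polynomial with coefficients
      -- `Fr r z`. By `moore` these all vanish, in particular the one with r = 0.
      Tr-nondegenerate : ∀ {z} → (∀ l → Tr (z * e′ l) ≡ 0#) → z ≡ 0#
      Tr-nondegenerate {z} eq = sym (Fr-zero z) ∙ moore n e′ (proj₁ (proj₂ e′-basis)) (λ r → Fr r z)
        (λ l → sumN-cong n (λ i _ → sym (Fr-* i z (e′ l))) ∙ eq l) 0 0<n

      Tr-injective : ∀ {y z} → (∀ x → Tr (y * x) ≡ Tr (z * x)) → y ≡ z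
      Tr-injective {y} {z} eq = −≡0⇒≡ (Tr-nondegenerate (λ l → cong Tr (distribʳ (e′ l) y (- z)) ∙
        (add Tr-linear _ _) ∙ cong₂ _+_ (eq (e′ l)) (cong Tr (sym (-‿distribˡ-* z (e′ l))) ∙
          (additive-neg (add Tr-linear) _)) ∙ -‿inverseʳ _))

      open Coordinates u (proj₁ (proj₂ u-basis)) (proj₂ (proj₂ u-basis)) using (coordinate-unique)

      -- Riesz representation: z ↦ Tr(z ·), in coordinates.
      A : K → K
      A z = lc (λ l → Tr (z * e′ l)) u

      A-linear : Linear A
      A-linear = linear
        (λ x y → sumF-cong {n} (λ l → cong (_* u l) (cong Tr (distribʳ (e′ l) x y) ∙ add Tr-linear _ _) ∙
            (distribʳ (u l) _ _)) ∙
          sumF-+ {n} (λ l → Tr (x * e′ l) * u l) (λ l → Tr (y * e′ l) * u l))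
        (λ {c} x c∈ → sumF-cong {n} (λ l → cong (_* u l) (cong Tr (*-assoc c x (e′ l)) ∙ hom Tr-linear _ c∈) ∙
            (*-assoc _ _ _)) ∙
          sym (sumF-*ˡ {n} c (λ l → Tr (x * e′ l) * u l)))

      A-injective : ∀ {x y} → A x ≡ A y → x ≡ y
      A-injective {x} {y} eq = −≡0⇒≡ (Tr-nondegenerate
          (coordinate-unique (λ l → Tr∈ ((x − y) * e′ l)) (λ _ → Fq.has-0) Axy≡0))
        where
        Axy≡0 : A (x − y) ≡ lc (λ _ → 0#) u
        Axy≡0 = additive-− (add A-linear) x y ∙ ≡⇒−≡0 eq ∙ sym (lc-0 u (λ _ → refl))

      abstract
        A-surjective : ∀ y → Σ K λ x → A x ≡ y
        A-surjective = injective⇒surjective A (λ _ _ → A-injective)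

      A⁻¹ : K → K
      A⁻¹ y = proj₁ (A-surjective y)

      AA⁻¹ : ∀ y → A (A⁻¹ y) ≡ y
      AA⁻¹ y = proj₂ (A-surjective y)

      A⁻¹-linear : Linear A⁻¹
      A⁻¹-linear = linear
        (λ x y → A-injective (AA⁻¹ _ ∙ sym (add A-linear _ _ ∙ cong₂ _+_ (AA⁻¹ x) (AA⁻¹ y))))
        (λ {c} x c∈ → A-injective (AA⁻¹ _ ∙ sym (hom A-linear _ c∈ ∙ cong (c *_) (AA⁻¹ x))))

      -- Each row of the matrix of `f` is read as an element of `K` in the basis `u`, as in the
      -- definition of Gabidulin codes. The map `form` below uses trace coordinates instead, in
      -- which `H` is a code of q-polynomials; `A` translates between the two.
      Λ : RawForm → Vector
      Λ f i = lc (λ l → f (e i) (e′ l)) u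

      form : Vector → RawForm
      form v x x′ = Tr (interpolate v x * x′)

      form-IsForm : ∀ v → IsForm (form v)
      form-IsForm v =
        (λ x x′ _ → Tr∈ _) ,
        (λ x y x′ _ _ → cong Tr (cong (_* x′) (add (interpolate-linear v) x y) ∙ distribʳ x′ _ _) ∙
          add Tr-linear _ _) ,
        (λ x x′ y′ _ → cong Tr (distribˡ _ x′ y′) ∙ add Tr-linear _ _) ,
        (λ c x x′ c∈ _ → cong Tr (cong (_* x′) (hom (interpolate-linear v) x c∈) ∙ *-assoc c _ x′) ∙
          hom Tr-linear _ c∈) ,
        (λ c x x′ c∈ _ → cong Tr (solve 3 (λ i c x → i :* (c :* x) := c :* (i :* x)) refl _ c x′) ∙
          hom Tr-linear _ c∈)

      Λ-form : ∀ v i → Λ (form v) i ≡ A (v i)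
      Λ-form v i = cong A (interpolate-e v i)

      Λ-cong : ∀ {f f′} → f ≈ f′ → ∀ i → Λ f i ≡ Λ f′ i
      Λ-cong eq i = sumF-cong {n} (λ l → cong (_* u l) (eq (e i) (e′ l) (e∈ i)))

      Λ-⊕ : ∀ f f′ i → Λ (f ⊕ f′) i ≡ Λ f i + Λ f′ i
      Λ-⊕ f f′ i = sumF-cong {n} (λ l → distribʳ (u l) _ _) ∙
        sumF-+ {n} (λ l → f (e i) (e′ l) * u l) (λ l → f′ (e i) (e′ l) * u l)

      Λ-· : ∀ c f i → Λ (c · f) i ≡ c * Λ f i
      Λ-· c f i = sumF-cong {n} (λ l → *-assoc _ _ _) ∙ sym (sumF-*ˡ {n} c (λ l → f (e i) (e′ l) * u l))

      ⊕-IsForm : ∀ {f f′} → IsForm f → IsForm f′ → IsForm (f ⊕ f′)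
      ⊕-IsForm (v , a , b , c , d) (v′ , a′ , b′ , c′ , d′) =
        (λ x x′ x∈ → Fq.has-+ (v x x′ x∈) (v′ x x′ x∈)) ,
        (λ x y x′ x∈ y∈ → cong₂ _+_ (a x y x′ x∈ y∈) (a′ x y x′ x∈ y∈) ∙ interchange _ _ _ _) ,
        (λ x x′ y′ x∈ → cong₂ _+_ (b x x′ y′ x∈) (b′ x x′ y′ x∈) ∙ interchange _ _ _ _) ,
        (λ k x x′ k∈ x∈ → cong₂ _+_ (c k x x′ k∈ x∈) (c′ k x x′ k∈ x∈) ∙ sym (distribˡ k _ _)) ,
        (λ k x x′ k∈ x∈ → cong₂ _+_ (d k x x′ k∈ x∈) (d′ k x x′ k∈ x∈) ∙ sym (distribˡ k _ _))
        where
        interchange : ∀ a b c d → (a + b) + (c + d) ≡ (a + c) + (b + d)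
        interchange = solve 4 (λ a b c d → (a :+ b) :+ (c :+ d) := (a :+ c) :+ (b :+ d)) refl

      ·-IsForm : ∀ {k f} → InFq k → IsForm f → IsForm (k · f)
      ·-IsForm {k} k∈ (v , a , b , c , d) =
        (λ x x′ x∈ → Fq.has-* k∈ (v x x′ x∈)) ,
        (λ x y x′ x∈ y∈ → cong (k *_) (a x y x′ x∈ y∈) ∙ distribˡ k _ _) ,
        (λ x x′ y′ x∈ → cong (k *_) (b x x′ y′ x∈) ∙ distribˡ k _ _) ,
        (λ l x x′ l∈ x∈ → cong (k *_) (c l x x′ l∈ x∈) ∙ swap k l _) ,
        (λ l x x′ l∈ x∈ → cong (k *_) (d l x x′ l∈ x∈) ∙ swap k l _)
        where
        swap : ∀ a b c → a * (b * c) ≡ b * (a * c)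
        swap = solve 3 (λ a b c → a :* (b :* c) := b :* (a :* c)) refl

      module _ {f : RawForm} (f-form : IsForm f) where
        right-linear : ∀ {x} → InFqm x → Linear (f x)
        right-linear {x} x∈ = linear (λ y z → proj₁ (proj₂ (proj₂ f-form)) x y z x∈)
          (λ {c} y c∈ → proj₂ (proj₂ (proj₂ (proj₂ f-form))) c x y c∈ x∈)

        left-sum : ∀ {d} (c b : Fin d → K) → (∀ i → InFq (c i)) → (∀ i → InFqm (b i)) →
                   ∀ x′ → f (lc c b) x′ ≡ lc c (λ i → f (b i) x′)
        left-sum {zero} c b _ _ x′ = +-cancelˡ (f 0# x′) (sym (proj₁ (proj₂ f-form) 0# 0# x′ Fqm.has-0 Fqm.has-0) ∙
            cong (λ z → f z x′) (+-identityˡ 0#) ∙ sym (+-identityʳ _))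
        left-sum {suc d} c b c∈ b∈ x′ = (proj₁ (proj₂ f-form) _ _ x′ (Fqm.has-* (Fq⊆Fqm (c∈ Fin.zero)) (b∈ Fin.zero))
            (Fqm.has-sum {d} (λ i → Fqm.has-* (Fq⊆Fqm (c∈ (Fin.suc i))) (b∈ (Fin.suc i))))) ∙
          cong₂ _+_ (proj₁ (proj₂ (proj₂ (proj₂ f-form))) _ _ x′ (c∈ Fin.zero) (b∈ Fin.zero))
            (left-sum (c ∘ Fin.suc) (b ∘ Fin.suc) (c∈ ∘ Fin.suc) (b∈ ∘ Fin.suc) x′)

      Λ-injective : ∀ {f f′} → IsForm f → IsForm f′ → (∀ i → Λ f i ≡ Λ f′ i) → f ≈ f′
      Λ-injective {f} {f′} f-form f′-form eq x x′ x∈ = begin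
        f x x′                          ≡⟨ cong (λ z → f z x′) (proj₂ (proj₂ expansion)) ⟨
        f (lc c e) x′                   ≡⟨ left-sum f-form c e c∈ e∈ x′ ⟩
        lc c (λ i → f (e i) x′)         ≡⟨ sumF-cong {m} (λ i → cong (c i *_) (on-e i)) ⟩
        lc c (λ i → f′ (e i) x′)        ≡⟨ left-sum f′-form c e c∈ e∈ x′ ⟨
        f′ (lc c e) x′                  ≡⟨ cong (λ z → f′ z x′) (proj₂ (proj₂ expansion)) ⟩
        f′ x x′                         ∎
        where
        expansion = e-spans x x∈
        c : Fin m → K
        c = proj₁ expansion
        c∈ : ∀ i → InFq (c i)
        c∈ = proj₁ (proj₂ expansion)
        on-e : ∀ i → f (e i) x′ ≡ f′ (e i) x′
        on-e i = linear-unique (proj₂ (proj₂ e′-basis)) (right-linear f-form (e∈ i)) (right-linear f′-form (e∈ i))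
          (coordinate-unique (λ l → proj₁ f-form (e i) (e′ l) (e∈ i)) (λ l → proj₁ f′-form (e i) (e′ l) (e∈ i)) (eq i)) {x′} _

      chart : RawForm → Vector
      chart f = A⁻¹ ∘ Λ f

      form-chart : ∀ {f} → IsForm f → f ≈ form (chart f)
      form-chart f-form = Λ-injective f-form (form-IsForm _) (λ i → sym (Λ-form _ i ∙ AA⁻¹ _))

      ≈-sym : ∀ {f f′} → f ≈ f′ → f′ ≈ f
      ≈-sym eq x x′ x∈ = sym (eq x x′ x∈)

      ≈-trans : ∀ {f f′ f″} → f ≈ f′ → f′ ≈ f″ → f ≈ f″
      ≈-trans eq eq′ x x′ x∈ = eq x x′ x∈ ∙ eq′ x x′ x∈

      form-cong : ∀ {v w} → (∀ i → v i ≡ w i) → form v ≈ form w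
      form-cong {v} {w} eq = Λ-injective (form-IsForm v) (form-IsForm w)
        (λ i → Λ-form v i ∙ cong A (eq i) ∙ sym (Λ-form w i))

      form-⊞ : ∀ v w → form (v ⊞ w) ≈ (form v ⊕ form w)
      form-⊞ v w = Λ-injective (form-IsForm _) (⊕-IsForm (form-IsForm v) (form-IsForm w)) (λ i → Λ-form _ i ∙
        (add A-linear _ _) ∙ sym (Λ-⊕ (form v) (form w) i ∙ cong₂ _+_ (Λ-form v i) (Λ-form w i)))

      form-· : ∀ {c} v → InFq c → form (λ i → c * v i) ≈ (c · form v)
      form-· {c} v c∈ = Λ-injective (form-IsForm _) (·-IsForm c∈ (form-IsForm v)) (λ i → Λ-form _ i ∙
        (hom A-linear _ c∈) ∙ sym (Λ-· c (form v) i ∙ cong (c *_) (Λ-form v i)))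

      -- Rank one expressed by the dimension of the radical.

      module Kernel {φ : K → K} (φ-linear : Linear φ) {V : K → Set}
                    (V⇒ : ∀ {x} → V x → InFqm x × φ x ≡ 0#) (⇒V : ∀ {x} → InFqm x → φ x ≡ 0# → V x) where

        -- All values of φ on the basis are F_q-multiples of the pivot value, so subtracting the
        -- right multiple of `b a` from each other basis vector gives a basis of the kernel.
        hyperplane : ∀ {d} (b : Fin d → K) → IsBasis InFqm b →
                     (∀ i j → φ (b i) * Fr 1 (φ (b j)) ≡ φ (b j) * Fr 1 (φ (b i))) →
                     (a : Fin d) → φ (b a) ≢ 0# → HasDim V (d ∸ 1)
        hyperplane {suc d} b (b∈ , b-independent , b-spans) rank-one a pivot≢0 =
          kernel , (λ k → ⇒V (Fqm.has-+ (b∈ _) (Fqm.has-neg (Fqm.has-* (Fq⊆Fqm (ratio∈ _)) (b∈ a)))) (φ-kernel k)) ,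
          independent , spanning
          where
          others : Fin d → Fin (suc d)
          others = Fin.punchIn a
          ratio : Fin (suc d) → K
          ratio i = φ (b i) * inv pivot≢0
          ratio∈ : ∀ i → InFq (ratio i)
          ratio∈ i = ratio-Fq pivot≢0 (rank-one i a)
          φ-b : ∀ i → φ (b i) ≡ ratio i * φ (b a)
          φ-b i = sym (ratio-* pivot≢0)
          kernel : Fin d → K
          kernel k = b (others k) − ratio (others k) * b a
          φ-kernel : ∀ k → φ (kernel k) ≡ 0#
          φ-kernel k = (additive-− (add φ-linear) _ _) ∙
            ≡⇒−≡0 (φ-b (others k) ∙ sym (hom φ-linear (b a) (ratio∈ _)))
          lc-kernel : ∀ c → lc c kernel ≡ lc c (b ∘ others) − sumF (λ k → c k * ratio (others k)) * b a
          lc-kernel c = begin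
            lc c kernel
              ≡⟨ sumF-cong {d} (λ k → solve 4 (λ c y r z → c :* (y :+ :- (r :* z)) := c :* y :+ :- (c :* r :* z)) refl
                   (c k) (b (others k)) (ratio (others k)) (b a)) ⟩
            sumF (λ k → c k * b (others k) − c k * ratio (others k) * b a)
              ≡⟨ sumF-+ {d} (λ k → c k * b (others k)) (λ k → - (c k * ratio (others k) * b a)) ⟩
            lc c (b ∘ others) + sumF (λ k → - (c k * ratio (others k) * b a))
              ≡⟨ cong (lc c (b ∘ others) +_) (sumF-additive {d} (λ x y → sym (-‿+-comm x y)) (λ k → c k * ratio (others k) * b a)) ⟨
            lc c (b ∘ others) − sumF (λ k → c k * ratio (others k) * b a)
              ≡⟨ cong (lc c (b ∘ others) −_) (sumF-*ʳ {d} (b a) (λ k → c k * ratio (others k))) ⟨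
            lc c (b ∘ others) − sumF (λ k → c k * ratio (others k)) * b a ∎
          independent : LinIndep kernel
          independent c c∈ c-kernel k = sym (insertAt-punchIn c a c₀ k) ∙
            b-independent extended extended∈ (begin
            lc extended b
              ≡⟨ sumF-punchIn a (λ i → extended i * b i) ⟩
            extended a * b a + sumF (λ k → extended (others k) * b (others k))
              ≡⟨ cong₂ _+_ (cong (_* b a) (insertAt-lookup c a c₀))
                   (sumF-cong {d} (λ k → cong (_* b (others k)) (insertAt-punchIn c a c₀ k))) ⟩
            c₀ * b a + lc c (b ∘ others)
              ≡⟨ solve 3 (λ s z l → :- s :* z :+ l := l :+ :- (s :* z)) refl _ (b a) _ ⟩
            lc c (b ∘ others) − sumF (λ k → c k * ratio (others k)) * b a
              ≡⟨ lc-kernel c ⟨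
            lc c kernel
              ≡⟨ c-kernel ⟩
            0# ∎) (others k)
            where
            c₀ : K
            c₀ = - sumF (λ k → c k * ratio (others k))
            extended : Fin (suc d) → K
            extended = insertAt c a c₀
            extended∈ : ∀ i → InFq (extended i)
            extended∈ i = by-cases (a Fin.≟ i)
              where
              by-cases : Dec (a ≡ i) → InFq (extended i)
              by-cases (yes refl) = subst InFq (sym (insertAt-lookup c a c₀))
                (Fq.has-neg (Fq.has-sum {d} (λ k → Fq.has-* (c∈ k) (ratio∈ (others k)))))
              by-cases (no a≢i) = subst (InFq ∘ extended) (Finₚ.punchIn-punchOut a≢i)
                (subst InFq (sym (insertAt-punchIn c a c₀ _)) (c∈ _))
          spanning : Spans V kernel
          spanning x x∈V = c ∘ others , (λ k → c∈ (others k)) , (begin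
            lc (c ∘ others) kernel
              ≡⟨ lc-kernel (c ∘ others) ⟩
            lc (c ∘ others) (b ∘ others) − R * b a
              ≡⟨ solve 4 (λ l R z y → l :+ :- (R :* z) := (y :* z :+ l) :+ :- ((y :+ R) :* z)) refl _ R (b a) (c a) ⟩
            (c a * b a + lc (c ∘ others) (b ∘ others)) − (c a + R) * b a
              ≡⟨ cong₂ (λ y z → y − z * b a) (sumF-punchIn a (λ i → c i * b i)) total ⟨
            lc c b − sumF (λ i → c i * ratio i) * b a
              ≡⟨ cong₂ (λ y z → y − z * b a) (proj₂ (proj₂ expansion)) total-0 ⟩
            x − 0# * b a
              ≡⟨ cong (λ z → x + - z) (zeroˡ (b a)) ∙ cong (x +_) -0#≈0# ∙ +-identityʳ x ⟩
            x ∎)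
            where
            expansion = b-spans x (proj₁ (V⇒ x∈V))
            c : Fin (suc d) → K
            c = proj₁ expansion
            c∈ : ∀ i → InFq (c i)
            c∈ = proj₁ (proj₂ expansion)
            R : K
            R = sumF (λ k → c (others k) * ratio (others k))
            total : sumF (λ i → c i * ratio i) ≡ c a + R
            total = sumF-punchIn a (λ i → c i * ratio i) ∙
              cong (_+ R) (cong (c a *_) (*-inv pivot≢0) ∙ *-identityʳ _)
            total-0 : sumF (λ i → c i * ratio i) ≡ 0#
            total-0 = *-cancelʳ-0 pivot≢0 (begin
              sumF (λ i → c i * ratio i) * φ (b a)
                ≡⟨ sumF-*ʳ {suc d} (φ (b a)) (λ i → c i * ratio i) ⟩
              sumF (λ i → c i * ratio i * φ (b a))
                ≡⟨ sumF-cong {suc d} (λ i → *-assoc _ _ _ ∙ cong (c i *_) (sym (φ-b i))) ⟩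
              lc c (φ ∘ b)
                ≡⟨ map-sum φ-linear c b c∈ ⟨
              φ (lc c b)
                ≡⟨ cong φ (proj₂ (proj₂ expansion)) ⟩
              φ x
                ≡⟨ proj₂ (V⇒ x∈V) ⟩
              0# ∎)

        -- `b i`, `b j` and the kernel basis are one vector too many for the space. A relation among
        -- them must involve `b i` or `b j`, the kernel basis being independent, and φ turns it into
        -- a proportionality of `φ (b i)` and `φ (b j)` over F_q.
        rank-one : ∀ {d} (b : Fin d → K) → IsBasis InFqm b → HasDim V (d ∸ 1) →
                   ∀ i j → φ (b i) * Fr 1 (φ (b j)) ≡ φ (b j) * Fr 1 (φ (b i))
        rank-one {suc d} b (b∈ , b-independent , b-spans) (kernel , kernel∈ , kernel-independent , _) i j =
          by-cases (c₀ ≟ 0#) (c₁ ≟ 0#)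
          where
          expansion : ∀ k → Σ (Fin (suc d) → K) λ c → (∀ l → InFq (c l)) × lc c b ≡ kernel k
          expansion k = b-spans (kernel k) (proj₁ (V⇒ (kernel∈ k)))
          rows : Fin (suc (suc d)) → Fin (suc d) → K
          rows Fin.zero = unit i
          rows (Fin.suc Fin.zero) = unit j
          rows (Fin.suc (Fin.suc k)) = proj₁ (expansion k)
          rows∈ : ∀ k l → InFq (rows k l)
          rows∈ Fin.zero = Fq.has-unit i
          rows∈ (Fin.suc Fin.zero) = Fq.has-unit j
          rows∈ (Fin.suc (Fin.suc k)) = proj₁ (proj₂ (expansion k))
          vectors : Fin (suc (suc d)) → K
          vectors Fin.zero = b i
          vectors (Fin.suc Fin.zero) = b j
          vectors (Fin.suc (Fin.suc k)) = kernel k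
          vectors≡ : ∀ k → vectors k ≡ lc (rows k) b
          vectors≡ Fin.zero = sym (sumF-unitˡ i b)
          vectors≡ (Fin.suc Fin.zero) = sym (sumF-unitˡ j b)
          vectors≡ (Fin.suc (Fin.suc k)) = sym (proj₂ (proj₂ (expansion k)))
          relation = Elimination.dependence FqField (suc d) rows rows∈
          c : Fin (suc (suc d)) → K
          c = proj₁ relation
          c∈ : ∀ k → InFq (c k)
          c∈ = proj₁ (proj₂ relation)
          c₀ c₁ : K
          c₀ = c Fin.zero
          c₁ = c (Fin.suc Fin.zero)
          combination : lc c vectors ≡ 0#
          combination = begin
            lc c vectors
              ≡⟨ sumF-cong {suc (suc d)} (λ k → cong (c k *_) (vectors≡ k) ∙
                sumF-*ˡ {suc d} (c k) (λ l → rows k l * b l)) ⟩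
            sumF (λ k → sumF (λ l → c k * (rows k l * b l)))
              ≡⟨ sumF-swap {suc (suc d)} {suc d} (λ k l → c k * (rows k l * b l)) ⟩
            sumF (λ l → sumF (λ k → c k * (rows k l * b l)))
              ≡⟨ sumF-cong {suc d} (λ l → sumF-cong {suc (suc d)} (λ k → sym (*-assoc (c k) (rows k l) (b l))) ∙
                   sym (sumF-*ʳ {suc (suc d)} (b l) (λ k → c k * rows k l))) ⟩
            lc (λ l → sumF (λ k → c k * rows k l)) b
              ≡⟨ lc-0 b (proj₂ (proj₂ (proj₂ relation))) ⟩
            0# ∎
          image : c₀ * φ (b i) + c₁ * φ (b j) ≡ 0#
          image = begin
            c₀ * φ (b i) + c₁ * φ (b j)
              ≡⟨ cong (c₀ * φ (b i) +_) (sym (+-identityʳ _) ∙ cong (c₁ * φ (b j) +_) (sym (sumF-0 {d} (λ k →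
                   cong (c (Fin.suc (Fin.suc k)) *_) (proj₂ (V⇒ (kernel∈ k))) ∙ zeroʳ _)))) ⟩
            lc c (φ ∘ vectors)
              ≡⟨ map-sum φ-linear c vectors c∈ ⟨
            φ (lc c vectors)
              ≡⟨ cong φ combination ∙ map-0 φ-linear ⟩
            0# ∎
          Φ-image : c₀ * Fr 1 (φ (b i)) + c₁ * Fr 1 (φ (b j)) ≡ 0#
          Φ-image = sym (Fr-+ 1 _ _ ∙ cong₂ _+_ (hom (Fr-linear 1) _ (c∈ _)) (hom (Fr-linear 1) _ (c∈ _))) ∙
            cong (Fr 1) image ∙ Fr-0 1
          absurd : c₀ ≡ 0# → c₁ ≡ 0# → ⊥
          absurd c₀≡0 c₁≡0 = nonzero (proj₁ (proj₂ (proj₂ relation)))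
            where
            tail-0 : ∀ k → c (Fin.suc (Fin.suc k)) ≡ 0#
            tail-0 = kernel-independent _ (λ k → c∈ _) (sym (cong₂ _+_ (cong (_* b i) c₀≡0 ∙ zeroˡ _)
              (cong (_+ tail) (cong (_* b j) c₁≡0 ∙ zeroˡ _) ∙ +-identityˡ tail) ∙ +-identityˡ tail) ∙
                combination)
              where
              tail : K
              tail = lc (λ k → c (Fin.suc (Fin.suc k))) kernel
            nonzero : (Σ (Fin (suc (suc d))) λ k → c k ≢ 0#) → ⊥
            nonzero (Fin.zero , c≢0) = c≢0 c₀≡0
            nonzero (Fin.suc Fin.zero , c≢0) = c≢0 c₁≡0
            nonzero (Fin.suc (Fin.suc k) , c≢0) = c≢0 (tail-0 k)
          x y Φx Φy : K
          x = φ (b i)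
          y = φ (b j)
          Φx = Fr 1 x
          Φy = Fr 1 y
          by-cases : Dec (c₀ ≡ 0#) → Dec (c₁ ≡ 0#) → x * Φy ≡ y * Φx
          by-cases (yes c₀≡0) (yes c₁≡0) = ⊥-elim (absurd c₀≡0 c₁≡0)
          by-cases (no c₀≢0) _ = −≡0⇒≡ (*-cancelˡ-0 c₀≢0 (begin
            c₀ * (x * Φy − y * Φx)
              ≡⟨ solve 6 (λ c d x y f g → c :* (x :* g :+ :- (y :* f)) := (c :* x :+ d :* y) :* g :+ :- (y :* (c :* f :+ d :* g)))
                   refl c₀ c₁ x y Φx Φy ⟩
            (c₀ * x + c₁ * y) * Φy − y * (c₀ * Φx + c₁ * Φy)
              ≡⟨ ≡⇒−≡0 (cong (_* Φy) image ∙ zeroˡ _ ∙ sym (cong (y *_) Φ-image ∙ zeroʳ _)) ⟩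
            0# ∎))
          by-cases _ (no c₁≢0) = −≡0⇒≡ (*-cancelˡ-0 c₁≢0 (begin
            c₁ * (x * Φy − y * Φx)
              ≡⟨ solve 6 (λ c d x y f g → d :* (x :* g :+ :- (y :* f)) := x :* (c :* f :+ d :* g) :+ :- ((c :* x :+ d :* y) :* f))
                   refl c₀ c₁ x y Φx Φy ⟩
            x * (c₀ * Φx + c₁ * Φy) − (c₀ * x + c₁ * y) * Φx
              ≡⟨ ≡⇒−≡0 (cong (x *_) Φ-image ∙ zeroʳ _ ∙ sym (cong (_* Φx) image ∙ zeroˡ _)) ⟩
            0# ∎))

      module _ {f : RawForm} (f-form : IsForm f) where
        private
          v : Vector
          v = chart f

          φ : K → K
          φ = interpolate v

          f≈ : f ≈ form v
          f≈ = form-chart f-form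

          radical⇒ : ∀ {x} → LeftRadical f x → InFqm x × φ x ≡ 0#
          radical⇒ {x} (x∈ , vanishes) = x∈ , Tr-nondegenerate (λ l → sym (f≈ x (e′ l) x∈) ∙ vanishes (e′ l))

          ⇒radical : ∀ {x} → InFqm x → φ x ≡ 0# → LeftRadical f x
          ⇒radical {x} x∈ φx≡0 = x∈ , λ x′ → f≈ x x′ x∈ ∙
            cong Tr (cong (_* x′) φx≡0 ∙ zeroˡ x′) ∙ map-0 Tr-linear

          module Ker = Kernel (interpolate-linear v) radical⇒ ⇒radical

          φ-e : ∀ i → φ (e i) ≡ v i
          φ-e = interpolate-e v

        Rank⇒RankOne : Rank f 1 → RankOne (chart f)
        Rank⇒RankOne (_ , dim) i j = cong₂ (λ a b → a * Fr 1 b) (sym (φ-e i)) (sym (φ-e j)) ∙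
          Ker.rank-one e basis dim i j ∙ cong₂ (λ a b → a * Fr 1 b) (φ-e j) (φ-e i)

        RankOne⇒Rank : RankOne (chart f) → (a : Fin m) → chart f a ≢ 0# → Rank f 1
        RankOne⇒Rank rk a va≢0 = ℕ.>-nonZero⁻¹ m , Ker.hyperplane e basis
          (λ i j → cong₂ (λ a b → a * Fr 1 b) (φ-e i) (φ-e j) ∙
            rk i j ∙ cong₂ (λ a b → a * Fr 1 b) (sym (φ-e j)) (sym (φ-e i)))
          a (λ eq → va≢0 (sym (φ-e a) ∙ eq))

    -- The given parameters and the given equivalence.

    module Inequivalence
        (k t : ℕ) (s : ℤ) (1<m : 1 < m) (m∣n : m ∣ n) (gcd≡1 : gcd k n ≡ 1)
        (1≤t : 1 ≤ t) (t≤m-2 : t ≤ m ∸ 2)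
        (s≢0 : ¬ IntCong s (ℤ.+ 0) m) (s≢1 : ¬ IntCong s (ℤ.+ 1) m)
        (μ : K) (μ≢0 : μ ≢ 0#) {{n≢0 : ℕ.NonZero n}}
        (t′ : ℕ) (1≤t′ : 1 ≤ t′) (t′≤m : t′ ≤ m) (j : ℤ) (gcd-j≡1 : gcd ℤ.∣ j ∣ n ≡ 1)
        (Γ : Fin m → K) (Γ-independent : LinIndep Γ)
        (u : Fin n → K) (u-basis : IsBasis Whole u) (e′ : Fin n → K) (e′-basis : IsBasis Whole e′)
      where
      open import Data.Integer using (+_)
      open Units m using (Unit; unit-cancel; unit-surjective; unit-*; coprime⇒unit; pred-unit; divisible≋0; ≡⇒≋)
      open IntegerExponents n

      0<m : 0 < m
      0<m = ℕₚ.<-trans ℕ.z<s 1<m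

      coprime-k : Coprime k m
      coprime-k = gcd-coprime gcd≡1 m∣n

      g ς τ J : ℕ
      -- σ = Fr g is the inverse of Fr k.
      g = ℕ.pred n ℕ.* k
      ς = intMod (s ℤ.* + k) n
      τ = g ℕ.* t ℕ.+ ς
      J = intMod j n

      g-unit : Unit g
      g-unit = unit-* {ℕ.pred n} {k} (pred-unit n m∣n) (coprime⇒unit coprime-k)

      J-unit : Unit J
      J-unit = coprime⇒unit (intMod-coprime j m∣n gcd-j≡1)

      J′ : ℕ
      J′ = ℕ.pred n ℕ.* J

      J′-unit : Unit J′
      J′-unit = unit-* {ℕ.pred n} {J} (pred-unit n m∣n) J-unit

      pred*+ : ∀ a → ℕ.pred n ℕ.* a ℕ.+ a ≡ n ℕ.* a
      pred*+ a = ℕₚ.+-comm _ a ∙ cong (ℕ._* a) (ℕₚ.suc-pred n)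

      g-injective : ∀ {i i′} → i < m → i′ < m → g ℕ.* i ≋ g ℕ.* i′ → i ≡ i′
      g-injective {i} {i′} i<m i′<m eq = sym (m<n⇒m%n≡m i<m) ∙ unit-cancel {g} g-unit {i} {i′}
        (≡⇒≋ (ℕₚ.*-comm i g) ∙ eq ∙ ≡⇒≋ (ℕₚ.*-comm g i′)) ∙ m<n⇒m%n≡m i′<m
        where open import Data.Nat.DivMod using (m<n⇒m%n≡m)

      g-surjective : ∀ r → Σ ℕ λ i → i < m × g ℕ.* i ≋ r
      g-surjective r = proj₁ found , proj₁ (proj₂ found) , ≡⇒≋ (ℕₚ.*-comm g (proj₁ found)) ∙ proj₂ (proj₂ found)
        where found = unit-surjective {g} g-unit r

      t+2≤m : t ℕ.+ 2 ≤ m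
      t+2≤m = ℕₚ.≤-trans (ℕₚ.+-monoˡ-≤ 2 t≤m-2) (ℕₚ.≤-reflexive (ℕₚ.m∸n+n≡m 1<m))

      τ≢gt : ¬ (τ ≋ g ℕ.* t)
      τ≢gt eq = s≢0 (intMod-congruence m∣n coprime-k s 0
        (≋-+-cancelˡ (g ℕ.* t) {ς} {0} (eq ∙ ≡⇒≋ (sym (ℕₚ.+-identityʳ (g ℕ.* t))))))

      -- For t = 1 the exponent τ is congruent to (s - 1) k modulo `m`, so its vanishing would mean
      -- that s is 1 modulo `m`.
      untwisted : t ≡ 1 → ¬ (τ ≋ 0)
      untwisted t≡1 eq = s≢1 (intMod-congruence m∣n coprime-k s 1 (begin
          ς % m                         ≡⟨ ≋-+ {n ℕ.* k} {0} {ς} {ς} (≡⇒≋ (ℕₚ.*-comm n k) ∙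
                                             Units.≋-* m k {n} {0} (divisible≋0 m∣n) ∙
                                               ≡⇒≋ (ℕₚ.*-zeroʳ k)) refl ⟨
          (n ℕ.* k ℕ.+ ς) % m           ≡⟨ ≡⇒≋ (cong (ℕ._+ ς) (sym (pred*+ k))) ⟩
          (g ℕ.+ k ℕ.+ ς) % m           ≡⟨ ≡⇒≋ (cong (ℕ._+ ς) (ℕₚ.+-comm g k) ∙ ℕₚ.+-assoc k g ς) ⟩
          (k ℕ.+ (g ℕ.+ ς)) % m         ≡⟨ ≡⇒≋ (cong (λ a → k ℕ.+ (a ℕ.+ ς)) (sym (cong (g ℕ.*_) t≡1 ∙
            ℕₚ.*-identityʳ g))) ⟩
          (k ℕ.+ τ) % m                 ≡⟨ ≋-+ˡ k {τ} {0} eq ⟩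
          (k ℕ.+ 0) % m                 ≡⟨ refl ⟩
          (1 ℕ.* k) % m ∎))

      -- In trace coordinates σ^t is applied to the whole coefficient `μ a^(q^(sk))` of the last
      -- term. On `μ` this gives `η`; on `a` the exponents `g * t` and `ς` add up to `τ`.
      η : K
      η = Fr (g ℕ.* t) μ

      η≢0 : η ≢ 0#
      η≢0 = Fr-nonzero (g ℕ.* t) μ≢0

      open TwistedCode g t τ η η≢0 g-injective g-surjective 1≤t t+2≤m τ≢gt
        hiding (0<m)
      open BilinearForms (ℕ.>-nonZero⁻¹ n) e′ u e′-basis u-basis

      Fr-g-k : ∀ i x → Fr (g ℕ.* i) (Fr (k ℕ.* i) x) ≡ x
      Fr-g-k i x = sym (Fr-∘ (g ℕ.* i) (k ℕ.* i) x) ∙ cong (λ a → Fr a x) exponent ∙ Fr-n* (k ℕ.* i) x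
        where
        exponent : g ℕ.* i ℕ.+ k ℕ.* i ≡ k ℕ.* i ℕ.* n
        exponent = sym (ℕₚ.*-distribʳ-+ i g k) ∙ cong (ℕ._* i) (pred*+ k) ∙
          ℕₚ.*-assoc n k i ∙ ℕₚ.*-comm n (k ℕ.* i)

      Fr-J-J′ : ∀ x → Fr J (Fr J′ x) ≡ x
      Fr-J-J′ x = sym (Fr-∘ J J′ x) ∙ cong (λ a → Fr a x)
        (ℕₚ.+-comm J J′ ∙ pred*+ J ∙ ℕₚ.*-comm n J) ∙ Fr-n* J x

      Fr-mod-n : ∀ {a b} → Congruence._≋_ n a b → ∀ x → Fr a x ≡ Fr b x
      Fr-mod-n {a} {b} eq x = reduce a ∙ cong (λ r → Fr r x) eq ∙ sym (reduce b)
        where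
        reduce : ∀ a → Fr a x ≡ Fr (a % n) x
        reduce a = cong (λ r → Fr r x) (m≡m%n+[m/n]*n a n) ∙
          (Fr-∘ (a % n) _ x) ∙ cong (Fr (a % n)) (Fr-n* (a / n) x)


      -- The trace is invariant under `Fr (g * i)`, which cancels the Frobenius power on `x′` and
      -- puts its inverse on `c` and `x`.
      fForm-linear : ∀ c i x x′ → fForm k c i x x′ ≡ Tr (Fr (g ℕ.* i) c * Fr (g ℕ.* i) x * x′)
      fForm-linear c i x x′ = begin
        Tr (c * x * Fr (k ℕ.* i) x′)                        ≡⟨ Tr-Fr (g ℕ.* i) _ ⟨
        Tr (Fr (g ℕ.* i) (c * x * Fr (k ℕ.* i) x′))         ≡⟨ cong Tr ((Fr-* (g ℕ.* i) _ _) ∙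
          cong₂ _*_ (Fr-* (g ℕ.* i) c x) (Fr-g-k i x′)) ⟩
        Tr (Fr (g ℕ.* i) c * Fr (g ℕ.* i) x * x′)           ∎

      codeword : K → (ℕ → K) → K → K
      codeword a c x = (a * x + twist a * Fr (g ℕ.* t) x) + sumN (t ∸ 1) (λ i → c i * Fr (g ℕ.* suc i) x)

      H-form : K → (ℕ → K) → RawForm
      H-form a b = (fForm k a 0 ⊕ fForm k (μ * frobℤ (s ℤ.* + k) a) t) ⊕ (λ x x′ → sumN (t ∸ 1) (λ i → fForm k (b i) (suc i) x x′))

      H-form-codeword : ∀ a b x x′ → H-form a b x x′ ≡ Tr (codeword a (λ i → Fr (g ℕ.* suc i) (b i)) x * x′)
      H-form-codeword a b x x′ = begin
        H-form a b x x′
          ≡⟨ cong₂ _+_ (cong₂ _+_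
               (fForm-linear a 0 x x′ ∙ cong (λ z → Tr (z * x′)) (cong₂ _*_ (Fr-g0 a) (Fr-g0 x)))
               (fForm-linear _ t x x′ ∙ cong (λ z → Tr (z * Fr (g ℕ.* t) x * x′)) Fr-twist))
               (sumN-cong (t ∸ 1) (λ i _ → fForm-linear (b i) (suc i) x x′)) ⟩
        Tr (a * x * x′) + Tr (twist a * Fr (g ℕ.* t) x * x′) + sumN (t ∸ 1) (λ i → Tr (term i * x′))
          ≡⟨ cong₂ _+_ (cong Tr (distribʳ x′ _ _) ∙ add Tr-linear _ _)
               (cong Tr (sumN-*ʳ (t ∸ 1) x′ term) ∙ (sumN-additive (t ∸ 1) (add Tr-linear) _)) ⟨
        Tr ((a * x + twist a * Fr (g ℕ.* t) x) * x′) + Tr (sumN (t ∸ 1) term * x′)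
          ≡⟨ cong Tr (distribʳ x′ _ _) ∙ add Tr-linear _ _ ⟨
        Tr (codeword a (λ i → Fr (g ℕ.* suc i) (b i)) x * x′) ∎
        where
        term : ℕ → K
        term i = Fr (g ℕ.* suc i) (b i) * Fr (g ℕ.* suc i) x
        Fr-g0 : ∀ y → Fr (g ℕ.* 0) y ≡ y
        Fr-g0 y = cong (λ r → Fr r y) (ℕₚ.*-zeroʳ g) ∙ Fr-zero y
        Fr-twist : Fr (g ℕ.* t) (μ * frobℤ (s ℤ.* + k) a) ≡ twist a
        Fr-twist = (Fr-* (g ℕ.* t) μ _) ∙ cong (η *_) (sym (Fr-∘ (g ℕ.* t) ς a))

      code-sum : ∀ (f : ℕ → K) → sumN (suc t) f ≡ (f 0 + f t) + sumN (t ∸ 1) (f ∘ suc)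
      code-sum f = at t 1≤t
        where
        at : ∀ t → 1 ≤ t → sumN (suc t) f ≡ (f 0 + f t) + sumN (t ∸ 1) (f ∘ suc)
        at (suc r) _ = cong (_+ f (suc r)) (sumN-suc r f) ∙
          solve 3 (λ a b c → (a :+ b) :+ c := (a :+ c) :+ b) refl (f 0) (sumN r (f ∘ suc)) (f (suc r))

      codeword-InCode : ∀ a c → InCode (codeword a c)
      codeword-InCode a c = coeffs , at-t 1≤t , λ {x} _ → sym (code-sum _ ∙ cong₂ _+_
          (cong₂ _+_ (cong (a *_) (cong (λ r → Fr r x) (ℕₚ.*-zeroʳ g) ∙ Fr-zero x))
            (cong (_* Fr (g ℕ.* t) x) (at-t 1≤t)))
          (sumN-cong (t ∸ 1) (λ i i<t-1 → cong (_* Fr (g ℕ.* suc i) x) (at-suc (suc i ℕ.≟ t)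
            (ℕₚ.<⇒≢ (before i<t-1))))))
        where
        choose : ∀ i → Dec (suc i ≡ t) → K
        choose i (yes _) = twist a
        choose i (no _) = c i
        coeffs : ℕ → K
        coeffs zero = a
        coeffs (suc i) = choose i (suc i ℕ.≟ t)
        at-suc : ∀ {i} (d : Dec (suc i ≡ t)) → suc i ≢ t → choose i d ≡ c i
        at-suc (yes eq) ≢ = ⊥-elim (≢ eq)
        at-suc (no _) _ = refl
        at-end : ∀ {i} (d : Dec (suc i ≡ t)) → suc i ≡ t → choose i d ≡ twist a
        at-end (yes _) _ = refl
        at-end (no ≢) eq = ⊥-elim (≢ eq)
        at-t : 1 ≤ t → coeffs t ≡ twist a
        at-t 1≤t = cong coeffs (sym eq) ∙ at-end (suc (ℕ.pred t) ℕ.≟ t) eq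
          where
          eq : suc (ℕ.pred t) ≡ t
          eq = ℕₚ.suc-pred t {{ℕ.>-nonZero 1≤t}}
        before : ∀ {i} → i < t ∸ 1 → suc i < t
        before {i} i<t-1 = subst (suc (suc i) ≤_) (ℕₚ.m∸n+n≡m 1≤t) (subst (_≤ t ∸ 1 ℕ.+ 1) (ℕₚ.+-comm (suc i) 1) (ℕₚ.+-monoˡ-≤ 1 i<t-1))

      H⇒code : ∀ v a b → form v ≈ H-form a b → InCode (interpolate v)
      H⇒code v a b eq with codeword-InCode a (λ i → Fr (g ℕ.* suc i) (b i))
      ... | c , coupled , expansion = c , coupled , λ {x} x∈ → Tr-injective (λ x′ → eq x x′ x∈ ∙
        H-form-codeword a b x x′) ∙ expansion x∈

      code⇒H : ∀ v → InCode (interpolate v) → H k t μ s (form v)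
      -- `Fr (k * suc i)` undoes the `Fr (g * suc i)` that the passage to trace coordinates puts on
      -- the free coefficients.
      code⇒H v (c , coupled , expansion) = form-IsForm v , c 0 , (λ i → Fr (k ℕ.* suc i) (c (suc i))) , λ x x′ x∈ → begin
        Tr (interpolate v x * x′)
          ≡⟨ cong (λ z → Tr (z * x′)) (expansion x∈ ∙ code-sum _ ∙ cong₂ _+_
               (cong₂ _+_ (cong (c 0 *_) (cong (λ r → Fr r x) (ℕₚ.*-zeroʳ g) ∙ Fr-zero x))
                 (cong (_* Fr (g ℕ.* t) x) coupled))
               (sumN-cong (t ∸ 1) (λ i _ → cong (_* Fr (g ℕ.* suc i) x) (sym (Fr-g-k (suc i) (c (suc i))))))) ⟩
        Tr (codeword (c 0) (λ i → Fr (g ℕ.* suc i) (Fr (k ℕ.* suc i) (c (suc i)))) x * x′)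
          ≡⟨ H-form-codeword (c 0) (λ i → Fr (k ℕ.* suc i) (c (suc i))) x x′ ⟨
        H-form (c 0) (λ i → Fr (k ℕ.* suc i) (c (suc i))) x x′ ∎

      Gabidulin : RawForm → Set
      Gabidulin f = IsForm f × Σ (Fin t′ → K) λ c → ∀ i →
        sumF (λ l → f (e i) (e′ l) * u l) ≡ sumF (λ r → c r * frobℤ (j ℤ.* + toℕ r) (Γ i))

      frobℤ-Fr : ∀ r x → frobℤ (j ℤ.* + r) x ≡ Fr (r ℕ.* J) x
      frobℤ-Fr r x = Fr-mod-n (intMod-multiple j r) x

      Gabidulin⇒ : ∀ {f} → Gabidulin f → InGabidulin t′ J Γ (Λ f)
      Gabidulin⇒ (_ , c , expansion) = ext c , λ i → expansion i ∙
        sumF-ext c (λ r → frobℤ (j ℤ.* + r) (Γ i)) ∙ sumN-cong t′ (λ r _ → cong (ext c r *_) (frobℤ-Fr r (Γ i)))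

      ⇒Gabidulin : ∀ {f} → IsForm f → InGabidulin t′ J Γ (Λ f) → Gabidulin f
      ⇒Gabidulin f-form (c , expansion) = f-form , c ∘ toℕ , λ i → expansion i ∙
        (sumN≡sumF t′ _) ∙ sumF-cong {t′} (λ r → cong (c (toℕ r) *_) (sym (frobℤ-Fr (toℕ r) (Γ i))))

      m≤n : m ≤ n
      m≤n = ∣⇒≤ m∣n

      -- Two elements `u₀`, `u₁` of F_q satisfy the relation `u₁ * u₀ − u₀ * u₁ = 0` over F_q, so an
      -- independent pair cannot lie in F_q.
      outside-Fq : Σ K λ θ → ¬ InFq θ
      outside-Fq = find n u (proj₁ (proj₂ u-basis)) (ℕₚ.<-≤-trans 1<m m≤n)
        where
        find : ∀ d (u : Fin d → K) → LinIndep u → 1 < d → Σ K λ θ → ¬ InFq θ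
        find (suc zero) _ _ (ℕ.s≤s ())
        find (suc (suc d)) u independent _ = by-cases (pow u₀ q ≟ u₀) (pow u₁ q ≟ u₁)
          where
          u₀ u₁ : K
          u₀ = u Fin.zero
          u₁ = u (Fin.suc Fin.zero)
          by-cases : Dec (InFq u₀) → Dec (InFq u₁) → Σ K λ θ → ¬ InFq θ
          by-cases (no ∉) _ = u₀ , ∉
          by-cases _ (no ∉) = u₁ , ∉
          by-cases (yes u₀∈) (yes u₁∈) = ⊥-elim (independent-nonzero u independent (Fin.suc Fin.zero)
            (independent c c∈ relation Fin.zero))
            where
            c : Fin (suc (suc d)) → K
            c Fin.zero = u₁
            c (Fin.suc Fin.zero) = - u₀
            c (Fin.suc (Fin.suc _)) = 0#
            c∈ : ∀ i → InFq (c i)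
            c∈ Fin.zero = u₁∈
            c∈ (Fin.suc Fin.zero) = Fq.has-neg u₀∈
            c∈ (Fin.suc (Fin.suc _)) = Fq.has-0
            relation : lc c u ≡ 0#
            relation = cong (λ z → u₁ * u₀ + (- u₀ * u₁ + z)) (sumF-0 {d} (λ i → zeroˡ (u (Fin.suc (Fin.suc i))))) ∙
              solve 3 (λ a b z → a :* b :+ (:- b :* a :+ z) := z) refl u₁ u₀ 0#

      o : Fin m
      o = Fin.fromℕ< 0<m

      module _ (C : RawForm → Set) (C⇔Gabidulin : ∀ f → (C f → Gabidulin f) × (Gabidulin f → C f))
               (T : RawForm → RawForm) (T-aut : IsAut T)
               (image : ∀ f → (C f → Σ RawForm λ f₀ → H k t μ s f₀ × T f₀ ≈ f) × ((Σ RawForm λ f₀ → H k t μ s f₀ × T f₀ ≈ f) → C f)) where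

        T-form : ∀ f → IsForm f → IsForm (T f)
        T-form = proj₁ T-aut

        T-cong : ∀ {f f′} → IsForm f → IsForm f′ → f ≈ f′ → T f ≈ T f′
        T-cong = proj₁ (proj₂ T-aut) _ _

        T-⊕ : ∀ f f′ → IsForm f → IsForm f′ → T (f ⊕ f′) ≈ (T f ⊕ T f′)
        T-⊕ = proj₁ (proj₂ (proj₂ T-aut))

        semilinear : Σ (K → K) λ σ → IsFqAut σ × (∀ c f → InFq c → IsForm f → T (c · f) ≈ (σ c · T f))
        semilinear = proj₁ (proj₂ (proj₂ (proj₂ T-aut)))

        σ : K → K
        σ = proj₁ semilinear

        σ-aut : IsFqAut σ
        σ-aut = proj₁ (proj₂ semilinear)

        T-injective : ∀ {f f′} → IsForm f → IsForm f′ → T f ≈ T f′ → f ≈ f′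
        T-injective = proj₁ (proj₂ (proj₂ (proj₂ (proj₂ T-aut)))) _ _

        T-surjective : ∀ f → IsForm f → Σ RawForm λ f₀ → IsForm f₀ × T f₀ ≈ f
        T-surjective = proj₁ (proj₂ (proj₂ (proj₂ (proj₂ (proj₂ T-aut)))))

        T-Rank⇒ : ∀ {f r} → IsForm f → Rank f r → Rank (T f) r
        T-Rank⇒ f-form = Equivalence.to (proj₂ (proj₂ (proj₂ (proj₂ (proj₂ (proj₂ T-aut))))) _ _ f-form)

        T-Rank⇐ : ∀ {f r} → IsForm f → Rank (T f) r → Rank f r
        T-Rank⇐ f-form = Equivalence.from (proj₂ (proj₂ (proj₂ (proj₂ (proj₂ (proj₂ T-aut))))) _ _ f-form)

        -- Trace coordinates on the source, where `H` is the twisted code, and `Λ` coordinates on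
        -- the target, where `C` is Gabidulin. The charts differ by the linear bijection `A`, which
        -- respects `RankOne`.
        T̂ T̂⁻¹ : Vector → Vector
        T̂ v = Λ (T (form v))

        preimage : ∀ w → Σ RawForm λ f → IsForm f × T f ≈ form (A⁻¹ ∘ w)
        preimage w = T-surjective (form (A⁻¹ ∘ w)) (form-IsForm _)

        T̂⁻¹ w = chart (proj₁ (preimage w))

        Tform : ∀ v → IsForm (T (form v))
        Tform v = T-form (form v) (form-IsForm v)

        T̂-cong : ∀ {v w} → (∀ i → v i ≡ w i) → ∀ i → T̂ v i ≡ T̂ w i
        T̂-cong {v} {w} eq = Λ-cong (T-cong (form-IsForm v) (form-IsForm w) (form-cong eq))

        T̂-injective : ∀ {v w} → (∀ i → T̂ v i ≡ T̂ w i) → ∀ i → v i ≡ w i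
        T̂-injective {v} {w} eq i = A-injective (sym (Λ-form v i) ∙ Λ-cong
          (T-injective (form-IsForm v) (form-IsForm w) (Λ-injective (Tform v) (Tform w) eq)) i ∙ Λ-form w i)

        T̂T̂⁻¹ : ∀ w i → T̂ (T̂⁻¹ w) i ≡ w i
        T̂T̂⁻¹ w i = Λ-cong (≈-trans (≈-sym (T-cong (proj₁ (proj₂ (preimage w))) (form-IsForm _)
          (form-chart (proj₁ (proj₂ (preimage w)))))) (proj₂ (proj₂ (preimage w)))) i ∙ Λ-form _ i ∙ AA⁻¹ (w i)

        T̂⁻¹T̂ : ∀ v i → T̂⁻¹ (T̂ v) i ≡ v i
        T̂⁻¹T̂ v = T̂-injective (T̂T̂⁻¹ (T̂ v))

        T̂⁻¹-cong : ∀ {v w} → (∀ i → v i ≡ w i) → ∀ i → T̂⁻¹ v i ≡ T̂⁻¹ w i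
        T̂⁻¹-cong {v} {w} eq = T̂-injective (λ i → T̂T̂⁻¹ v i ∙ eq i ∙ sym (T̂T̂⁻¹ w i))

        T̂-+ : ∀ v w i → T̂ (v ⊞ w) i ≡ T̂ v i + T̂ w i
        T̂-+ v w i = Λ-cong (≈-trans (T-cong (form-IsForm _) (⊕-IsForm (form-IsForm v) (form-IsForm w)) (form-⊞ v w))
          (T-⊕ (form v) (form w) (form-IsForm v) (form-IsForm w))) i ∙ Λ-⊕ (T (form v)) (T (form w)) i

        T̂-hom : ∀ {c} v → InFq c → ∀ i → T̂ (λ l → c * v l) i ≡ σ c * T̂ v i
        T̂-hom {c} v c∈ i = Λ-cong (≈-trans (T-cong (form-IsForm _) (·-IsForm c∈ (form-IsForm v)) (form-· v c∈))
          (proj₂ (proj₂ semilinear) c (form v) c∈ (form-IsForm v))) i ∙ Λ-· (σ c) (T (form v)) i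

        chart-form : ∀ v i → chart (form v) i ≡ v i
        chart-form v i = A-injective (AA⁻¹ _ ∙ Λ-form v i)

        RankOne-0 : ∀ {v} → (∀ i → v i ≡ 0#) → RankOne v
        RankOne-0 {v} v≡0 i l = cong (_* Fr 1 (v l)) (v≡0 i) ∙ zeroˡ _ ∙
          sym (cong (_* Fr 1 (v i)) (v≡0 l) ∙ zeroˡ _)

        T̂-0 : ∀ {v} → (∀ i → v i ≡ 0#) → ∀ i → T̂ v i ≡ 0#
        T̂-0 {v} v≡0 i = T̂-cong v≡0 i ∙ +-cancelˡ (T̂ (λ _ → 0#) i)
          (sym (T̂-+ _ _ i) ∙ T̂-cong (λ _ → +-identityˡ 0#) i ∙ sym (+-identityʳ _))

        -- The zero vector is treated apart: it satisfies `RankOne`, but the form it represents does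
        -- not have rank 1.
        T̂-rank : ∀ {v} → RankOne v → RankOne (T̂ v)
        T̂-rank {v} rk = by-cases (nonzero-entry v)
          where
          by-cases : (∀ i → v i ≡ 0#) ⊎ (Σ (Fin m) λ i → v i ≢ 0#) → RankOne (T̂ v)
          by-cases (inj₁ v≡0) = RankOne-0 (T̂-0 v≡0)
          by-cases (inj₂ (a , va≢0)) = RankOne-cong (λ i → AA⁻¹ _) (linear-RankOne A-linear
            (Rank⇒RankOne (Tform v) (T-Rank⇒ (form-IsForm v) (RankOne⇒Rank (form-IsForm v)
              (RankOne-cong (λ i → sym (chart-form v i)) rk) a (λ eq → va≢0 (sym (chart-form v a) ∙ eq))))))

        T̂-rank⁻¹ : ∀ {v} → RankOne (T̂ v) → RankOne v
        T̂-rank⁻¹ {v} rk = by-cases (nonzero-entry (T̂ v))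
          where
          by-cases : (∀ i → T̂ v i ≡ 0#) ⊎ (Σ (Fin m) λ i → T̂ v i ≢ 0#) → RankOne v
          by-cases (inj₁ T̂v≡0) = RankOne-0 (T̂-injective {v} {λ _ → 0#} (λ i → T̂v≡0 i ∙
            sym (T̂-0 (λ _ → refl) i)))
          by-cases (inj₂ (a , ≢0)) = RankOne-cong (chart-form v) (Rank⇒RankOne (form-IsForm v)
            (T-Rank⇐ (form-IsForm v) (RankOne⇒Rank (Tform v) (linear-RankOne A⁻¹-linear rk) a
              (λ eq → ≢0 (sym (AA⁻¹ _) ∙ cong A eq ∙ map-0 A-linear)))))

        code⇒gabidulin : ∀ v → InCode (interpolate v) → InGabidulin t′ J Γ (T̂ v)
        code⇒gabidulin v v∈ = Gabidulin⇒ (proj₁ (C⇔Gabidulin (T (form v)))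
          (proj₂ (image (T (form v))) (form v , code⇒H v v∈ , λ _ _ _ → refl)))

        gabidulin⇒code : ∀ v → InGabidulin t′ J Γ (T̂ v) → InCode (interpolate v)
        gabidulin⇒code v v∈ = finish (proj₁ (image (T (form v))) (proj₂ (C⇔Gabidulin (T (form v))) (⇒Gabidulin (Tform v) v∈)))
          where
          -- The word of `H` supplied by the equivalence is some `f₀`; injectivity of `T` identifies
          -- it with `form v` up to `≈`.
          finish : (Σ RawForm λ f₀ → H k t μ s f₀ × T f₀ ≈ T (form v)) → InCode (interpolate v)
          finish (f₀ , (f₀-form , a , b , f₀≈) , Tf₀≈) = H⇒code v a b
            (≈-trans (≈-sym (T-injective f₀-form (form-IsForm v) Tf₀≈)) f₀≈)

        σ-0 : σ 0# ≡ 0#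
        σ-0 = +-cancelˡ (σ 0#) (sym (proj₁ (proj₂ σ-aut) 0# 0# Fq.has-0 Fq.has-0) ∙
          cong σ (+-identityˡ 0#) ∙ sym (+-identityʳ _))

        σ-surjective : ∀ {c} → InFq c → Σ K λ d → InFq d × σ d ≡ c
        σ-surjective {c} = proj₂ (proj₂ (proj₂ (proj₂ σ-aut))) c

        contradiction : ⊥
        contradiction = CodeEquivalence.not-equivalent untwisted (proj₂ outside-Fq) o T̂ T̂⁻¹ σ
          T̂-cong T̂⁻¹-cong T̂-+ T̂-hom (λ c∈ → proj₁ σ-aut _ c∈) T̂⁻¹T̂ T̂T̂⁻¹ T̂-rank T̂-rank⁻¹
          t′ 1≤t′ t′≤m J Γ code⇒gabidulin gabidulin⇒code
          (λ {i} {l} → unit-cancel {J} J-unit {i} {l}) (unit-surjective {J} J-unit) Γ-independent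
          J′ Fr-J-J′ (λ {i} {l} → unit-cancel {J′} J′-unit {i} {l}) (unit-surjective {J′} J′-unit)
          σ-0 σ-surjective u u-basis m≤n

-- Positivity of n, and the conclusion.

-- For n = 0 the field would have a single element, against `0≢1`.
nonempty-exponent : ∀ {N n} (F : Field) → Field.Carrier F ↔ Fin (N ^ n) → ℕ.NonZero n
nonempty-exponent {n = suc n} _ _ = _
nonempty-exponent {n = zero} F enumeration = ⊥-elim (Field.0≢1 F (begin
  Field.0# F                    ≡⟨ Inverse.inverseʳ enumeration refl ⟨
  from (to (Field.0# F))        ≡⟨ cong from (Fin1 _ _) ⟩
  from (to (Field.1# F))        ≡⟨ Inverse.inverseʳ enumeration refl ⟩
  Field.1# F                    ∎))
  where
  open Inverse enumeration using (to; from)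
  Fin1 : (i j : Fin 1) → i ≡ j
  Fin1 Fin.zero Fin.zero = refl

open import Data.Nat using (ℕ; _^_; _*_; _≤_; _<_; _∸_)
open import Data.Nat.Divisibility using (_∣_)
open import Data.Nat.Primality using (Prime)
open import Data.Nat.GCD using (gcd)
open import Data.Integer using (ℤ; +_) renaming (_*_ to _*ℤ_; _-_ to _-ℤ_; -_ to -ℤ_)
open import Data.Fin using (Fin)
open import Data.Product using (Σ; _×_)
open import Function.Bundles using (_↔_)
open import Relation.Binary.PropositionalEquality using (_≡_; _≢_)
open import Relation.Nullary using (¬_)

theorem5p5 : (p h m n k t : ℕ) (s : ℤ) → Prime p → 1 ≤ h →
    1 < m → m ∣ n →
    1 ≤ k → gcd k n ≡ 1 →
    1 ≤ t → t ≤ m ∸ 2 →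
    ¬ IntCong s (+ 0) m → ¬ IntCong s (+ 1) m → ¬ IntCong s (-ℤ (+ 1)) m →
    ¬ IntCong s (+ 2) m → ¬ IntCong s (-ℤ (+ 2)) m →
    gcdℤ n ((s *ℤ (+ k)) -ℤ (+ t)) < m →
    (F : Field) → (Field.Carrier F ↔ Fin ((p ^ h) ^ n)) →
    (μ : Field.Carrier F) → μ ≢ Field.0# F →
    Setup.Norm F (p ^ h) n m μ ≢ Setup.pow F (p ^ h) n m (Field.-_ F (Field.1# F)) (n * t) →
    (C : Setup.RawForm F (p ^ h) n m → Set) →
    Setup.IsGeneralizedGabidulin F (p ^ h) n m C →
    ¬ Setup.Equivalent F (p ^ h) n m (Setup.H F (p ^ h) n m k t μ s) C
theorem5p5 p h m n k t s p-prime _ 1<m m∣n _ gcd≡1 1≤t t≤m-2 s≢0 s≢1 _ _ _ _ F enumeration μ μ≢0 _ C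
    (t′ , 1≤t′ , t′≤m , j , gcd-j≡1 , Γ , Γ-independent , u , u-basis , e , e-basis , e′ , e′-basis , C⇔)
    (T , T-aut , image) =
  -- The bases of F_{q^m} and of K used throughout are those that come with the Gabidulin code.
  FiniteField.Coefficients.Inequivalence.contradiction F p h n m p-prime enumeration
    {{ℕ.>-nonZero (ℕₚ.<-trans ℕ.z<s 1<m)}} e e-basis
    k t s 1<m m∣n gcd≡1 1≤t t≤m-2 s≢0 s≢1 μ μ≢0 {{nonempty-exponent F enumeration}}
    t′ 1≤t′ t′≤m j gcd-j≡1 Γ Γ-independent u u-basis e′ e′-basis
    C (λ f → Equivalence.to (C⇔ f) , Equivalence.from (C⇔ f))
    T T-aut (λ f → Equivalence.to (image f) , Equivalence.from (image f))
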